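{- Let $H$ and $F$ be two fixed graphs with $\chi(H)>\chi(F)\ge 2$, let $c$ be a real number with \[ c>\frac{\chi(F)-1}{\chi(H)-1}, \] and let $\varepsilon>0$. Then there exist constants $\eta>0$ and $n_0$ such that the following holds for all $n\ge n_0$. Suppose that $G$ is an $H$-free graph on $n$ vertices and contains a vertex subset $M$ of size $m$ with \[ \frac{m}{n}\ge c \] such that $G[M]$ contains at most $\eta m^{v(F)}$ copies of $F$. Then \[ e(G)\le m(n-m)+\left(1-\frac{1}{\chi(F)-1}\right)\binom{m}{2}+\left(1-\frac{1}{\chi(H)-\chi(F)}\right)\binom{n-m}{2}+\varepsilon n^2 . \]
   Context: All graphs are finite, simple and undirected; $v(G)$ and $e(G)$ are the numbers of vertices and edges of $G$, $\chi$ is the chromatic number, and $G[M]$ is the subgraph induced by $M\subseteq V(G)$. A graph is $H$-free if it contains no (not necessarily induced) subgraph isomorphic to $H$. A copy of $F$ in a graph is a (not necessarily induced) subgraph isomorphic to $F$. -}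

module Defs where

open import Data.Bool using (Bool; T; T?)
open import Data.Fin as Fin using (Fin; finToFun; funToFin)
open import Data.Fin.Properties using (any?; all?; finToFun-funToFin)
open import Data.Fin.Subset using (Subset; _∈_; ∣_∣; inside; outside)
open import Data.Fin.Subset.Properties using (_∈?_)
open import Data.Integer using (+_)
open import Data.List using (List; []; _∷_; allFin; cartesianProduct; cartesianProductWith; filter; length)
open import Data.Nat as ℕ using (ℕ; zero; suc; _∸_; NonZero; s≤s; _⊔_)
import Data.Nat.Properties as ℕ
open import Data.Product using (∃; _×_; _,_; proj₁; proj₂)
open import Data.Rational using (ℚ; 0ℚ; 1ℚ; ½; _+_; _-_; _*_; _<_; _≤_; _/_; 1/_; Positive; positive; nonNegative) renaming (∣_∣ to abs; NonZero to ℚNonZero)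
import Data.Rational.Properties as ℚ
open import Data.Rational.Solver using (module +-*-Solver)
open import Data.Vec as Vec using (Vec; lookup)
open import Function using (_∘_; id; _⇔_; mk⇔; Injective; Equivalence)
open import Relation.Binary using (Symmetric; Decidable)
open import Relation.Binary.PropositionalEquality
open import Relation.Nullary using (¬_; Dec; yes; no; ¬?)
open import Relation.Nullary.Decidable using (map′; _×-dec_; _→-dec_)
import Relation.Unary as U

-- Reals are Cauchy sequences of rationals, not quotiented: only their
-- order is used, and _<ℝ_ is invariant under equivalence of sequences.

IsCauchy : (ℕ → ℚ) → Set
IsCauchy x = ∀ ε → 0ℚ < ε → ∃ λ N → ∀ m n → N ℕ.≤ m → N ℕ.≤ n → abs (x m - x n) ≤ ε

record ℝ : Set where
  constructor mkℝ
  field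
    seq    : ℕ → ℚ
    cauchy : IsCauchy seq

open ℝ public

infix  4 _<ℝ_ _≤ℝ_
infixl 6 _+ℝ_
infixl 7 _*ℝ_

_<ℝ_ : ℝ → ℝ → Set
x <ℝ y = ∃ λ δ → 0ℚ < δ × ∃ λ N → ∀ n → N ℕ.≤ n → seq x n + δ ≤ seq y n

_≤ℝ_ : ℝ → ℝ → Set
x ≤ℝ y = ¬ (y <ℝ x)

fromℚ : ℚ → ℝ
fromℚ q = mkℝ (λ _ → q) λ ε 0<ε → 0 , λ _ _ _ _ →
  subst (λ d → abs d ≤ ε) (sym (ℚ.+-inverseʳ q)) (ℚ.<⇒≤ 0<ε)

0ℝ : ℝ
0ℝ = fromℚ 0ℚ

private
  ½-pos : ∀ {ε} → 0ℚ < ε → 0ℚ < ½ * ε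
  ½-pos {ε} 0<ε = ℚ.positive⁻¹ (½ * ε) {{ℚ.pos*pos⇒pos ½ ε {{positive 0<ε}}}}

  halves : ∀ ε → ½ * ε + ½ * ε ≡ ε
  halves ε = trans (sym (ℚ.*-distribʳ-+ ε ½ ½)) (ℚ.*-identityˡ ε)

  +-rearrange : ∀ a b c d → (a + c) - (b + d) ≡ (a - b) + (c - d)
  +-rearrange = solve 4 (λ a b c d → (a :+ c) :- (b :+ d) := (a :- b) :+ (c :- d)) refl
    where open +-*-Solver

  *-rearrange : ∀ a b c d → a * c - b * d ≡ a * (c - d) + (a - b) * d
  *-rearrange = solve 4 (λ a b c d → a :* c :- b :* d := a :* (c :- d) :+ (a :- b) :* d) refl
    where open +-*-Solver

  split : ∀ a b → a ≡ (a - b) + b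
  split = solve 2 (λ a b → a := (a :- b) :+ b) refl
    where open +-*-Solver

  cauchy⇒bounded : ∀ x → IsCauchy x →
                   ∃ λ K → 0ℚ < K × ∃ λ N → ∀ n → N ℕ.≤ n → abs (x n) ≤ K
  cauchy⇒bounded x cx with cx 1ℚ (ℚ.positive⁻¹ 1ℚ)
  ... | N , close = 1ℚ + abs (x N) , K-pos , N , bound
    where
    K-pos : 0ℚ < 1ℚ + abs (x N)
    K-pos = ℚ.+-mono-<-≤ (ℚ.positive⁻¹ 1ℚ) (ℚ.0≤∣p∣ (x N))

    bound : ∀ n → N ℕ.≤ n → abs (x n) ≤ 1ℚ + abs (x N)
    bound n N≤n = begin
      abs (x n)                      ≡⟨ cong abs (split (x n) (x N)) ⟩
      abs ((x n - x N) + x N)        ≤⟨ ℚ.∣p+q∣≤∣p∣+∣q∣ (x n - x N) (x N) ⟩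
      abs (x n - x N) + abs (x N)    ≤⟨ ℚ.+-monoˡ-≤ (abs (x N)) (close n N N≤n ℕ.≤-refl) ⟩
      1ℚ + abs (x N)                 ∎
      where open ℚ.≤-Reasoning

  *-mono-≤ : ∀ p q r s → 0ℚ ≤ p → 0ℚ ≤ s → p ≤ q → r ≤ s → p * r ≤ q * s
  *-mono-≤ p q r s 0≤p 0≤s p≤q r≤s = ℚ.≤-trans
    (ℚ.*-monoˡ-≤-nonNeg p {{nonNegative 0≤p}} r≤s)
    (ℚ.*-monoʳ-≤-nonNeg s {{nonNegative 0≤s}} p≤q)

_+ℝ_ : ℝ → ℝ → ℝ
x +ℝ y = mkℝ (λ n → seq x n + seq y n) λ ε 0<ε →
  let N₁ , p = cauchy x (½ * ε) (½-pos 0<ε)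
      N₂ , q = cauchy y (½ * ε) (½-pos 0<ε)
  in N₁ ⊔ N₂ , λ m n N≤m N≤n → let open ℚ.≤-Reasoning in begin
    abs ((seq x m + seq y m) - (seq x n + seq y n))
      ≡⟨ cong abs (+-rearrange (seq x m) (seq x n) (seq y m) (seq y n)) ⟩
    abs ((seq x m - seq x n) + (seq y m - seq y n))
      ≤⟨ ℚ.∣p+q∣≤∣p∣+∣q∣ (seq x m - seq x n) (seq y m - seq y n) ⟩
    abs (seq x m - seq x n) + abs (seq y m - seq y n)
      ≤⟨ ℚ.+-mono-≤ (p m n (ℕ.m⊔n≤o⇒m≤o N₁ N₂ N≤m) (ℕ.m⊔n≤o⇒m≤o N₁ N₂ N≤n))
                    (q m n (ℕ.m⊔n≤o⇒n≤o N₁ N₂ N≤m) (ℕ.m⊔n≤o⇒n≤o N₁ N₂ N≤n)) ⟩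
    ½ * ε + ½ * ε
      ≡⟨ halves ε ⟩
    ε ∎

private
  tolerance : ∀ K L ε → 0ℚ < K → 0ℚ < L → 0ℚ < ε →
              ∃ λ δ → 0ℚ < δ × K * δ + δ * L ≡ ε
  tolerance K L ε 0<K 0<L 0<ε = 1/ (K + L) * ε , δ-pos , eq
    where
    instance
      K+L-pos : Positive (K + L)
      K+L-pos = positive (ℚ.+-mono-< 0<K 0<L)
      K+L-nonZero : ℚNonZero (K + L)
      K+L-nonZero = ℚ.pos⇒nonZero (K + L)

    δ-pos : 0ℚ < 1/ (K + L) * ε
    δ-pos = ℚ.positive⁻¹ (1/ (K + L) * ε)
      {{ℚ.pos*pos⇒pos (1/ (K + L)) {{ℚ.1/pos⇒pos (K + L)}} ε {{positive 0<ε}}}}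

    eq : K * (1/ (K + L) * ε) + 1/ (K + L) * ε * L ≡ ε
    eq = begin
      K * (1/ (K + L) * ε) + 1/ (K + L) * ε * L      ≡⟨ cong (λ z → K * (1/ (K + L) * ε) + z) (ℚ.*-comm (1/ (K + L) * ε) L) ⟩
      K * (1/ (K + L) * ε) + L * (1/ (K + L) * ε)    ≡⟨ ℚ.*-distribʳ-+ (1/ (K + L) * ε) K L ⟨
      (K + L) * (1/ (K + L) * ε)                     ≡⟨ ℚ.*-assoc (K + L) (1/ (K + L)) ε ⟨
      (K + L) * 1/ (K + L) * ε                       ≡⟨ cong (_* ε) (ℚ.*-inverseʳ (K + L)) ⟩
      1ℚ * ε                                         ≡⟨ ℚ.*-identityˡ ε ⟩
      ε                                              ∎
      where open ≡-Reasoning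

  product-close : ∀ a b c d K L δ → 0ℚ < δ → 0ℚ < L →
                  abs a ≤ K → abs d ≤ L → abs (c - d) ≤ δ → abs (a - b) ≤ δ →
                  abs (a * c - b * d) ≤ K * δ + δ * L
  product-close a b c d K L δ 0<δ 0<L a≤K d≤L cd ab = begin
    abs (a * c - b * d)
      ≡⟨ cong abs (*-rearrange a b c d) ⟩
    abs (a * (c - d) + (a - b) * d)
      ≤⟨ ℚ.∣p+q∣≤∣p∣+∣q∣ (a * (c - d)) ((a - b) * d) ⟩
    abs (a * (c - d)) + abs ((a - b) * d)
      ≡⟨ cong₂ _+_ (ℚ.∣p*q∣≡∣p∣*∣q∣ a (c - d)) (ℚ.∣p*q∣≡∣p∣*∣q∣ (a - b) d) ⟩
    abs a * abs (c - d) + abs (a - b) * abs d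
      ≤⟨ ℚ.+-mono-≤ (*-mono-≤ (abs a) K (abs (c - d)) δ (ℚ.0≤∣p∣ a) (ℚ.<⇒≤ 0<δ) a≤K cd)
                    (*-mono-≤ (abs (a - b)) δ (abs d) L (ℚ.0≤∣p∣ (a - b)) (ℚ.<⇒≤ 0<L) ab d≤L) ⟩
    K * δ + δ * L ∎
    where open ℚ.≤-Reasoning

_*ℝ_ : ℝ → ℝ → ℝ
x *ℝ y = mkℝ (λ n → seq x n * seq y n) λ ε 0<ε →
  let K , 0<K , M₁ , bx = cauchy⇒bounded (seq x) (cauchy x)
      L , 0<L , M₂ , by = cauchy⇒bounded (seq y) (cauchy y)
      δ , 0<δ , eq      = tolerance K L ε 0<K 0<L 0<ε
      N₁ , p            = cauchy x δ 0<δ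
      N₂ , q            = cauchy y δ 0<δ
      N                 = (M₁ ⊔ M₂) ⊔ (N₁ ⊔ N₂)
      M₁≤N              = ℕ.≤-trans (ℕ.m≤m⊔n M₁ M₂) (ℕ.m≤m⊔n (M₁ ⊔ M₂) (N₁ ⊔ N₂))
      M₂≤N              = ℕ.≤-trans (ℕ.m≤n⊔m M₁ M₂) (ℕ.m≤m⊔n (M₁ ⊔ M₂) (N₁ ⊔ N₂))
      N₁≤N              = ℕ.≤-trans (ℕ.m≤m⊔n N₁ N₂) (ℕ.m≤n⊔m (M₁ ⊔ M₂) (N₁ ⊔ N₂))
      N₂≤N              = ℕ.≤-trans (ℕ.m≤n⊔m N₁ N₂) (ℕ.m≤n⊔m (M₁ ⊔ M₂) (N₁ ⊔ N₂))
  in N , λ m n N≤m N≤n →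
    subst (abs (seq x m * seq y m - seq x n * seq y n) ≤_) eq
      (product-close (seq x m) (seq x n) (seq y m) (seq y n) K L δ 0<δ 0<L
        (bx m (ℕ.≤-trans M₁≤N N≤m))
        (by n (ℕ.≤-trans M₂≤N N≤n))
        (q m n (ℕ.≤-trans N₂≤N N≤m) (ℕ.≤-trans N₂≤N N≤n))
        (p m n (ℕ.≤-trans N₁≤N N≤m) (ℕ.≤-trans N₁≤N N≤n)))

fromℕ : ℕ → ℚ
fromℕ k = + k / 1

∸-nonZero : ∀ {a b} → a ℕ.< b → NonZero (b ∸ a)
∸-nonZero a<b = ℕ.>-nonZero (ℕ.m<n⇒0<n∸m a<b)

record Graph (n : ℕ) : Set where
  field
    adj    : Fin n → Fin n → Bool

  Adj : Fin n → Fin n → Set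
  Adj u v = T (adj u v)

  field
    symmetric   : Symmetric Adj
    irreflexive : ∀ v → ¬ Adj v v

  Adj? : Decidable Adj
  Adj? u v = T? (adj u v)

open Graph public using (Adj; Adj?)

e : ∀ {n} → Graph n → ℕ
e {n} G = length (filter (λ (u , v) → (u Fin.<? v) ×-dec Adj? G u v)
                         (cartesianProduct (allFin n) (allFin n)))

-- The increasing enumeration of the elements of a subset.
element : ∀ {n} (M : Subset n) → Fin ∣ M ∣ → Fin n
element (inside  Vec.∷ M) Fin.zero    = Fin.zero
element (inside  Vec.∷ M) (Fin.suc i) = Fin.suc (element M i)
element (outside Vec.∷ M) i           = Fin.suc (element M i)

induced : ∀ {n} → Graph n → (M : Subset n) → Graph ∣ M ∣
induced G M = record
  { adj         = λ i j → Graph.adj G (element M i) (element M j)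
  ; symmetric   = Graph.symmetric G
  ; irreflexive = λ i → Graph.irreflexive G (element M i)
  }

Proper : ∀ {n k} → Graph n → (Fin n → Fin k) → Set
Proper G c = ∀ u v → Adj G u v → c u ≢ c v

Colourable : ∀ {n} → Graph n → ℕ → Set
Colourable {n} G k = ∃ λ (c : Fin n → Fin k) → Proper G c

colourable? : ∀ {n} (G : Graph n) → U.Decidable (Colourable G)
colourable? G k = map′
  (λ (i , p) → finToFun i , p)
  (λ (c , p) → funToFin c , λ u v uv eq → p u v uv
    (trans (sym (finToFun-funToFin c u)) (trans eq (finToFun-funToFin c v))))
  (any? λ i → all? λ u → all? λ v →
    Adj? G u v →-dec ¬? (finToFun i u Fin.≟ finToFun i v))

least : {P : ℕ → Set} → U.Decidable P → ∀ n → P n →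
        ∃ λ k → P k × (∀ j → j ℕ.< k → ¬ P j)
least P? zero    p = 0 , p , λ _ ()
least P? (suc n) p with P? 0
... | yes p₀ = 0 , p₀ , λ _ ()
... | no ¬p₀ with least (P? ∘ suc) n p
...   | k , pₖ , min = suc k , pₖ , λ where
        zero    _         → ¬p₀
        (suc j) (s≤s j<k) → min j j<k

leastColouring : ∀ {n} (G : Graph n) →
  ∃ λ k → Colourable G k × (∀ j → j ℕ.< k → ¬ Colourable G j)
leastColouring {n} G = least (colourable? G) n
  (id , λ { u _ uv refl → Graph.irreflexive G u uv })

χ : ∀ {n} → Graph n → ℕ
χ G = proj₁ (leastColouring G)

-- A vertex set together with an adjacency matrix whose row u is the
-- set of neighbours of u.  Only some of these are subgraphs of a given
-- graph, but distinct subgraphs always have distinct representations.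
SubgraphData : ℕ → Set
SubgraphData n = Subset n × Vec (Subset n) n

IsSubgraph : ∀ {n} → Graph n → SubgraphData n → Set
IsSubgraph G (V , E) = ∀ u v → v ∈ lookup E u →
  Adj G u v × u ∈ V × v ∈ V × u ∈ lookup E v

IsIso : ∀ {f n} → Graph f → SubgraphData n → (Fin f → Fin n) → Set
IsIso F (V , E) φ =
    Injective _≡_ _≡_ φ
  × (∀ v → v ∈ V ⇔ (∃ λ i → φ i ≡ v))
  × (∀ i j → Adj F i j ⇔ φ j ∈ lookup E (φ i))

IsCopy : ∀ {f n} → Graph f → Graph n → SubgraphData n → Set
IsCopy F G S = IsSubgraph G S × ∃ (IsIso F S)

_-free : ∀ {h n} → Graph h → Graph n → Set
(H -free) G = ¬ ∃ (IsCopy H G)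

private
  infixr 2 _⇔-dec_

  _⇔-dec_ : {A B : Set} → Dec A → Dec B → Dec (A ⇔ B)
  A? ⇔-dec B? = map′ (λ (to , from) → mk⇔ to from)
                     (λ A⇔B → Equivalence.to A⇔B , Equivalence.from A⇔B)
                     ((A? →-dec B?) ×-dec (B? →-dec A?))

isSubgraph? : ∀ {n} (G : Graph n) → U.Decidable (IsSubgraph G)
isSubgraph? G (V , E) = all? λ u → all? λ v → (v ∈? lookup E u) →-dec
  (Adj? G u v ×-dec u ∈? V ×-dec v ∈? V ×-dec u ∈? lookup E v)

isIso? : ∀ {f n} (F : Graph f) (S : SubgraphData n) → U.Decidable (IsIso F S)
isIso? F (V , E) φ =
  map′ (λ inj {i} {j} → inj i j) (λ inj i j → inj)
       (all? λ i → all? λ j → (φ i Fin.≟ φ j) →-dec (i Fin.≟ j))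
  ×-dec (all? λ v → (v ∈? V) ⇔-dec any? λ i → φ i Fin.≟ v)
  ×-dec (all? λ i → all? λ j → Adj? F i j ⇔-dec (φ j ∈? lookup E (φ i)))

isIso-resp-≗ : ∀ {f n} (F : Graph f) (S : SubgraphData n) {φ ψ : Fin f → Fin n} →
               φ ≗ ψ → IsIso F S φ → IsIso F S ψ
isIso-resp-≗ F (V , E) φ≗ψ (inj , onto , edges) =
    (λ {i} {j} eq → inj (trans (φ≗ψ i) (trans eq (sym (φ≗ψ j)))))
  , (λ v → mk⇔
      (λ v∈V → let i , eq = Equivalence.to (onto v) v∈V in i , trans (sym (φ≗ψ i)) eq)
      (λ (i , eq) → Equivalence.from (onto v) (i , trans (φ≗ψ i) eq)))
  , (λ i j → subst₂ (λ a b → Adj F i j ⇔ b ∈ lookup E a) (φ≗ψ i) (φ≗ψ j) (edges i j))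

isCopy? : ∀ {f n} (F : Graph f) (G : Graph n) → U.Decidable (IsCopy F G)
isCopy? F G S = isSubgraph? G S ×-dec map′
  (λ (i , iso) → finToFun i , iso)
  (λ (φ , iso) → funToFin φ , isIso-resp-≗ F S (sym ∘ finToFun-funToFin φ) iso)
  (any? (isIso? F S ∘ finToFun))

tuples : {A : Set} → List A → ∀ n → List (Vec A n)
tuples xs zero    = Vec.[] ∷ []
tuples xs (suc n) = cartesianProductWith Vec._∷_ xs (tuples xs n)

subsets : ∀ n → List (Subset n)
subsets = tuples (inside ∷ outside ∷ [])

copies : ∀ {f n} → Graph f → Graph n → ℕ
copies {n = n} F G = length (filter (isCopy? F G)
  (cartesianProduct (subsets n) (tuples (subsets n) n)))

{-# OPTIONS --safe #-}

-- Write p = χ(F) − 1 and q = χ(H) − χ(F), so that m/p ≥ (n − m)/q.  Since many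
-- copies of K_{p+q+1} in G force a blow-up of it, and hence H, an H-free G has
-- few of them; likewise G[M] has few copies of K_{p+1}.  Hence a random sample
-- of boundedly many vertices of M and of its complement, weighted so that the
-- total weights of the two kinds are proportional to m and n − m, mostly spans
-- neither a K_{p+q+1} nor a K_{p+1} inside M, while its expected weighted edge
-- density is about that of G.  For such samples the bound follows by Zykov
-- symmetrisation: shifting weight between non-adjacent vertices, first inside
-- M and then everywhere, turns the sample into a weighted clique on at most
-- p + q vertices, of which at most p carry the weight of M (and possibly more),
-- and convexity finishes the proof because m/p ≥ (n − m)/q.

module Submission where

open import Defs

-- Symmetrisation needs forbidden cliques to be absent, whereas the hypotheses only make them rare,
-- and deleting rare cliques from `G` would call for a removal lemma. Sampling avoids this: a sample
-- has bounded size, so if a random tuple is a clique with small enough probability, all but a 1/`L`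
-- fraction of the samples have no forbidden clique at all, and a trivial edge bound suffices for
-- the rest. Another 1/`L` is lost to pairs formed by a sampled position with itself. Hence
-- `L = 4 * E` with `E` at least 1/ε. Let A and B be the total sampled weights of the two kinds. A
-- clique of total weight W and weights w has edge weight (W² - Σ w²)/2, so the two Turán terms
-- amount to the lower bound Σ w² ≥ A²/p + B²/q, attained by weights A/p and B/q. Merging can push
-- the number of labels below p and the labelled weight above A. Since A/p ≥ B/q, which is what the
-- condition on c provides, the labelled vertices are the heavy ones in the extremal clique, and
-- neither change makes the bound fail. Averages are sums of natural numbers with denominators
-- cleared; rationals and reals enter only at the end.

module FiniteSums where
  open import Data.Empty using (⊥-elim)
  open import Data.Fin using (Fin; zero; suc)
  open import Data.List using (List; []; _∷_; _++_; map; filter; length; allFin; cartesianProductWith)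
  open import Data.List.Membership.Propositional using (_∈_)
  open import Data.List.Properties using (map-tabulate)
  open import Data.List.Relation.Binary.Permutation.Propositional using (_↭_; refl; prep; swap; trans)
  open import Data.List.Relation.Unary.Any using (here; there)
  open import Data.Nat using (ℕ; zero; suc; _+_; _*_; _^_; _≤_; z≤n)
  open import Data.Nat.Properties
  open import Data.Nat.Tactic.RingSolver using (solve-∀)
  open import Data.Vec as Vec using (Vec)
  open import Function using (_∘_; id)
  open import Relation.Binary.PropositionalEquality as ≡ using (_≡_; cong; cong₂; sym; module ≡-Reasoning)
  open import Relation.Nullary using (Dec; yes; no; ¬_)
  import Relation.Unary as U

  private
    variable
      A B : Set

  -- Finite sums over lists.

  ∑ : List A → (A → ℕ) → ℕ
  ∑ []       f = 0
  ∑ (x ∷ xs) f = f x + ∑ xs f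

  ∑-cong : ∀ (xs : List A) {f g : A → ℕ} → (∀ x → x ∈ xs → f x ≡ g x) → ∑ xs f ≡ ∑ xs g
  ∑-cong []       eq = ≡.refl
  ∑-cong (x ∷ xs) eq = cong₂ _+_ (eq x (here ≡.refl)) (∑-cong xs (λ y → eq y ∘ there))

  ∑-mono : ∀ (xs : List A) {f g : A → ℕ} → (∀ x → x ∈ xs → f x ≤ g x) → ∑ xs f ≤ ∑ xs g
  ∑-mono []       le = z≤n
  ∑-mono (x ∷ xs) le = +-mono-≤ (le x (here ≡.refl)) (∑-mono xs (λ y → le y ∘ there))

  ∑-distrib-+ : ∀ (xs : List A) (f g : A → ℕ) → ∑ xs (λ x → f x + g x) ≡ ∑ xs f + ∑ xs g
  ∑-distrib-+ []       f g = ≡.refl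
  ∑-distrib-+ (x ∷ xs) f g = ≡.trans (cong (f x + g x +_) (∑-distrib-+ xs f g)) (lem (f x) (g x) (∑ xs f) (∑ xs g))
    where
    lem : ∀ a b c d → a + b + (c + d) ≡ a + c + (b + d)
    lem = solve-∀

  ∑-*ˡ : ∀ (xs : List A) c (f : A → ℕ) → ∑ xs (λ x → c * f x) ≡ c * ∑ xs f
  ∑-*ˡ []       c f = sym (*-zeroʳ c)
  ∑-*ˡ (x ∷ xs) c f = ≡.trans (cong (c * f x +_) (∑-*ˡ xs c f)) (sym (*-distribˡ-+ c (f x) (∑ xs f)))

  ∑-*ʳ : ∀ (xs : List A) c (f : A → ℕ) → ∑ xs (λ x → f x * c) ≡ ∑ xs f * c
  ∑-*ʳ xs c f = ≡.trans (∑-cong xs (λ x _ → *-comm (f x) c)) (≡.trans (∑-*ˡ xs c f) (*-comm c (∑ xs f)))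

  ∑-const : ∀ (xs : List A) c → ∑ xs (λ _ → c) ≡ length xs * c
  ∑-const []       c = ≡.refl
  ∑-const (x ∷ xs) c = cong (c +_) (∑-const xs c)

  ∑-swap : ∀ (xs : List A) (ys : List B) (f : A → B → ℕ) →
           ∑ xs (λ x → ∑ ys (f x)) ≡ ∑ ys (λ y → ∑ xs (λ x → f x y))
  ∑-swap []       ys f = sym (≡.trans (∑-const ys 0) (*-zeroʳ (length ys)))
  ∑-swap (x ∷ xs) ys f = ≡.trans (cong (∑ ys (f x) +_) (∑-swap xs ys f)) (sym (∑-distrib-+ ys _ _))

  ∑-++ : ∀ (xs ys : List A) (f : A → ℕ) → ∑ (xs ++ ys) f ≡ ∑ xs f + ∑ ys f
  ∑-++ []       ys f = ≡.refl
  ∑-++ (x ∷ xs) ys f = ≡.trans (cong (f x +_) (∑-++ xs ys f)) (sym (+-assoc (f x) _ _))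

  ∑-map : ∀ (h : A → B) (xs : List A) (f : B → ℕ) → ∑ (map h xs) f ≡ ∑ xs (f ∘ h)
  ∑-map h []       f = ≡.refl
  ∑-map h (x ∷ xs) f = cong (f (h x) +_) (∑-map h xs f)

  ∑-↭ : ∀ {xs ys : List A} (f : A → ℕ) → xs ↭ ys → ∑ xs f ≡ ∑ ys f
  ∑-↭ f refl         = ≡.refl
  ∑-↭ f (prep x p)   = cong (f x +_) (∑-↭ f p)
  ∑-↭ f (swap x y p) = ≡.trans (cong (λ z → f x + (f y + z)) (∑-↭ f p)) (lem (f x) (f y) _)
    where
    lem : ∀ a b c → a + (b + c) ≡ b + (a + c)
    lem = solve-∀
  ∑-↭ f (trans p q)  = ≡.trans (∑-↭ f p) (∑-↭ f q)

  ∑-∈ : ∀ {xs : List A} {x} (f : A → ℕ) → x ∈ xs → f x ≤ ∑ xs f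
  ∑-∈ f (here ≡.refl)      = m≤m+n _ _
  ∑-∈ f (there {x = y} x∈) = ≤-trans (∑-∈ f x∈) (m≤n+m _ (f y))

  ∑-cartesianProductWith : ∀ {C : Set} (h : A → B → C) (xs : List A) (ys : List B) (f : C → ℕ) →
    ∑ (cartesianProductWith h xs ys) f ≡ ∑ xs (λ x → ∑ ys (λ y → f (h x y)))
  ∑-cartesianProductWith h []       ys f = ≡.refl
  ∑-cartesianProductWith h (x ∷ xs) ys f =
    ≡.trans (∑-++ (map (h x) ys) _ f) (cong₂ _+_ (∑-map (h x) ys f) (∑-cartesianProductWith h xs ys f))

  ∑-allFin-suc : ∀ n (f : Fin (suc n) → ℕ) → ∑ (allFin (suc n)) f ≡ f zero + ∑ (allFin n) (f ∘ suc)
  ∑-allFin-suc n f = cong (f zero +_)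
    (≡.trans (cong (λ zs → ∑ zs f) (sym (map-tabulate id suc))) (∑-map suc (allFin n) f))

  -- Indicators of decidable propositions.

  𝟙 : {P : Set} → Dec P → ℕ
  𝟙 (yes _) = 1
  𝟙 (no _)  = 0

  𝟙≤1 : {P : Set} (P? : Dec P) → 𝟙 P? ≤ 1
  𝟙≤1 (yes _) = ≤-refl
  𝟙≤1 (no _)  = z≤n

  𝟙-yes : {P : Set} (P? : Dec P) → P → 𝟙 P? ≡ 1
  𝟙-yes (yes _) p = ≡.refl
  𝟙-yes (no ¬p) p = ⊥-elim (¬p p)

  𝟙-no : {P : Set} (P? : Dec P) → ¬ P → 𝟙 P? ≡ 0
  𝟙-no (yes p) ¬p = ⊥-elim (¬p p)
  𝟙-no (no _)  ¬p = ≡.refl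

  𝟙-≤ : {P : Set} (P? : Dec P) {c : ℕ} → (P → 1 ≤ c) → 𝟙 P? ≤ c
  𝟙-≤ (yes p) le = le p
  𝟙-≤ (no _)  le = z≤n

  𝟙-mono : {P Q : Set} (P? : Dec P) (Q? : Dec Q) → (P → Q) → 𝟙 P? ≤ 𝟙 Q?
  𝟙-mono P? Q? P⇒Q = 𝟙-≤ P? (λ p → ≤-reflexive (sym (𝟙-yes Q? (P⇒Q p))))

  𝟙-cong : {P Q : Set} (P? : Dec P) (Q? : Dec Q) → (P → Q) → (Q → P) → 𝟙 P? ≡ 𝟙 Q?
  𝟙-cong P? Q? to from = ≤-antisym (𝟙-mono P? Q? to) (𝟙-mono Q? P? from)

  𝟙-* : {P Q R : Set} (P? : Dec P) (Q? : Dec Q) (R? : Dec R) → (P → Q → R) → 𝟙 P? * 𝟙 Q? ≤ 𝟙 R?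
  𝟙-* (yes p) (yes q) R? h = ≤-reflexive (sym (𝟙-yes R? (h p q)))
  𝟙-* (yes p) (no _)  R? h = z≤n
  𝟙-* (no _)  Q?      R? h = z≤n

  length-filter : ∀ {P : A → Set} (P? : U.Decidable P) (xs : List A) →
                  length (filter P? xs) ≡ ∑ xs (𝟙 ∘ P?)
  length-filter P? []       = ≡.refl
  length-filter P? (x ∷ xs) with P? x
  ... | yes _ = cong suc (length-filter P? xs)
  ... | no  _ = length-filter P? xs

  -- Sums over tuples.

  ∑-tuples-suc : ∀ (xs : List A) n (f : Vec A (suc n) → ℕ) →
                 ∑ (tuples xs (suc n)) f ≡ ∑ xs (λ x → ∑ (tuples xs n) (λ ys → f (x Vec.∷ ys)))
  ∑-tuples-suc xs n f = ∑-cartesianProductWith Vec._∷_ xs (tuples xs n) f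

  ∑-one : (xs : List A) → ∑ xs (λ _ → 1) ≡ length xs
  ∑-one xs = ≡.trans (∑-const xs 1) (*-identityʳ (length xs))

  length-tuples : ∀ (xs : List A) n → length (tuples xs n) ≡ length xs ^ n
  length-tuples xs zero    = ≡.refl
  length-tuples xs (suc n) = begin
    length (tuples xs (suc n))                    ≡⟨ ∑-one (tuples xs (suc n)) ⟨
    ∑ (tuples xs (suc n)) (λ _ → 1)               ≡⟨ ∑-tuples-suc xs n _ ⟩
    ∑ xs (λ _ → ∑ (tuples xs n) (λ _ → 1))        ≡⟨ ∑-const xs _ ⟩
    length xs * ∑ (tuples xs n) (λ _ → 1)         ≡⟨ cong (length xs *_) (≡.trans (∑-one (tuples xs n)) (length-tuples xs n)) ⟩
    length xs * length xs ^ n                     ∎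
    where open ≡-Reasoning

  -- Summing out position `i` last groups the tuples by their other entries, as the Cauchy-Schwarz
  -- argument of `homs-clone` requires.
  ∑-tuples-insertAt : ∀ (xs : List A) n (i : Fin (suc n)) (f : Vec A (suc n) → ℕ) →
    ∑ (tuples xs (suc n)) f ≡ ∑ (tuples xs n) (λ ys → ∑ xs (λ x → f (Vec.insertAt ys i x)))
  ∑-tuples-insertAt xs n zero f = ≡.trans (∑-tuples-suc xs n f) (∑-swap xs (tuples xs n) _)
  ∑-tuples-insertAt xs (suc n) (suc i) f = begin
    ∑ (tuples xs (2 + n)) f
      ≡⟨ ∑-tuples-suc xs (suc n) f ⟩
    ∑ xs (λ x → ∑ (tuples xs (suc n)) (λ ys → f (x Vec.∷ ys)))
      ≡⟨ ∑-cong xs (λ x _ → ∑-tuples-insertAt xs n i _) ⟩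
    ∑ xs (λ x → ∑ (tuples xs n) (λ ys → ∑ xs (λ z → f (x Vec.∷ Vec.insertAt ys i z))))
      ≡⟨ ∑-tuples-suc xs n _ ⟨
    ∑ (tuples xs (suc n)) (λ ys → ∑ xs (λ z → f (Vec.insertAt ys (suc i) z))) ∎
    where open ≡-Reasoning

  ∑-tuples-++ : ∀ (xs : List A) a b (f : Vec A (a + b) → ℕ) →
    ∑ (tuples xs (a + b)) f ≡ ∑ (tuples xs a) (λ ys → ∑ (tuples xs b) (λ zs → f (ys Vec.++ zs)))
  ∑-tuples-++ xs zero    b f = sym (+-identityʳ _)
  ∑-tuples-++ xs (suc a) b f = begin
    ∑ (tuples xs (suc a + b)) f
      ≡⟨ ∑-tuples-suc xs (a + b) f ⟩
    ∑ xs (λ x → ∑ (tuples xs (a + b)) (λ ys → f (x Vec.∷ ys)))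
      ≡⟨ ∑-cong xs (λ x _ → ∑-tuples-++ xs a b _) ⟩
    ∑ xs (λ x → ∑ (tuples xs a) (λ ys → ∑ (tuples xs b) (λ zs → f (x Vec.∷ ys Vec.++ zs))))
      ≡⟨ ∑-tuples-suc xs a _ ⟨
    ∑ (tuples xs (suc a)) (λ ys → ∑ (tuples xs b) (λ zs → f (ys Vec.++ zs))) ∎
    where open ≡-Reasoning

-- Supersaturation: many cliques give many embeddings of a colourable graph.

module Homomorphisms where
  open FiniteSums
  open import Data.Fin as Fin using (Fin; zero; suc; _↑ʳ_)
  open import Data.Fin.Properties using (all?; any?)
  open import Data.List.Membership.Propositional.Properties using (∈-allFin)
  open import Data.List using (List; allFin; length)
  open import Data.List.Properties using (length-tabulate)
  open import Data.Nat using (ℕ; zero; suc; _+_; _*_; _^_; _≤_; NonZero)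
  open import Data.Nat.Properties
  open import Data.Nat.Tactic.RingSolver using (solve-∀)
  open import Data.Product using (_×_; _,_; ∃)
  open import Data.Sum using (inj₁; inj₂)
  open import Data.Vec as Vec using (Vec; []; _∷_; lookup; insertAt; tabulate)
  open import Data.Vec.Properties using (insertAt-lookup; lookup-allFin; lookup-++ʳ; lookup-++ˡ; lookup∘tabulate)
  open import Function using (_∘_; id)
  open import Relation.Binary.PropositionalEquality as ≡ using (_≡_; _≢_; refl; cong; cong₂; sym; subst; subst₂)
  open import Relation.Nullary using (Dec; yes; no; ¬_; ¬?; contradiction)
  open import Relation.Nullary.Decidable using (_×-dec_; _→-dec_)

  length-allFin : ∀ n → length (allFin n) ≡ n
  length-allFin n = length-tabulate {n = n} id

  vertexTuples : ∀ n N → List (Vec (Fin n) N)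
  vertexTuples n = tuples (allFin n)

  length-vertexTuples : ∀ n N → length (vertexTuples n N) ≡ n ^ N
  length-vertexTuples n N = ≡.trans (length-tuples (allFin n) N) (cong (_^ N) (length-allFin n))

  -- xs is a homomorphic copy of the complete multipartite graph on the
  -- positions, where position i lies in the part lookup cs i.
  Multipartite : ∀ {N k n} → Vec (Fin k) N → Graph n → Vec (Fin n) N → Set
  Multipartite cs G xs = ∀ i j → lookup cs i ≢ lookup cs j → Adj G (lookup xs i) (lookup xs j)

  multipartite? : ∀ {N k n} (cs : Vec (Fin k) N) (G : Graph n) (xs : Vec (Fin n) N) → Dec (Multipartite cs G xs)
  multipartite? cs G xs = all? λ i → all? λ j →
    ¬? (lookup cs i Fin.≟ lookup cs j) →-dec Adj? G (lookup xs i) (lookup xs j)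

  homs : ∀ {N k n} → Vec (Fin k) N → Graph n → ℕ
  homs {N} {n = n} cs G = ∑ (vertexTuples n N) (λ xs → 𝟙 (multipartite? cs G xs))

  lookup-insertAt-≢ : ∀ {A : Set} {N} (ys : Vec A N) i x x′ j → i ≢ j →
                      lookup (insertAt ys i x) j ≡ lookup (insertAt ys i x′) j
  lookup-insertAt-≢ ys       zero    x x′ zero    i≢j = contradiction refl i≢j
  lookup-insertAt-≢ ys       zero    x x′ (suc j) i≢j = refl
  lookup-insertAt-≢ (y ∷ ys) (suc i) x x′ zero    i≢j = refl
  lookup-insertAt-≢ (y ∷ ys) (suc i) x x′ (suc j) i≢j = lookup-insertAt-≢ ys i x x′ j (i≢j ∘ cong suc)

  -- `x` and `x′` are two values for the same position, hence lie in the same part and need no edge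
  -- between them. Both see the other parts, whose entries are shared.
  multipartite-clone : ∀ {N k n} (cs : Vec (Fin k) (suc N)) (G : Graph n) ys i x x′ →
    Multipartite cs G (insertAt ys i x) → Multipartite cs G (insertAt ys i x′) →
    Multipartite (lookup cs i ∷ cs) G (x′ ∷ insertAt ys i x)
  multipartite-clone cs G ys i x x′ hom hom′ = go
    where
    x′-adj : ∀ j → lookup cs i ≢ lookup cs j → Adj G x′ (lookup (insertAt ys i x) j)
    x′-adj j ci≢cj = subst₂ (Adj G) (insertAt-lookup ys i x′)
      (lookup-insertAt-≢ ys i x′ x j (ci≢cj ∘ cong (lookup cs))) (hom′ i j ci≢cj)

    go : Multipartite (lookup cs i ∷ cs) G (x′ ∷ insertAt ys i x)
    go zero    zero    ≢ = contradiction refl ≢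
    go zero    (suc j) ≢ = x′-adj j ≢
    go (suc j) zero    ≢ = Graph.symmetric G (x′-adj j (≢ ∘ sym))
    go (suc j) (suc l) ≢ = hom j l ≢

  -- A crude form of AM-GM: the product is bounded by the square of the larger factor.
  n*d≤d²+n² : ∀ n d → n * d ≤ d * d + n * n
  n*d≤d²+n² n d with ≤-total n d
  ... | inj₁ n≤d = ≤-trans (*-monoˡ-≤ d n≤d) (m≤m+n _ _)
  ... | inj₂ d≤n = ≤-trans (*-monoʳ-≤ n d≤n) (m≤n+m _ _)

  -- Cauchy–Schwarz: the number of pairs of extensions of a tuple is on
  -- average at least the square of the average number of extensions.
  homs-clone : ∀ {N k n} (cs : Vec (Fin k) (suc N)) (G : Graph n) i K →
    n ^ suc N ≤ K * homs cs G → n ^ (2 + N) ≤ (2 * K) * (2 * K) * homs (lookup cs i ∷ cs) G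
  homs-clone {N} {n = n} cs G i K many = +-cancelʳ-≤ (n ^ (2 + N)) _ _ (begin
    -- The terms `n * n` produced by AM-GM add up to `n ^ (2 + N)` over all `y`. Doubling the left
    -- side in advance allows one copy to be cancelled.
    n ^ (2 + N) + n ^ (2 + N)                    ≡⟨ double n (n ^ suc N) ⟩
    n * (2 * n ^ suc N)                          ≤⟨ *-monoʳ-≤ n (*-monoʳ-≤ 2 many) ⟩
    n * (2 * (K * homs cs G))                    ≡⟨ cong (n *_) (*-assoc 2 K (homs cs G)) ⟨
    n * (2 * K * homs cs G)                      ≡⟨ cong (λ z → n * (2 * K * z)) (∑-tuples-insertAt (allFin n) N i _) ⟩
    n * (2 * K * ∑ Ys d)                         ≡⟨ cong (n *_) (∑-*ˡ Ys (2 * K) d) ⟨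
    n * ∑ Ys (λ y → 2 * K * d y)                 ≡⟨ ∑-*ˡ Ys n _ ⟨
    ∑ Ys (λ y → n * (2 * K * d y))               ≤⟨ ∑-mono Ys (λ y _ → n*d≤d²+n² n (2 * K * d y)) ⟩
    ∑ Ys (λ y → 2 * K * d y * (2 * K * d y) + n * n) ≡⟨ ∑-distrib-+ Ys _ _ ⟩
    ∑ Ys (λ y → 2 * K * d y * (2 * K * d y)) + ∑ Ys (λ _ → n * n)
      ≡⟨ cong₂ _+_ (≡.trans (∑-cong Ys (λ y _ → square (2 * K) (d y))) (∑-*ˡ Ys (2 * K * (2 * K)) (λ y → d y * d y))) (≡.trans (∑-const Ys (n * n)) (cong (_* (n * n)) (length-vertexTuples n N))) ⟩
    2 * K * (2 * K) * ∑ Ys (λ y → d y * d y) + n ^ N * (n * n)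
      ≤⟨ +-mono-≤ (*-monoʳ-≤ (2 * K * (2 * K)) pairs) (≤-reflexive (power (n ^ N) n)) ⟩
    2 * K * (2 * K) * homs (lookup cs i ∷ cs) G + n ^ (2 + N) ∎)
    where
    open ≤-Reasoning
    Ys = vertexTuples n N

    g : Vec (Fin n) N → Fin n → ℕ
    g y x = 𝟙 (multipartite? cs G (insertAt y i x))

    d : Vec (Fin n) N → ℕ
    d y = ∑ (allFin n) (g y)

    double : ∀ a b → a * b + a * b ≡ a * (2 * b)
    double = solve-∀
    square : ∀ a b → a * b * (a * b) ≡ a * a * (b * b)
    square = solve-∀
    power : ∀ a b → a * (b * b) ≡ b * (b * a)
    power = solve-∀

    h : Fin n → Vec (Fin n) (suc N) → ℕ
    h x′ xs = 𝟙 (multipartite? (lookup cs i ∷ cs) G (x′ ∷ xs))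

    pairs : ∑ Ys (λ y → d y * d y) ≤ homs (lookup cs i ∷ cs) G
    pairs = begin
      ∑ Ys (λ y → d y * d y)
        ≡⟨ ∑-cong Ys (λ y _ → ≡.trans (sym (∑-*ʳ (allFin n) (d y) (g y))) (∑-cong (allFin n) (λ x _ → sym (∑-*ˡ (allFin n) (g y x) (g y))))) ⟩
      ∑ Ys (λ y → ∑ (allFin n) (λ x → ∑ (allFin n) (λ x′ → g y x * g y x′)))
        ≤⟨ ∑-mono Ys (λ y _ → ∑-mono (allFin n) (λ x _ → ∑-mono (allFin n) (λ x′ _ →
             𝟙-* (multipartite? cs G (insertAt y i x)) (multipartite? cs G (insertAt y i x′)) (multipartite? (lookup cs i ∷ cs) G (x′ ∷ insertAt y i x)) (multipartite-clone cs G y i x x′)))) ⟩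
      ∑ Ys (λ y → ∑ (allFin n) (λ x → ∑ (allFin n) (λ x′ → h x′ (insertAt y i x))))
        ≡⟨ ∑-cong Ys (λ y _ → ∑-swap (allFin n) (allFin n) _) ⟩
      ∑ Ys (λ y → ∑ (allFin n) (λ x′ → ∑ (allFin n) (λ x → h x′ (insertAt y i x))))
        ≡⟨ ∑-swap Ys (allFin n) _ ⟩
      ∑ (allFin n) (λ x′ → ∑ Ys (λ y → ∑ (allFin n) (λ x → h x′ (insertAt y i x))))
        ≡⟨ ∑-cong (allFin n) (λ x′ _ → sym (∑-tuples-insertAt (allFin n) N i (h x′))) ⟩
      ∑ (allFin n) (λ x′ → ∑ (vertexTuples n (suc N)) (h x′))
        ≡⟨ ∑-tuples-suc (allFin n) (suc N) _ ⟨
      homs (lookup cs i ∷ cs) G ∎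

  -- Each cloned position costs one use of `homs-clone`, which replaces `K` by `(2 * K) * (2 * K)`.
  blowupConstant : ℕ → ℕ → ℕ
  blowupConstant zero    K = K
  blowupConstant (suc t) K = 2 * blowupConstant t K * (2 * blowupConstant t K)

  -- A clique with one position per part stays at the end of the tuple as a template, so that a
  -- position of any part `c` is always available for cloning.
  homs-blowup : ∀ {t k n} (cs : Vec (Fin k) t) (G : Graph n) K → n ^ k ≤ K * homs (Vec.allFin k) G →
    n ^ (t + k) ≤ blowupConstant t K * homs (cs Vec.++ Vec.allFin k) G
  homs-blowup {t = zero}      []       G K many = many
  homs-blowup {t = suc t} {k = suc k} {n} (c ∷ cs) G K many =
    subst (λ c → n ^ suc (t + suc k) ≤ blowupConstant (suc t) K * homs (c ∷ cs Vec.++ Vec.allFin (suc k)) G) eq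
      (clone (t + suc k) (+-suc t k) (cs Vec.++ Vec.allFin (suc k)) (t ↑ʳ c) (homs-blowup cs G K many))
    where
    eq : lookup (cs Vec.++ Vec.allFin (suc k)) (t ↑ʳ c) ≡ c
    eq = ≡.trans (lookup-++ʳ cs (Vec.allFin (suc k)) c) (lookup-allFin c)

    -- `t + suc k` is a successor only propositionally. Generalising it to `N` lets the equation be
    -- matched with `refl`.
    clone : ∀ N {N′} → N ≡ suc N′ → (ds : Vec (Fin (suc k)) N) → ∀ i →
      n ^ N ≤ blowupConstant t K * homs ds G →
      n ^ suc N ≤ blowupConstant (suc t) K * homs (lookup ds i ∷ ds) G
    clone _ refl ds i = homs-clone ds G i (blowupConstant t K)

  -- Forgetting the positions of `ds` preserves the property, and a tuple has only `n ^ t′`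
  -- extensions to these positions.
  homs-++ : ∀ {t t′ k n} (cs : Vec (Fin k) t) (ds : Vec (Fin k) t′) (G : Graph n) →
            homs (cs Vec.++ ds) G ≤ n ^ t′ * homs cs G
  homs-++ {t} {t′} {n = n} cs ds G = begin
    homs (cs Vec.++ ds) G
      ≡⟨ ∑-tuples-++ (allFin n) t t′ _ ⟩
    ∑ (vertexTuples n t) (λ xs → ∑ (vertexTuples n t′) (λ ys → 𝟙 (multipartite? (cs Vec.++ ds) G (xs Vec.++ ys))))
      ≤⟨ ∑-mono (vertexTuples n t) (λ xs _ → ∑-mono (vertexTuples n t′) (λ ys _ →
           𝟙-mono (multipartite? (cs Vec.++ ds) G (xs Vec.++ ys)) (multipartite? cs G xs) (restrict xs ys))) ⟩
    ∑ (vertexTuples n t) (λ xs → ∑ (vertexTuples n t′) (λ _ → 𝟙 (multipartite? cs G xs)))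
      ≡⟨ ∑-cong (vertexTuples n t) (λ xs _ → ≡.trans (∑-const (vertexTuples n t′) _) (cong (_* 𝟙 (multipartite? cs G xs)) (length-vertexTuples n t′))) ⟩
    ∑ (vertexTuples n t) (λ xs → n ^ t′ * 𝟙 (multipartite? cs G xs))
      ≡⟨ ∑-*ˡ (vertexTuples n t) (n ^ t′) (λ xs → 𝟙 (multipartite? cs G xs)) ⟩
    n ^ t′ * homs cs G ∎
    where
    open ≤-Reasoning
    restrict : ∀ xs ys → Multipartite (cs Vec.++ ds) G (xs Vec.++ ys) → Multipartite cs G xs
    restrict xs ys hom i j ci≢cj = subst₂ (Adj G) (lookup-++ˡ xs ys i) (lookup-++ˡ xs ys j)
      (hom (i Fin.↑ˡ t′) (j Fin.↑ˡ t′)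
        (subst₂ _≢_ (sym (lookup-++ˡ cs ds i)) (sym (lookup-++ˡ cs ds j)) ci≢cj))

  -- The template clique kept by `homs-blowup` is discarded, at the price of a factor `n ^ k` that
  -- cancels.
  many-homs : ∀ {t k n} .{{_ : NonZero n}} (cs : Vec (Fin k) t) (G : Graph n) K → n ^ k ≤ K * homs (Vec.allFin k) G →
              n ^ t ≤ blowupConstant t K * homs cs G
  many-homs {t} {k} {n} cs G K many = *-cancelˡ-≤ (n ^ k) {{m^n≢0 n k}} (begin
    n ^ k * n ^ t                                                ≡⟨ *-comm (n ^ k) (n ^ t) ⟩
    n ^ t * n ^ k                                                ≡⟨ ^-distribˡ-+-* n t k ⟨
    n ^ (t + k)                                                  ≤⟨ homs-blowup cs G K many ⟩
    blowupConstant t K * homs (cs Vec.++ Vec.allFin k) G         ≤⟨ *-monoʳ-≤ (blowupConstant t K) (homs-++ cs (Vec.allFin k) G) ⟩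
    blowupConstant t K * (n ^ k * homs cs G)                     ≡⟨ lem (blowupConstant t K) (n ^ k) (homs cs G) ⟩
    n ^ k * (blowupConstant t K * homs cs G)                     ∎)
    where
    open ≤-Reasoning
    lem : ∀ a b c → a * (b * c) ≡ b * (a * c)
    lem = solve-∀

  -- Discarding non-injective tuples.

  InjectiveVec : ∀ {n t} → Vec (Fin n) t → Set
  InjectiveVec xs = ∀ i j → lookup xs i ≡ lookup xs j → i ≡ j

  injectiveVec? : ∀ {n t} (xs : Vec (Fin n) t) → Dec (InjectiveVec xs)
  injectiveVec? xs = all? λ i → all? λ j → (lookup xs i Fin.≟ lookup xs j) →-dec (i Fin.≟ j)

  𝟙-noninjective-∷ : ∀ {n t} (x : Fin n) (xs : Vec (Fin n) t) →
    𝟙 (¬? (injectiveVec? (x ∷ xs))) ≤ 𝟙 (¬? (injectiveVec? xs)) + ∑ (allFin t) (λ i → 𝟙 (x Fin.≟ lookup xs i))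
  𝟙-noninjective-∷ {t = t} x xs with injectiveVec? xs
  ... | no  _   = ≤-trans (𝟙≤1 (¬? (injectiveVec? (x ∷ xs)))) (m≤m+n 1 _)
  ... | yes inj = 𝟙-≤ (¬? (injectiveVec? (x ∷ xs))) λ ¬inj → occurs ¬inj (any? (λ i → x Fin.≟ lookup xs i))
    where
    occurs : ¬ InjectiveVec (x ∷ xs) → Dec (∃ λ i → x ≡ lookup xs i) → 1 ≤ ∑ (allFin t) (λ i → 𝟙 (x Fin.≟ lookup xs i))
    occurs _ (yes (i , eq)) = ≤-trans (≤-reflexive (sym (𝟙-yes (x Fin.≟ lookup xs i) eq))) (∑-∈ (λ i → 𝟙 (x Fin.≟ lookup xs i)) (∈-allFin i))
    occurs ¬inj (no x∉) = contradiction cons ¬inj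
      where
      cons : InjectiveVec (x ∷ xs)
      cons zero    zero    _  = refl
      cons zero    (suc j) eq = contradiction (j , eq) x∉
      cons (suc i) zero    eq = contradiction (i , sym eq) x∉
      cons (suc i) (suc j) eq = cong suc (inj i j eq)

  ∑-allFin-≟ : ∀ n (y : Fin n) → ∑ (allFin n) (λ x → 𝟙 (x Fin.≟ y)) ≡ 1
  ∑-allFin-≟ (suc n) zero    = ≡.trans (∑-allFin-suc n (λ x → 𝟙 (x Fin.≟ zero))) (cong suc
    (≡.trans (∑-cong (allFin n) (λ x _ → 𝟙-no (suc x Fin.≟ zero) (λ ()))) (≡.trans (∑-const (allFin n) 0) (*-zeroʳ (length (allFin n))))))
  ∑-allFin-≟ (suc n) (suc y) = ≡.trans (∑-allFin-suc n (λ x → 𝟙 (x Fin.≟ suc y))) (cong₂ _+_ (𝟙-no (Fin.zero {n} Fin.≟ suc y) (λ ()))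
    (≡.trans (∑-cong (allFin n) (λ x _ → 𝟙-cong (suc x Fin.≟ suc y) (x Fin.≟ y) (λ { refl → refl }) (cong suc))) (∑-allFin-≟ n y)))

  -- Union bound: there are at most `t * t` pairs of positions, and a given pair coincides in a 1/n
  -- fraction of all tuples.
  noninjective-bound : ∀ n t → n * ∑ (vertexTuples n t) (λ xs → 𝟙 (¬? (injectiveVec? xs))) ≤ t * t * n ^ t
  noninjective-bound n zero    = ≤-reflexive (≡.trans (cong (n *_) (≡.trans (+-identityʳ _) (𝟙-no (¬? (injectiveVec? {n} [])) (λ ¬inj → ¬inj (λ ()))))) (*-zeroʳ n))
  noninjective-bound n (suc t) = begin
    n * ∑ (vertexTuples n (suc t)) (λ xs → 𝟙 (¬? (injectiveVec? xs)))
      ≡⟨ cong (n *_) (∑-tuples-suc (allFin n) t _) ⟩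
    n * ∑ (allFin n) (λ x → ∑ Xs (λ xs → 𝟙 (¬? (injectiveVec? (x ∷ xs)))))
      ≤⟨ *-monoʳ-≤ n (∑-mono (allFin n) (λ x _ → ∑-mono Xs (λ xs _ → 𝟙-noninjective-∷ x xs))) ⟩
    n * ∑ (allFin n) (λ x → ∑ Xs (λ xs → 𝟙 (¬? (injectiveVec? xs)) + ∑ (allFin t) (λ i → 𝟙 (x Fin.≟ lookup xs i))))
      ≡⟨ cong (n *_) (∑-cong (allFin n) (λ x _ → ∑-distrib-+ Xs _ _)) ⟩
    n * ∑ (allFin n) (λ x → ∑ Xs (λ xs → 𝟙 (¬? (injectiveVec? xs))) + ∑ Xs (λ xs → ∑ (allFin t) (λ i → 𝟙 (x Fin.≟ lookup xs i))))
      ≡⟨ cong (n *_) (≡.trans (∑-distrib-+ (allFin n) _ _) (cong₂ _+_ (≡.trans (∑-const (allFin n) bad) (cong (_* bad) (length-allFin n))) hits)) ⟩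
    n * (n * bad + n ^ t * t)
      ≡⟨ *-distribˡ-+ n (n * bad) _ ⟩
    n * (n * bad) + n * (n ^ t * t)
      ≤⟨ +-monoˡ-≤ _ (*-monoʳ-≤ n (noninjective-bound n t)) ⟩
    n * (t * t * n ^ t) + n * (n ^ t * t)
      -- The induction yields `t * t + t`, which is rounded up to `suc t * suc t`.
      ≤⟨ m≤m+n _ ((suc t) * (n * n ^ t)) ⟩
    n * (t * t * n ^ t) + n * (n ^ t * t) + (suc t) * (n * n ^ t)
      ≡⟨ lem n t (n ^ t) ⟩
    suc t * suc t * (n * n ^ t) ∎
    where
    open ≤-Reasoning
    Xs  = vertexTuples n t
    bad = ∑ Xs (λ xs → 𝟙 (¬? (injectiveVec? xs)))

    lem : ∀ n t z → n * (t * t * z) + n * (z * t) + (1 + t) * (n * z) ≡ (1 + t) * (1 + t) * (n * z)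
    lem = solve-∀

    hits : ∑ (allFin n) (λ x → ∑ Xs (λ xs → ∑ (allFin t) (λ i → 𝟙 (x Fin.≟ lookup xs i)))) ≡ n ^ t * t
    hits = begin-equality
      ∑ (allFin n) (λ x → ∑ Xs (λ xs → ∑ (allFin t) (λ i → 𝟙 (x Fin.≟ lookup xs i))))
        ≡⟨ ∑-swap (allFin n) Xs _ ⟩
      ∑ Xs (λ xs → ∑ (allFin n) (λ x → ∑ (allFin t) (λ i → 𝟙 (x Fin.≟ lookup xs i))))
        ≡⟨ ∑-cong Xs (λ xs _ → ≡.trans (∑-swap (allFin n) (allFin t) _) (≡.trans (∑-cong (allFin t) (λ i _ → ∑-allFin-≟ n (lookup xs i))) (≡.trans (∑-one (allFin t)) (length-allFin t)))) ⟩
      ∑ Xs (λ _ → t)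
        ≡⟨ ≡.trans (∑-const Xs t) (cong (_* t) (length-vertexTuples n t)) ⟩
      n ^ t * t ∎

  -- Vectors instead of functions make embeddings enumerable, hence countable by a sum.
  Embeds : ∀ {f n} → Graph f → Graph n → Vec (Fin n) f → Set
  Embeds F G φ = (∀ i j → Adj F i j → Adj G (lookup φ i) (lookup φ j)) × InjectiveVec φ

  embeds? : ∀ {f n} (F : Graph f) (G : Graph n) (φ : Vec (Fin n) f) → Dec (Embeds F G φ)
  embeds? F G φ = (all? λ i → all? λ j → Adj? F i j →-dec Adj? G (lookup φ i) (lookup φ j)) ×-dec injectiveVec? φ

  embeddings : ∀ {f n} → Graph f → Graph n → ℕ
  embeddings {f} {n} F G = ∑ (vertexTuples n f) (λ φ → 𝟙 (embeds? F G φ))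

  -- Along a proper colouring, `F` is a subgraph of the complete multipartite pattern `tabulate c`.
  -- So every injective homomorphic copy of that pattern contains an embedding of `F`, and the
  -- non-injective ones are negligible for large `n`.
  many-embeddings : ∀ {f k} (F : Graph f) → Colourable F k → ∀ K →
    ∃ λ K′ → ∀ n .{{_ : NonZero n}} (G : Graph n) → K′ ≤ n →
      n ^ k ≤ K * homs (Vec.allFin k) G → n ^ f ≤ K′ * embeddings F G
  many-embeddings {f} {k} F (c , proper) K = K′ , bound
    where
    B  = blowupConstant f K
    -- `2 * B` is the counting constant after half of the bound is given up to non-injective tuples;
    -- `2 * B * (f * f)` is the order from which they account for at most that half. One number
    -- serves both purposes.
    K′ = 2 * B + 2 * B * (f * f)

    module _ (n : ℕ) .{{_ : NonZero n}} (G : Graph n) (K′≤n : K′ ≤ n) (many : n ^ k ≤ K * homs (Vec.allFin k) G) where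
      open ≤-Reasoning
      Xs  = vertexTuples n f
      bad = ∑ Xs (λ xs → 𝟙 (¬? (injectiveVec? xs)))

      split : ∀ xs → 𝟙 (multipartite? (tabulate c) G xs) ≤ 𝟙 (embeds? F G xs) + 𝟙 (¬? (injectiveVec? xs))
      split xs = 𝟙-≤ (multipartite? (tabulate c) G xs) (λ hom → cases hom (injectiveVec? xs))
        where
        cases : Multipartite (tabulate c) G xs → Dec (InjectiveVec xs) →
                1 ≤ 𝟙 (embeds? F G xs) + 𝟙 (¬? (injectiveVec? xs))
        cases hom (yes inj) = ≤-trans (≤-reflexive (sym (𝟙-yes (embeds? F G xs) (edges , inj)))) (m≤m+n _ _)
          where
          edges : ∀ i j → Adj F i j → Adj G (lookup xs i) (lookup xs j)
          edges i j ij = hom i j (proper i j ij ∘ subst₂ _≡_ (lookup∘tabulate c i) (lookup∘tabulate c j))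
        cases hom (no ¬inj) = ≤-trans (≤-reflexive (sym (𝟙-yes (¬? (injectiveVec? xs)) ¬inj))) (m≤n+m _ _)

      bound : n ^ f ≤ K′ * embeddings F G
      bound = ≤-trans (*-cancelˡ-≤ n (+-cancelʳ-≤ (n * n ^ f) _ _ (begin
        n * n ^ f + n * n ^ f
          ≡⟨ double n (n ^ f) ⟩
        n * (2 * n ^ f)
          ≤⟨ *-monoʳ-≤ n (*-monoʳ-≤ 2 (many-homs (tabulate c) G K many)) ⟩
        n * (2 * (B * homs (tabulate c) G))
          ≤⟨ *-monoʳ-≤ n (*-monoʳ-≤ 2 (*-monoʳ-≤ B (∑-mono Xs (λ xs _ → split xs)))) ⟩
        n * (2 * (B * ∑ Xs (λ xs → 𝟙 (embeds? F G xs) + 𝟙 (¬? (injectiveVec? xs)))))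
          ≡⟨ cong (λ z → n * (2 * (B * z))) (∑-distrib-+ Xs _ _) ⟩
        n * (2 * (B * (embeddings F G + bad)))
          ≡⟨ expand n B (embeddings F G) bad ⟩
        n * (2 * B * embeddings F G) + 2 * B * (n * bad)
          ≤⟨ +-monoʳ-≤ _ (*-monoʳ-≤ (2 * B) (noninjective-bound n f)) ⟩
        n * (2 * B * embeddings F G) + 2 * B * (f * f * n ^ f)
          ≡⟨ cong (n * (2 * B * embeddings F G) +_) (*-assoc (2 * B) (f * f) (n ^ f)) ⟨
        n * (2 * B * embeddings F G) + 2 * B * (f * f) * n ^ f
          ≤⟨ +-monoʳ-≤ _ (*-monoˡ-≤ (n ^ f) (≤-trans (m≤n+m _ (2 * B)) K′≤n)) ⟩
        n * (2 * B * embeddings F G) + n * n ^ f ∎)))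
        (*-monoˡ-≤ (embeddings F G) (m≤m+n (2 * B) _))
        where
        double : ∀ a b → a * b + a * b ≡ a * (2 * b)
        double = solve-∀
        expand : ∀ n B e b → n * (2 * (B * (e + b))) ≡ n * (2 * B * e) + 2 * B * (n * b)
        expand = solve-∀

-- From embeddings to copies, and the resulting bounds on clique counts.

module Copies where
  open FiniteSums
  open Homomorphisms
  open import Data.Bool using (true)
  open import Data.Fin as Fin using (Fin; zero; suc)
  open import Data.Fin.Properties using (any?)
  open import Data.Fin.Subset as Subset using (Subset; inside; outside)
  open import Data.List using (List; []; _∷_; allFin; length; cartesianProduct)
  open import Data.List.Membership.Propositional using (_∈_)
  open import Data.List.Membership.Propositional.Properties using (∈-allFin; ∈-cartesianProduct⁺; ∈-cartesianProductWith⁺)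
  open import Data.List.Relation.Unary.Any using (here; there)
  open import Data.Nat using (ℕ; zero; suc; _+_; _*_; _^_; _≤_; z≤n; s≤s; NonZero)
  open import Data.Nat.Properties
  open import Data.Product using (_×_; _,_; ∃; proj₁; proj₂)
  open import Data.Vec as Vec using (Vec; []; _∷_; lookup; tabulate)
  open import Data.Vec.Properties using (lookup∘tabulate; tabulate∘lookup; tabulate-cong; tabulate-∘; lookup⇒[]=; []=⇒lookup; ≡-dec)
  open import Function using (_∘_; mk⇔; Equivalence)
  open import Relation.Binary.PropositionalEquality as ≡ using (_≡_; refl; cong; cong₂; sym; subst; subst₂)
  open import Relation.Nullary using (Dec; yes; no; ¬_; contradiction; does)
  open import Relation.Nullary.Decidable using (_×-dec_; dec-true)
  import Relation.Unary as U

  comprehension : ∀ {n} {P : Fin n → Set} → U.Decidable P → Subset n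
  comprehension P? = tabulate (does ∘ P?)

  ∈-comprehension⁺ : ∀ {n} {P : Fin n → Set} (P? : U.Decidable P) {v} → P v → v Subset.∈ comprehension P?
  ∈-comprehension⁺ P? {v} p = lookup⇒[]= v _ (≡.trans (lookup∘tabulate (does ∘ P?) v) (dec-true (P? v) p))

  ∈-comprehension⁻ : ∀ {n} {P : Fin n → Set} (P? : U.Decidable P) {v} → v Subset.∈ comprehension P? → P v
  ∈-comprehension⁻ {P = P} P? {v} v∈ = holds (P? v) (≡.trans (sym (lookup∘tabulate (does ∘ P?) v)) ([]=⇒lookup v∈))
    where
    holds : (P?v : Dec (P v)) → does P?v ≡ true → P v
    holds (yes p) _ = p

  module _ {f n : ℕ} (F : Graph f) (φ : Vec (Fin n) f) where

    imageEdge? : ∀ u v → Dec (∃ λ i → ∃ λ j → Adj F i j × lookup φ i ≡ u × lookup φ j ≡ v)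
    imageEdge? u v = any? λ i → any? λ j → Adj? F i j ×-dec lookup φ i Fin.≟ u ×-dec lookup φ j Fin.≟ v

    -- Only the images of edges of `F` are kept, since copies need not be induced.
    image : SubgraphData n
    image = comprehension (λ v → any? λ i → lookup φ i Fin.≟ v) , tabulate (λ u → comprehension (imageEdge? u))

    row : ∀ u → lookup (proj₂ image) u ≡ comprehension (imageEdge? u)
    row = lookup∘tabulate _

    edge⁺ : ∀ {u v} → (∃ λ i → ∃ λ j → Adj F i j × lookup φ i ≡ u × lookup φ j ≡ v) → v Subset.∈ lookup (proj₂ image) u
    edge⁺ {u} {v} w = subst (v Subset.∈_) (sym (row u)) (∈-comprehension⁺ (imageEdge? u) w)

    edge⁻ : ∀ {u v} → v Subset.∈ lookup (proj₂ image) u → ∃ λ i → ∃ λ j → Adj F i j × lookup φ i ≡ u × lookup φ j ≡ v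
    edge⁻ {u} {v} v∈ = ∈-comprehension⁻ (imageEdge? u) (subst (v Subset.∈_) (row u) v∈)

    image-subgraph : ∀ (G : Graph n) → Embeds F G φ → IsSubgraph G image
    image-subgraph G (hom , _) u v v∈ with edge⁻ v∈
    ... | i , j , ij , refl , refl = hom i j ij
        , ∈-comprehension⁺ (λ v → any? λ i → lookup φ i Fin.≟ v) (i , refl)
        , ∈-comprehension⁺ (λ v → any? λ i → lookup φ i Fin.≟ v) (j , refl)
        , edge⁺ (j , i , Graph.symmetric F ij , refl , refl)

    image-iso : InjectiveVec φ → IsIso F image (lookup φ)
    image-iso inj = (λ {i} {j} → inj i j)
      , (λ v → mk⇔ (∈-comprehension⁻ (λ v → any? λ i → lookup φ i Fin.≟ v)) (∈-comprehension⁺ (λ v → any? λ i → lookup φ i Fin.≟ v)))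
      , (λ i j → mk⇔ (λ ij → edge⁺ (i , j , ij , refl , refl)) λ φj∈ →
          let i′ , j′ , ij , eq , eq′ = edge⁻ φj∈ in subst₂ (Adj F) (inj i′ i eq) (inj j′ j eq′) ij)

  embedding⇒copy : ∀ {f n} (F : Graph f) (G : Graph n) φ → Embeds F G φ → IsCopy F G (image F φ)
  embedding⇒copy F G φ emb = image-subgraph F φ G emb , lookup φ , image-iso F φ (proj₂ emb)

  free⇒no-embeddings : ∀ {h n} (H : Graph h) (G : Graph n) → (H -free) G → embeddings H G ≡ 0
  free⇒no-embeddings {h} {n} H G free = ≡.trans
    (∑-cong (vertexTuples n h) (λ φ _ → 𝟙-no (embeds? H G φ) (λ emb → free (image H φ , embedding⇒copy H G φ emb))))
    (≡.trans (∑-const (vertexTuples n h) 0) (*-zeroʳ (length (vertexTuples n h))))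

  ∈-tuples : ∀ {A : Set} {xs : List A} → (∀ x → x ∈ xs) → ∀ {n} (v : Vec A n) → v ∈ tuples xs n
  ∈-tuples all []      = here refl
  ∈-tuples all (x ∷ v) = ∈-cartesianProductWith⁺ Vec._∷_ (all x) (∈-tuples all v)

  ∈-subsets : ∀ {n} (V : Subset n) → V ∈ subsets n
  ∈-subsets = ∈-tuples λ { inside → here refl ; outside → there (here refl) }

  subgraphData : ∀ n → List (SubgraphData n)
  subgraphData n = cartesianProduct (subsets n) (tuples (subsets n) n)

  ∈-subgraphData : ∀ {n} (S : SubgraphData n) → S ∈ subgraphData n
  ∈-subgraphData (V , E) = ∈-cartesianProduct⁺ (∈-subsets V) (∈-tuples ∈-subsets E)

  _≟ᵛ_ : ∀ {n t} (xs ys : Vec (Fin n) t) → Dec (xs ≡ ys)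
  _≟ᵛ_ = ≡-dec Fin._≟_

  ∑-vertexTuples-≟ : ∀ {n t} (ys : Vec (Fin n) t) → ∑ (vertexTuples n t) (λ xs → 𝟙 (xs ≟ᵛ ys)) ≤ 1
  ∑-vertexTuples-≟ {n} []   = ≤-trans (≤-reflexive (+-identityʳ _)) (𝟙≤1 (_≟ᵛ_ {n} [] []))
  ∑-vertexTuples-≟ {n} {suc t} (y ∷ ys) = begin
    ∑ (vertexTuples n (suc t)) (λ xs → 𝟙 (xs ≟ᵛ (y ∷ ys)))
      ≡⟨ ∑-tuples-suc (allFin n) t _ ⟩
    ∑ (allFin n) (λ x → ∑ (vertexTuples n t) (λ xs → 𝟙 ((x ∷ xs) ≟ᵛ (y ∷ ys))))
      ≤⟨ ∑-mono (allFin n) (λ x _ → ∑-mono (vertexTuples n t) (λ xs _ → pointwise x xs)) ⟩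
    ∑ (allFin n) (λ x → ∑ (vertexTuples n t) (λ xs → 𝟙 (x Fin.≟ y) * 𝟙 (xs ≟ᵛ ys)))
      ≡⟨ ∑-cong (allFin n) (λ x _ → ∑-*ˡ (vertexTuples n t) (𝟙 (x Fin.≟ y)) (λ xs → 𝟙 (xs ≟ᵛ ys))) ⟩
    ∑ (allFin n) (λ x → 𝟙 (x Fin.≟ y) * ∑ (vertexTuples n t) (λ xs → 𝟙 (xs ≟ᵛ ys)))
      ≡⟨ ∑-*ʳ (allFin n) _ (λ x → 𝟙 (x Fin.≟ y)) ⟩
    ∑ (allFin n) (λ x → 𝟙 (x Fin.≟ y)) * ∑ (vertexTuples n t) (λ xs → 𝟙 (xs ≟ᵛ ys))
      ≤⟨ *-mono-≤ (≤-reflexive (∑-allFin-≟ n y)) (∑-vertexTuples-≟ ys) ⟩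
    1 ∎
    where
    open ≤-Reasoning
    pointwise : ∀ x xs → 𝟙 ((x ∷ xs) ≟ᵛ (y ∷ ys)) ≤ 𝟙 (x Fin.≟ y) * 𝟙 (xs ≟ᵛ ys)
    pointwise x xs = 𝟙-≤ ((x ∷ xs) ≟ᵛ (y ∷ ys)) λ { refl →
      ≤-reflexive (sym (cong₂ _*_ (𝟙-yes (x Fin.≟ x) refl) (𝟙-yes (xs ≟ᵛ xs) refl))) }

  -- Two embeddings with the same image differ by a self-map of Fin f.
  embeddings≤copies : ∀ {f n} (F : Graph f) (G : Graph n) → embeddings F G ≤ f ^ f * copies F G
  embeddings≤copies {f} {n} F G = begin
    embeddings F G
      ≤⟨ ∑-mono Φ (λ φ _ → 𝟙-≤ (embeds? F G φ) (has-image φ)) ⟩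
    ∑ Φ (λ φ → ∑ (subgraphData n) (λ S → 𝟙 (parametrises? φ S)))
      ≡⟨ ∑-swap Φ (subgraphData n) _ ⟩
    ∑ (subgraphData n) (λ S → ∑ Φ (λ φ → 𝟙 (parametrises? φ S)))
      ≤⟨ ∑-mono (subgraphData n) (λ S _ → parametrisations S (isCopy? F G S)) ⟩
    ∑ (subgraphData n) (λ S → f ^ f * 𝟙 (isCopy? F G S))
      ≡⟨ ∑-*ˡ (subgraphData n) (f ^ f) (𝟙 ∘ isCopy? F G) ⟩
    f ^ f * ∑ (subgraphData n) (𝟙 ∘ isCopy? F G)
      ≡⟨ cong (f ^ f *_) (length-filter (isCopy? F G) (subgraphData n)) ⟨
    f ^ f * copies F G ∎
    where
    open ≤-Reasoning
    Φ = vertexTuples n f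

    parametrises? : ∀ φ S → Dec (IsSubgraph G S × IsIso F S (lookup φ))
    parametrises? φ S = isSubgraph? G S ×-dec isIso? F S (lookup φ)

    has-image : ∀ φ → Embeds F G φ → 1 ≤ ∑ (subgraphData n) (λ S → 𝟙 (parametrises? φ S))
    has-image φ emb = ≤-trans
      (≤-reflexive (sym (𝟙-yes (parametrises? φ (image F φ)) (image-subgraph F φ G emb , image-iso F φ (proj₂ emb)))))
      (∑-∈ (λ S → 𝟙 (parametrises? φ S)) (∈-subgraphData (image F φ)))

    parametrisations : ∀ S (copy? : Dec (IsCopy F G S)) → ∑ Φ (λ φ → 𝟙 (parametrises? φ S)) ≤ f ^ f * 𝟙 copy?
    parametrisations S (no ¬copy) = ≤-trans (∑-mono Φ {g = λ _ → 0} (λ φ _ → ≤-reflexive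
        (𝟙-no (parametrises? φ S) (λ (sub , iso) → ¬copy (sub , _ , iso)))))
      (≤-trans (≤-reflexive (≡.trans (∑-const Φ 0) (*-zeroʳ (length Φ)))) z≤n)
    parametrisations S (yes (sub , ψ , iso)) = begin
      ∑ Φ (λ φ → 𝟙 (parametrises? φ S))
        ≤⟨ ∑-mono Φ (λ φ _ → 𝟙-≤ (parametrises? φ S) (factors φ)) ⟩
      ∑ Φ (λ φ → ∑ (vertexTuples f f) (λ σ → 𝟙 (φ ≟ᵛ Vec.map ψ σ)))
        ≡⟨ ∑-swap Φ (vertexTuples f f) _ ⟩
      ∑ (vertexTuples f f) (λ σ → ∑ Φ (λ φ → 𝟙 (φ ≟ᵛ Vec.map ψ σ)))
        ≤⟨ ∑-mono (vertexTuples f f) (λ σ _ → ∑-vertexTuples-≟ (Vec.map ψ σ)) ⟩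
      ∑ (vertexTuples f f) (λ _ → 1)
        ≡⟨ ≡.trans (∑-one (vertexTuples f f)) (length-vertexTuples f f) ⟩
      f ^ f
        ≡⟨ *-identityʳ (f ^ f) ⟨
      f ^ f * 1 ∎
      where
      factors : ∀ φ → IsSubgraph G S × IsIso F S (lookup φ) → 1 ≤ ∑ (vertexTuples f f) (λ σ → 𝟙 (φ ≟ᵛ Vec.map ψ σ))
      factors φ (_ , _ , onto , _) = ≤-trans
        (≤-reflexive (sym (𝟙-yes (φ ≟ᵛ Vec.map ψ σ) φ≡ψσ)))
        (∑-∈ (λ σ → 𝟙 (φ ≟ᵛ Vec.map ψ σ)) (∈-tuples ∈-allFin σ))
        where
        preimage : ∀ i → ∃ λ j → ψ j ≡ lookup φ i
        preimage i = Equivalence.to (proj₁ (proj₂ iso) (lookup φ i)) (Equivalence.from (onto (lookup φ i)) (i , refl))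

        σ : Vec (Fin f) f
        σ = tabulate (proj₁ ∘ preimage)

        φ≡ψσ : φ ≡ Vec.map ψ σ
        φ≡ψσ = ≡.trans (sym (tabulate∘lookup φ))
          (≡.trans (tabulate-cong (λ i → sym (proj₂ (preimage i)))) (tabulate-∘ ψ (proj₁ ∘ preimage)))

  -- Contrapositive of supersaturation: too many cliques would bound the positive number `n ^ h` by
  -- a multiple of the number of embeddings of `H`, which is zero.
  few-cliques-if-free : ∀ {h k} (H : Graph h) → Colourable H k → ∀ K →
    ∃ λ n₀ → ∀ n .{{_ : NonZero n}} (G : Graph n) → n₀ ≤ n → (H -free) G → K * homs (Vec.allFin k) G ≤ n ^ k
  few-cliques-if-free {h} {k} H col K = n₀ , λ n G n₀≤n free → ≮⇒≥ λ lt → contradiction (none n G free (many n G n₀≤n (<⇒≤ lt))) (<⇒≱ (m^n>0 n h))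
    where
    n₀   = proj₁ (many-embeddings H col K)
    many = proj₂ (many-embeddings H col K)

    none : ∀ n (G : Graph n) → (H -free) G → n ^ h ≤ n₀ * embeddings H G → n ^ h ≤ 0
    none n G free le = begin
      n ^ h                   ≤⟨ le ⟩
      n₀ * embeddings H G     ≡⟨ cong (n₀ *_) (free⇒no-embeddings H G free) ⟩
      n₀ * 0                  ≡⟨ *-zeroʳ n₀ ⟩
      0                       ∎
      where open ≤-Reasoning

  few-cliques-if-few-copies : ∀ {f k} (F : Graph f) → Colourable F k → ∀ K →
    ∃ λ D → ∀ n .{{_ : NonZero n}} (G : Graph n) → D ≤ n → suc D * copies F G ≤ n ^ f → K * homs (Vec.allFin k) G ≤ n ^ k
  few-cliques-if-few-copies {f} {k} F col K = D , λ n G D≤n few → ≮⇒≥ λ lt → absurd n (copies F G) (enough n G D≤n (<⇒≤ lt)) few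
    where
    n₀   = proj₁ (many-embeddings F col K)
    many = proj₂ (many-embeddings F col K)
    -- The first summand is the order from which supersaturation applies; the second is its constant
    -- times the loss in passing from embeddings to copies.
    D = n₀ + n₀ * f ^ f

    enough : ∀ n .{{_ : NonZero n}} (G : Graph n) → D ≤ n → n ^ k ≤ K * homs (Vec.allFin k) G → n ^ f ≤ D * copies F G
    enough n G D≤n le = begin
      n ^ f                        ≤⟨ many n G (m+n≤o⇒m≤o n₀ D≤n) le ⟩
      n₀ * embeddings F G          ≤⟨ *-monoʳ-≤ n₀ (embeddings≤copies F G) ⟩
      n₀ * (f ^ f * copies F G)    ≡⟨ *-assoc n₀ (f ^ f) (copies F G) ⟨
      n₀ * f ^ f * copies F G      ≤⟨ *-monoˡ-≤ (copies F G) (m≤n+m _ n₀) ⟩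
      D * copies F G               ∎
      where open ≤-Reasoning

    -- Both bounds together give `suc D * x ≤ D * x`. This rules out a positive `x`, and for `x = 0`
    -- the first bound would make `n ^ f` vanish.
    absurd : ∀ n .{{_ : NonZero n}} x → n ^ f ≤ D * x → ¬ (suc D * x ≤ n ^ f)
    absurd n zero    le _   = n≮0 (≤-trans (m^n>0 n f) (≤-trans le (≤-reflexive (*-zeroʳ D))))
    absurd n (suc x) le le′ = <-irrefl refl (≤-trans (s≤s (m≤n+m (D * suc x) x)) (≤-trans le′ le))

-- Symmetrisation of lists of weighted, labelled vertices.

module ZykovSymmetrisation where
  open FiniteSums
  open import Data.Bool using (Bool; true; false; _∨_; if_then_else_)
  import Data.Bool.Properties as Bool
  open import Data.Fin using (Fin)
  open import Data.List using (List; []; _∷_; _++_; map; length)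
  open import Data.List.Properties using (length-map; ++-assoc; ++-identityʳ)
  open import Data.List.Relation.Binary.Permutation.Propositional using (_↭_; ↭-refl; ↭-sym; ↭-trans; ↭-reflexive; prep; swap)
  open import Data.List.Relation.Binary.Permutation.Propositional.Properties using (shift; ↭-length; map⁺; ++⁺ʳ; All-resp-↭)
  open import Data.List.Relation.Unary.All as All using (All; []; _∷_)
  open import Data.List.Relation.Unary.All.Properties using (¬All⇒Any¬)
  open import Data.List.Relation.Unary.AllPairs using (AllPairs; []; _∷_)
  import Data.List.Relation.Unary.AllPairs.Properties as AllPairs
  open import Data.List.Relation.Unary.Any using (Any; here; there)
  open import Data.Nat using (ℕ; suc; _+_; _*_; _∸_; _≤_; z≤n; s≤s; NonZero)
  open import Data.Nat.Properties
  open import Data.Nat.Tactic.RingSolver using (solve-∀)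
  open import Data.Product using (_×_; _,_; ∃; ∃₂; proj₁; proj₂)
  open import Data.Sum using (_⊎_; inj₁; inj₂)
  open import Function using (_∘_; id)
  open import Relation.Binary using (Rel; Decidable)
  open import Relation.Binary.PropositionalEquality as ≡ using (_≡_; refl; cong; cong₂; sym; subst; subst₂; module ≡-Reasoning)
  open import Relation.Nullary using (yes; no; ¬_; contradiction)
  open import Relation.Nullary.Decidable using (_→-dec_)
  open import Level using (0ℓ)

  module _ {A : Set} {R : Rel A 0ℓ} (R? : Decidable R) where

    extract : ∀ {P : A → Set} {xs : List A} → Any P xs → ∃₂ λ x xs′ → xs ↭ x ∷ xs′ × P x
    extract (here {x} {xs} px) = x , xs , ↭-refl , px
    extract (there {y} any)    = let x , xs , xs↭ , px = extract any in
      x , y ∷ xs , ↭-trans (prep y xs↭) (swap y x ↭-refl) , px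

    -- An unrelated pair is returned at the front of a permutation of the list, the form in which
    -- two entries can be merged.
    allPairs⊎unrelated : ∀ xs → AllPairs R xs ⊎ (∃₂ λ x y → ∃ λ xs′ → xs ↭ x ∷ y ∷ xs′ × ¬ R x y)
    allPairs⊎unrelated []       = inj₁ []
    allPairs⊎unrelated (z ∷ xs) with allPairs⊎unrelated xs
    ... | inj₂ (x , y , xs′ , xs↭ , ¬xy) = inj₂ (x , y , z ∷ xs′ ,
          ↭-trans (prep z xs↭) (↭-trans (swap z x ↭-refl) (prep x (swap z y ↭-refl))) , ¬xy)
    ... | inj₁ rs with All.all? (R? z) xs
    ...   | yes zs = inj₁ (zs ∷ rs)
    ...   | no ¬zs = let y , xs′ , xs↭ , ¬zy = extract (¬All⇒Any¬ (R? z) xs ¬zs) in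
                     inj₂ (z , y , xs′ , prep z xs↭ , ¬zy)

  2xy≤x²+y²-ordered : ∀ {x y} → x ≤ y → 2 * (x * y) ≤ x * x + y * y
  2xy≤x²+y²-ordered {x} {y} x≤y = subst (λ y → 2 * (x * y) ≤ x * x + y * y) (m+[n∸m]≡n x≤y)
    (≤-trans (m≤m+n _ ((y ∸ x) * (y ∸ x))) (≤-reflexive (lem x (y ∸ x))))
    where
    lem : ∀ x d → 2 * (x * (x + d)) + d * d ≡ x * x + (x + d) * (x + d)
    lem = solve-∀

  2xy≤x²+y² : ∀ x y → 2 * (x * y) ≤ x * x + y * y
  2xy≤x²+y² x y with ≤-total x y
  ... | inj₁ x≤y = 2xy≤x²+y²-ordered x≤y
  ... | inj₂ y≤x = subst₂ _≤_ (cong (2 *_) (*-comm y x)) (+-comm (y * y) (x * x)) (2xy≤x²+y²-ordered y≤x)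

  module Symmetrisation {n : ℕ} (G : Graph n) where

    -- A true `label` means that weight from `M` has been merged into the entry; in the second stage
    -- its `vertex` may nevertheless lie outside `M`.
    record Entry : Set where
      constructor entry
      field
        vertex : Fin n
        weight : ℕ
        label  : Bool
    open Entry public

    private
      V = Fin n

    a : V → V → ℕ
    a u v = 𝟙 (Adj? G u v)

    a-sym : ∀ u v → a u v ≡ a v u
    a-sym u v = 𝟙-cong (Adj? G u v) (Adj? G v u) (Graph.symmetric G) (Graph.symmetric G)

    degree : V → List Entry → ℕ
    degree v l = ∑ l (λ x → weight x * a v (vertex x))

    -- A list may repeat a vertex, as samples are drawn with repetition. Repeated entries are
    -- non-adjacent by irreflexivity, so they contribute nothing here and are merged like any other
    -- non-adjacent pair.
    edgeWeight : List Entry → ℕ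
    edgeWeight []      = 0
    edgeWeight (x ∷ l) = weight x * degree (vertex x) l + edgeWeight l

    edgeWeight-↭ : ∀ {l l′} → l ↭ l′ → edgeWeight l ≡ edgeWeight l′
    edgeWeight-↭ _↭_.refl = refl
    edgeWeight-↭ (prep x p) = cong₂ (λ d s → weight x * d + s) (∑-↭ _ p) (edgeWeight-↭ p)
    edgeWeight-↭ (swap {l} {l′} x y p) = begin
      weight x * (weight y * a (vertex x) (vertex y) + degree (vertex x) l) + (weight y * degree (vertex y) l + edgeWeight l)
        ≡⟨ lem (weight x) (weight y) (a (vertex x) (vertex y)) _ _ _ ⟩
      weight y * (weight x * a (vertex x) (vertex y) + degree (vertex y) l) + (weight x * degree (vertex x) l + edgeWeight l)
        ≡⟨ cong₂ _+_ (cong₂ (λ c d → weight y * (weight x * c + d)) (a-sym (vertex x) (vertex y)) (∑-↭ _ p))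
                     (cong₂ (λ d s → weight x * d + s) (∑-↭ _ p) (edgeWeight-↭ p)) ⟩
      weight y * (weight x * a (vertex y) (vertex x) + degree (vertex y) l′) + (weight x * degree (vertex x) l′ + edgeWeight l′) ∎
      where
      open ≡-Reasoning
      lem : ∀ u v c d d′ s → u * (v * c + d) + (v * d′ + s) ≡ v * (u * c + d′) + (u * d + s)
      lem = solve-∀
    edgeWeight-↭ (_↭_.trans p q) = ≡.trans (edgeWeight-↭ p) (edgeWeight-↭ q)

    degree≤weight : ∀ v l → degree v l ≤ ∑ l weight
    degree≤weight v l = ∑-mono l (λ x _ → ≤-trans (*-monoʳ-≤ (weight x) (𝟙≤1 (Adj? G v (vertex x)))) (≤-reflexive (*-identityʳ (weight x))))

    -- Expand the square of the total weight and bound every adjacency indicator by 1; for a clique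
    -- this is an equality.
    edgeWeight-bound : ∀ l → 2 * edgeWeight l + ∑ l (λ x → weight x * weight x) ≤ ∑ l weight * ∑ l weight
    edgeWeight-bound []      = z≤n
    edgeWeight-bound (x ∷ l) = begin
      2 * (w * degree (vertex x) l + edgeWeight l) + (w * w + s)
        ≡⟨ lem w (degree (vertex x) l) (edgeWeight l) s ⟩
      2 * (w * degree (vertex x) l) + w * w + (2 * edgeWeight l + s)
        ≤⟨ +-mono-≤ (+-monoˡ-≤ (w * w) (*-monoʳ-≤ 2 (*-monoʳ-≤ w (degree≤weight (vertex x) l)))) (edgeWeight-bound l) ⟩
      2 * (w * t) + w * w + t * t
        ≡⟨ lem′ w t ⟩
      (w + t) * (w + t) ∎
      where
      open ≤-Reasoning
      w = weight x
      t = ∑ l weight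
      s = ∑ l (λ x → weight x * weight x)
      lem : ∀ w d q s → 2 * (w * d + q) + (w * w + s) ≡ 2 * (w * d) + w * w + (2 * q + s)
      lem = solve-∀
      lem′ : ∀ w t → 2 * (w * t) + w * w + t * t ≡ (w + t) * (w + t)
      lem′ = solve-∀

    mergeAt : V → Entry → Entry → Entry
    mergeAt v x y = entry v (weight x + weight y) (label x ∨ label y)

    edgeWeight-nonadjacent : ∀ x y l → ¬ Adj G (vertex x) (vertex y) →
      edgeWeight (x ∷ y ∷ l) ≡ weight x * degree (vertex x) l + weight y * degree (vertex y) l + edgeWeight l
    edgeWeight-nonadjacent x y l ¬xy = ≡.trans
      (cong (λ c → weight x * (weight y * c + degree (vertex x) l) + (weight y * degree (vertex y) l + edgeWeight l))
            (𝟙-no (Adj? G (vertex x) (vertex y)) ¬xy))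
      (lem (weight x) (weight y) (degree (vertex x) l) (degree (vertex y) l) (edgeWeight l))
      where
      lem : ∀ u v d d′ s → u * (v * 0 + d) + (v * d′ + s) ≡ u * d + v * d′ + s
      lem = solve-∀

    -- Without an edge between `x` and `y`, the edge weight is linear in the way their joint weight
    -- is divided between the two vertices. Moving all of it to the vertex of larger degree
    -- therefore loses nothing.
    edgeWeight-merge : ∀ x y l → ¬ Adj G (vertex x) (vertex y) →
      ∃ λ v → (v ≡ vertex x ⊎ v ≡ vertex y) × edgeWeight (x ∷ y ∷ l) ≤ edgeWeight (mergeAt v x y ∷ l)
    edgeWeight-merge x y l ¬xy with ≤-total (degree (vertex y) l) (degree (vertex x) l)
    ... | inj₁ dy≤dx = vertex x , inj₁ refl , ≤-trans (≤-reflexive (edgeWeight-nonadjacent x y l ¬xy))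
            (+-monoˡ-≤ (edgeWeight l) (≤-trans (+-monoʳ-≤ (weight x * degree (vertex x) l) (*-monoʳ-≤ (weight y) dy≤dx))
              (≤-reflexive (sym (*-distribʳ-+ (degree (vertex x) l) (weight x) (weight y))))))
    ... | inj₂ dx≤dy = vertex y , inj₂ refl , ≤-trans (≤-reflexive (edgeWeight-nonadjacent x y l ¬xy))
            (+-monoˡ-≤ (edgeWeight l) (≤-trans (+-monoˡ-≤ (weight y * degree (vertex y) l) (*-monoʳ-≤ (weight x) dx≤dy))
              (≤-reflexive (sym (*-distribʳ-+ (degree (vertex y) l) (weight x) (weight y))))))

    module _ {R : Rel Entry 0ℓ} (R? : Decidable R)
             (adj⇒R : ∀ {x y} → Adj G (vertex x) (vertex y) → R x y)
             (Inv : List Entry → Set)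
             (resp : ∀ {l l′} → l ↭ l′ → Inv l → Inv l′)
             (step : ∀ x y l {v} → ¬ R x y → v ≡ vertex x ⊎ v ≡ vertex y →
                     Inv (x ∷ y ∷ l) → Inv (mergeAt v x y ∷ l))
             where

      -- Each merge shortens the list, so `k` bounds the number of merges. Unrelated entries are
      -- non-adjacent by `adj⇒R`, so no merge lowers the edge weight.
      mergeAll′ : ∀ k l → length l ≤ k → Inv l → ∃ λ l′ → AllPairs R l′ × Inv l′ × edgeWeight l ≤ edgeWeight l′
      mergeAll′ k l len inv with allPairs⊎unrelated R? l
      mergeAll′ k l len inv | inj₁ rs = l , rs , inv , ≤-refl
      mergeAll′ k l len inv | inj₂ (x , y , xs , l↭ , ¬xy)
        with edgeWeight-merge x y xs (¬xy ∘ adj⇒R) | subst (_≤ k) (↭-length l↭) len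
      mergeAll′ (suc k) l len inv | inj₂ (x , y , xs , l↭ , ¬xy) | v , v≡ , le | s≤s len′ =
        let l′ , rs , inv′ , le′ = mergeAll′ k (mergeAt v x y ∷ xs) len′ (step x y xs ¬xy v≡ (resp l↭ inv))
        in l′ , rs , inv′ , ≤-trans (≤-reflexive (edgeWeight-↭ l↭)) (≤-trans le le′)

      mergeAll : ∀ l → Inv l → ∃ λ l′ → AllPairs R l′ × Inv l′ × edgeWeight l ≤ edgeWeight l′
      mergeAll l = mergeAll′ (length l) l ≤-refl

    weight₁ count₁ : Entry → ℕ
    weight₁ x = if label x then weight x else 0
    count₁ x = if label x then 1 else 0

    labelled unlabelled : List Entry → List V
    labelled []                  = []
    labelled (entry v _ true ∷ l)  = v ∷ labelled l
    labelled (entry v _ false ∷ l) = labelled l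
    unlabelled []                  = []
    unlabelled (entry v _ true ∷ l)  = unlabelled l
    unlabelled (entry v _ false ∷ l) = v ∷ unlabelled l

    labelled-unlabelled : ∀ l → labelled l ++ unlabelled l ↭ map vertex l
    labelled-unlabelled []                    = ↭-refl
    labelled-unlabelled (entry v _ true ∷ l)  = prep v (labelled-unlabelled l)
    labelled-unlabelled (entry v _ false ∷ l) = ↭-trans (shift v (labelled l) (unlabelled l)) (prep v (labelled-unlabelled l))

    length-labelled : ∀ l → length (labelled l) ≡ ∑ l count₁
    length-labelled []                    = refl
    length-labelled (entry v _ true ∷ l)  = cong suc (length-labelled l)
    length-labelled (entry v _ false ∷ l) = length-labelled l

    All-labelled : ∀ {P : V → Set} {l} → All (λ x → label x ≡ true → P (vertex x)) l → All P (labelled l)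
    All-labelled []                            = []
    All-labelled {l = entry _ _ true ∷ _}  (p ∷ ps) = p refl ∷ All-labelled ps
    All-labelled {l = entry _ _ false ∷ _} (p ∷ ps) = All-labelled ps

    -- This fails only for two labelled entries, so restoring it by merging leaves unlabelled
    -- entries alone.
    AdjIfLabelled : Rel Entry 0ℓ
    AdjIfLabelled x y = label x ≡ true → label y ≡ true → Adj G (vertex x) (vertex y)

    adjIfLabelled? : Decidable AdjIfLabelled
    adjIfLabelled? x y = (label x Bool.≟ true) →-dec ((label y Bool.≟ true) →-dec Adj? G (vertex x) (vertex y))

    AllPairs-labelled : ∀ {l} → AllPairs AdjIfLabelled l → AllPairs (Adj G) (labelled l)
    AllPairs-labelled [] = []
    AllPairs-labelled {l = entry _ _ true ∷ _}  (p ∷ ps) = All-labelled (All.map (λ h → h refl) p) ∷ AllPairs-labelled ps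
    AllPairs-labelled {l = entry _ _ false ∷ _} (p ∷ ps) = AllPairs-labelled ps

    -- Inclusion of multisets. Vertices surviving the merges remain among the sampled ones, so
    -- clique bounds for the sample carry over to them.
    _⊑_ : List V → List V → Set
    us ⊑ vs = ∃ λ zs → us ++ zs ↭ vs

    ⊑-resp-↭ : ∀ {us us′ vs} → us ↭ us′ → us ⊑ vs → us′ ⊑ vs
    ⊑-resp-↭ p (zs , q) = zs , ↭-trans (++⁺ʳ zs (↭-sym p)) q

    ⊑-merge : ∀ {x y v us vs} → v ≡ x ⊎ v ≡ y → (x ∷ y ∷ us) ⊑ vs → (v ∷ us) ⊑ vs
    ⊑-merge {x} {y} {us = us} (inj₁ refl) (zs , p) = y ∷ zs , ↭-trans (prep x (shift y us zs)) p
    ⊑-merge {x} {y} {us = us} (inj₂ refl) (zs , p) = x ∷ zs , ↭-trans (prep y (shift x us zs)) (↭-trans (swap y x ↭-refl) p)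

    ⊑-trans : ∀ {us vs ws} → us ⊑ vs → vs ⊑ ws → us ⊑ ws
    ⊑-trans {us} (zs , p) (zs′ , q) = zs ++ zs′ ,
      ↭-trans (↭-reflexive (sym (++-assoc us zs zs′))) (↭-trans (++⁺ʳ zs′ p) q)

    module _ (p q : ℕ) .{{_ : NonZero p}} .{{_ : NonZero q}} (A B : ℕ) (ratio : p * B ≤ q * A) where

      private
        α = q * A
        β = p * B
        Z = q * (A * A) + p * (B * B)

      -- This is `p * q` times the extremal weight, which is A/p on a labelled entry and B/q on an
      -- unlabelled one. Likewise `Z` is `p * q` times the extremal sum of squares A²/p + B²/q, and
      -- `ratio` says `β ≤ α`.
      θ : Entry → ℕ
      θ x = if label x then α else β

      -- With c labels the sum is at most c α² + (p + q - c) β². By `β ≤ α` this is largest at c =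
      -- p, where it equals `p * q * Z`.
      ∑θ² : ∀ l → ∑ l count₁ ≤ p → length l ≤ p + q → ∑ l (λ x → θ x * θ x) ≤ p * q * Z
      ∑θ² l cnt len = begin
        ∑ l (λ x → θ x * θ x)
          -- Adding c β² on both sides replaces the number of unlabelled entries by the length and
          -- so avoids subtraction.
          ≤⟨ +-cancelʳ-≤ (∑ l count₁ * (β * β)) _ _ (begin
             ∑ l (λ x → θ x * θ x) + ∑ l count₁ * (β * β)   ≡⟨ sum-eq l ⟩
             ∑ l count₁ * (α * α) + length l * (β * β)       ≤⟨ +-monoʳ-≤ (c * (α * α)) (*-monoˡ-≤ (β * β) len) ⟩
             c * (α * α) + (p + q) * (β * β)                 ≤⟨ exchange c p q (α * α) (β * β) cnt (*-mono-≤ ratio ratio) ⟩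
             p * (α * α) + q * (β * β) + c * (β * β)         ∎) ⟩
        p * (α * α) + q * (β * β)
          ≡⟨ lem p q A B ⟩
        p * q * Z ∎
        where
        open ≤-Reasoning
        c = ∑ l count₁

        lem : ∀ p q A B → p * (q * A * (q * A)) + q * (p * B * (p * B)) ≡ p * q * (q * (A * A) + p * (B * B))
        lem = solve-∀

        sum-eq : ∀ l → ∑ l (λ x → θ x * θ x) + ∑ l count₁ * (β * β) ≡ ∑ l count₁ * (α * α) + length l * (β * β)
        sum-eq [] = refl
        sum-eq (entry _ _ true ∷ l) = ≡.trans (l₁ (α * α) (β * β) (∑ l (λ x → θ x * θ x)) (∑ l count₁)) (≡.trans (cong (λ z → α * α + (β * β + z)) (sum-eq l)) (l₂ (α * α) (β * β) (∑ l count₁) (length l)))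
          where
          l₁ : ∀ x y s c → x + s + (1 + c) * y ≡ x + (y + (s + c * y))
          l₁ = solve-∀
          l₂ : ∀ x y c m → x + (y + (c * x + m * y)) ≡ (1 + c) * x + (1 + m) * y
          l₂ = solve-∀
        sum-eq (entry _ _ false ∷ l) = ≡.trans (+-assoc (β * β) _ _) (≡.trans (cong (β * β +_) (sum-eq l)) (l₂ (α * α) (β * β) (∑ l count₁) (length l)))
          where
          l₂ : ∀ x y c m → y + (c * x + m * y) ≡ c * x + (1 + m) * y
          l₂ = solve-∀

        exchange : ∀ c p q x y → c ≤ p → y ≤ x → c * x + (p + q) * y ≤ p * x + q * y + c * y
        exchange c p q x y c≤p y≤x = subst (λ p → c * x + (p + q) * y ≤ p * x + q * y + c * y) (m+[n∸m]≡n c≤p)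
          (≤-trans (≤-reflexive (e₁ c (p ∸ c) q x y)) (≤-trans (+-monoʳ-≤ (c * x + (c * y + q * y)) (*-monoʳ-≤ (p ∸ c) y≤x)) (≤-reflexive (e₂ c (p ∸ c) q x y))))
          where
          e₁ : ∀ c d q x y → c * x + (c + d + q) * y ≡ c * x + (c * y + q * y) + d * y
          e₁ = solve-∀
          e₂ : ∀ c d q x y → c * x + (c * y + q * y) + d * x ≡ (c + d) * x + q * y + c * y
          e₂ = solve-∀

      -- The sum equals α a′ + β (A + B - a′) for the labelled weight a′. It grows with a′ because
      -- `β ≤ α`, and at a′ = A its value is `Z`.
      ∑θw : ∀ l → A ≤ ∑ l weight₁ → ∑ l weight ≡ A + B → Z ≤ ∑ l (λ x → θ x * weight x)
      ∑θw l A≤ total = +-cancelʳ-≤ (β * a′) _ _ (begin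
        Z + β * a′                                     ≡⟨ lem p q A B a′ ⟩
        α * A + β * B + β * a′                         ≤⟨ exchange A a′ A≤ ⟩
        α * a′ + β * (A + B)                           ≡⟨ cong (λ z → α * a′ + β * z) total ⟨
        α * a′ + β * ∑ l weight                        ≡⟨ sum-eq l ⟨
        ∑ l (λ x → θ x * weight x) + β * a′            ∎)
        where
        open ≤-Reasoning
        a′ = ∑ l weight₁

        lem : ∀ p q A B z → q * (A * A) + p * (B * B) + p * B * z ≡ q * A * A + p * B * B + p * B * z
        lem = solve-∀

        exchange : ∀ A a′ → A ≤ a′ → α * A + β * B + β * a′ ≤ α * a′ + β * (A + B)
        exchange A a′ A≤a′ = subst (λ z → α * A + β * B + β * z ≤ α * z + β * (A + B)) (m+[n∸m]≡n A≤a′)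
          (≤-trans (≤-reflexive (e₁ α β A B (a′ ∸ A))) (≤-trans (+-monoʳ-≤ (α * A + β * (A + B)) (*-monoˡ-≤ (a′ ∸ A) ratio)) (≤-reflexive (e₂ α β A B (a′ ∸ A)))))
          where
          e₁ : ∀ α β A B d → α * A + β * B + β * (A + d) ≡ α * A + β * (A + B) + β * d
          e₁ = solve-∀
          e₂ : ∀ α β A B d → α * A + β * (A + B) + α * d ≡ α * (A + d) + β * (A + B)
          e₂ = solve-∀

        sum-eq : ∀ l → ∑ l (λ x → θ x * weight x) + β * ∑ l weight₁ ≡ α * ∑ l weight₁ + β * ∑ l weight
        sum-eq [] = ≡.trans (*-zeroʳ β) (sym (cong₂ _+_ (*-zeroʳ α) (*-zeroʳ β)))
        sum-eq (entry _ w true ∷ l) = ≡.trans (l₁ α β w _ _) (≡.trans (cong (λ z → α * w + (β * w + z)) (sum-eq l)) (l₂ α β w _ _))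
          where
          l₁ : ∀ α β w s c → α * w + s + β * (w + c) ≡ α * w + (β * w + (s + β * c))
          l₁ = solve-∀
          l₂ : ∀ α β w c m → α * w + (β * w + (α * c + β * m)) ≡ α * (w + c) + β * (w + m)
          l₂ = solve-∀
        sum-eq (entry _ w false ∷ l) = ≡.trans (+-assoc (β * w) _ _) (≡.trans (cong (β * w +_) (sum-eq l)) (l₂ α β w _ _))
          where
          l₂ : ∀ α β w c m → β * w + (α * c + β * m) ≡ α * c + β * (w + m)
          l₂ = solve-∀

      -- Each square is bounded below by its tangent at the weight A/p or
      -- B/q which the extremal configuration assigns to that label.
      clique-weights : ∀ l → ∑ l count₁ ≤ p → length l ≤ p + q → A ≤ ∑ l weight₁ → ∑ l weight ≡ A + B →
                       Z ≤ p * q * ∑ l (λ x → weight x * weight x)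
      clique-weights l cnt len A≤ total = *-cancelˡ-≤ P {{m*n≢0 p q}} (+-cancelʳ-≤ (P * Z) _ _ (begin
        P * Z + P * Z                                            ≡⟨ cong (P * Z +_) (+-identityʳ (P * Z)) ⟨
        2 * (P * Z)                                              ≤⟨ *-monoʳ-≤ 2 (*-monoʳ-≤ P (∑θw l A≤ total)) ⟩
        2 * (P * ∑ l (λ x → θ x * weight x))                     ≡⟨ ≡.trans (∑-*ˡ l 2 _) (cong (2 *_) (∑-*ˡ l P _)) ⟨
        ∑ l (λ x → 2 * (P * (θ x * weight x)))                   ≤⟨ ∑-mono l (λ x _ → tangent (θ x) (weight x)) ⟩
        ∑ l (λ x → P * (P * (weight x * weight x)) + θ x * θ x)  ≡⟨ ∑-distrib-+ l _ _ ⟩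
        ∑ l (λ x → P * (P * (weight x * weight x))) + ∑ l (λ x → θ x * θ x)
          ≤⟨ +-mono-≤ (≤-reflexive (≡.trans (∑-*ˡ l P _) (cong (P *_) (∑-*ˡ l P _)))) (∑θ² l cnt len) ⟩
        P * (P * ∑ l (λ x → weight x * weight x)) + P * Z        ∎))
        where
        open ≤-Reasoning
        P = p * q
        tangent : ∀ t w → 2 * (P * (t * w)) ≤ P * (P * (w * w)) + t * t
        tangent t w = subst₂ _≤_ (e₁ P t w) (e₂ P t w) (2xy≤x²+y² (P * w) t)
          where
          e₁ : ∀ P t w → 2 * (P * w * t) ≡ 2 * (P * (t * w))
          e₁ = solve-∀
          e₂ : ∀ P t w → P * w * (P * w) + t * t ≡ P * (P * (w * w)) + t * t
          e₂ = solve-∀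

      module _ (M : V → Set) (l₀ : List Entry)
               (∑weight : ∑ l₀ weight ≡ A + B) (∑weight₁ : ∑ l₀ weight₁ ≡ A)
               (labelled⇒M : All (λ x → label x ≡ true → M (vertex x)) l₀)
               (clique-in-M : ∀ us → us ⊑ map vertex l₀ → AllPairs (Adj G) us → All M us → length us ≤ p)
               (clique : ∀ us → us ⊑ map vertex l₀ → AllPairs (Adj G) us → length us ≤ p + q)
               where

        -- Stage 1 merges labelled vertices only and so ends with a clique in M
        -- carrying at most p labels; as a merged vertex is labelled when one
        -- of the two was, stage 2 neither creates labels nor loses labelled weight.
        private
          Inv Inv₁ Inv₂ : List Entry → Set
          Inv  l = map vertex l ⊑ map vertex l₀ × ∑ l weight ≡ A + B × A ≤ ∑ l weight₁
          Inv₁ l = Inv l × All (λ x → label x ≡ true → M (vertex x)) l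
          Inv₂ l = Inv l × ∑ l count₁ ≤ p

          resp : ∀ {l l′} → l ↭ l′ → Inv l → Inv l′
          resp l↭l′ (sub , total , A≤) = ⊑-resp-↭ (map⁺ vertex l↭l′) sub
            , ≡.trans (sym (∑-↭ weight l↭l′)) total , subst (A ≤_) (∑-↭ weight₁ l↭l′) A≤

          step : ∀ x y l {v} → v ≡ vertex x ⊎ v ≡ vertex y → Inv (x ∷ y ∷ l) → Inv (mergeAt v x y ∷ l)
          step x y l v≡ (sub , total , A≤) = ⊑-merge v≡ sub
            , ≡.trans (+-assoc (weight x) (weight y) (∑ l weight)) total
            , ≤-trans A≤ (≤-trans (≤-reflexive (sym (+-assoc (weight₁ x) (weight₁ y) (∑ l weight₁))))
                                  (+-monoˡ-≤ (∑ l weight₁) (weight₁-merge x y)))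
            where
            weight₁-merge : ∀ x y → weight₁ x + weight₁ y ≤ (if label x ∨ label y then weight x + weight y else 0)
            weight₁-merge (entry _ w true)  (entry _ w′ true)  = ≤-refl
            weight₁-merge (entry _ w true)  (entry _ w′ false) = +-monoʳ-≤ w z≤n
            weight₁-merge (entry _ w false) (entry _ w′ true)  = m≤n+m w′ w
            weight₁-merge (entry _ w false) (entry _ w′ false) = z≤n

          step₁ : ∀ x y l {v} → ¬ AdjIfLabelled x y → v ≡ vertex x ⊎ v ≡ vertex y →
                  Inv₁ (x ∷ y ∷ l) → Inv₁ (mergeAt v x y ∷ l)
          -- A pair violating `AdjIfLabelled` carries two labels, so these two cases are vacuous. In
          -- the others both vertices lie in `M`, hence so does the survivor.
          step₁ (entry _ _ false) _                   l ¬xy _  _ = contradiction (λ ()) ¬xy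
          step₁ (entry _ _ true)  (entry _ _ false)   l ¬xy _  _ = contradiction (λ _ ()) ¬xy
          step₁ x@(entry _ _ true) y@(entry _ _ true) l ¬xy (inj₁ refl) (inv , x∈ ∷ y∈ ∷ l∈) = step x y l (inj₁ refl) inv , x∈ ∷ l∈
          step₁ x@(entry _ _ true) y@(entry _ _ true) l ¬xy (inj₂ refl) (inv , x∈ ∷ y∈ ∷ l∈) = step x y l (inj₂ refl) inv , y∈ ∷ l∈

          step₂ : ∀ x y l {v} → ¬ Adj G (vertex x) (vertex y) → v ≡ vertex x ⊎ v ≡ vertex y →
                  Inv₂ (x ∷ y ∷ l) → Inv₂ (mergeAt v x y ∷ l)
          step₂ x y l _ v≡ (inv , cnt) = step x y l v≡ inv , ≤-trans
            (≤-trans (+-monoˡ-≤ (∑ l count₁) (count₁-merge x y)) (≤-reflexive (+-assoc (count₁ x) (count₁ y) (∑ l count₁)))) cnt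
            where
            count₁-merge : ∀ x y → (if label x ∨ label y then 1 else 0) ≤ count₁ x + count₁ y
            count₁-merge (entry _ _ true)  y = m≤m+n 1 _
            count₁-merge (entry _ _ false) y = ≤-refl

          stage₁ : ∃ λ l → AllPairs AdjIfLabelled l × Inv₁ l × edgeWeight l₀ ≤ edgeWeight l
          stage₁ = mergeAll adjIfLabelled? (λ xy _ _ → xy) Inv₁
            (λ l↭l′ (inv , l∈) → resp l↭l′ inv , All-resp-↭ l↭l′ l∈) step₁ l₀
            ((([] , ↭-reflexive (++-identityʳ _)) , ∑weight , ≤-reflexive (sym ∑weight₁)) , labelled⇒M)

          stage₂ : ∃ λ l → AllPairs (λ x y → Adj G (vertex x) (vertex y)) l × Inv₂ l × edgeWeight (proj₁ stage₁) ≤ edgeWeight l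
          stage₂ = mergeAll (λ x y → Adj? G (vertex x) (vertex y)) id Inv₂
            (λ l↭l′ (inv , cnt) → resp l↭l′ inv , subst (_≤ p) (∑-↭ count₁ l↭l′) cnt) step₂ l₁
            (proj₁ inv₁ , subst (_≤ p) (length-labelled l₁)
              (clique-in-M (labelled l₁) (⊑-trans (unlabelled l₁ , labelled-unlabelled l₁) (proj₁ (proj₁ inv₁)))
                (AllPairs-labelled (proj₁ (proj₂ stage₁))) (All-labelled (proj₂ inv₁))))
            where
            l₁   = proj₁ stage₁
            inv₁ = proj₁ (proj₂ (proj₂ stage₁))

        -- Symmetrisation reduces the claim to a clique of at most `p + q` entries with at most `p`
        -- labels. There `clique-weights` bounds the sum of squares from below, and
        -- `edgeWeight-bound` subtracts it from the square of the total weight.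
        symmetrisation-bound : p * q * (2 * edgeWeight l₀) + (q * (A * A) + p * (B * B)) ≤ p * q * ((A + B) * (A + B))
        symmetrisation-bound = finish stage₁ stage₂
          where
          open ≤-Reasoning
          finish : (s₁ : ∃ λ l → AllPairs AdjIfLabelled l × Inv₁ l × edgeWeight l₀ ≤ edgeWeight l) →
                   (∃ λ l → AllPairs (λ x y → Adj G (vertex x) (vertex y)) l × Inv₂ l × edgeWeight (proj₁ s₁) ≤ edgeWeight l) →
                   p * q * (2 * edgeWeight l₀) + (q * (A * A) + p * (B * B)) ≤ p * q * ((A + B) * (A + B))
          finish (l₁ , _ , _ , le₁) (l , pairs , ((sub , total , A≤) , cnt) , le₂) = begin
            p * q * (2 * edgeWeight l₀) + Z
              ≤⟨ +-mono-≤ (*-monoʳ-≤ (p * q) (*-monoʳ-≤ 2 (≤-trans le₁ le₂)))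
                   (clique-weights l cnt (subst (_≤ p + q) (length-map vertex l) (clique (map vertex l) sub (AllPairs.map⁺ pairs))) A≤ total) ⟩
            p * q * (2 * edgeWeight l) + p * q * ∑ l (λ x → weight x * weight x)
              ≡⟨ *-distribˡ-+ (p * q) _ _ ⟨
            p * q * (2 * edgeWeight l + ∑ l (λ x → weight x * weight x))
              ≤⟨ *-monoʳ-≤ (p * q) (edgeWeight-bound l) ⟩
            p * q * (∑ l weight * ∑ l weight)
              ≡⟨ cong (λ z → p * q * (z * z)) total ⟩
            p * q * ((A + B) * (A + B)) ∎

-- Averaging over random samples.

module CliqueSampling where
  open FiniteSums
  open Homomorphisms
  open ZykovSymmetrisation
  open import Data.Bool using (Bool; true; false; if_then_else_)
  open import Data.Fin using (Fin; zero; suc)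
  open import Data.List using (List; []; _∷_; _++_; map; length; allFin; take; drop)
  open import Data.List.Membership.Propositional using (_∈_)
  open import Data.List.Properties using (take++drop≡id; length-take; ++-assoc)
  open import Data.List.Relation.Binary.Permutation.Propositional using (_↭_; ↭-refl; ↭-sym; ↭-trans; ↭-reflexive; prep; swap; ↭⇒↭ₛ)
  open import Data.List.Relation.Binary.Permutation.Propositional.Properties using (All-resp-↭)
  import Data.List.Relation.Binary.Permutation.Setoid.Properties as ↭ₛ
  open import Data.List.Relation.Binary.Pointwise using (Pointwise; []; _∷_)
  open import Data.List.Relation.Unary.All as All using (All; []; _∷_)
  import Data.List.Relation.Unary.All.Properties as All
  open import Data.List.Relation.Unary.AllPairs using (AllPairs; []; _∷_; allPairs?)
  import Data.List.Relation.Unary.AllPairs.Properties as AllPairs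
  open import Data.Nat using (ℕ; zero; suc; _+_; _*_; _^_; _≤_; z≤n; s≤s; NonZero; >-nonZero; >-nonZero⁻¹)
  open import Data.Nat.Properties
  open import Data.Nat.Tactic.RingSolver using (solve-∀)
  open import Data.Product using (_×_; _,_)
  open import Data.Unit using (tt)
  open import Data.Vec using (toList)
  open import Function using (_∘_; id)
  open import Relation.Binary.PropositionalEquality as ≡ using (_≡_; refl; cong; cong₂; sym; module ≡-Reasoning)
  open import Relation.Nullary using (Dec; contradiction)
  open import Relation.Nullary.Decidable using (_×-dec_)
  import Relation.Unary as U
  open import Relation.Unary.Properties using (U?)

  module _ {A : Set} where

    -- For the clique indicator this counts the cliques of a sample, chosen by position, so that
    -- repeated vertices stay distinct.
    subsequenceSum : ℕ → (List A → ℕ) → List A → ℕ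
    subsequenceSum zero    g xs       = g []
    subsequenceSum (suc r) g []       = 0
    subsequenceSum (suc r) g (x ∷ xs) = subsequenceSum r (g ∘ (x ∷_)) xs + subsequenceSum (suc r) g xs

    Symmetricᴸ : (List A → ℕ) → Set
    Symmetricᴸ g = ∀ {xs ys} → xs ↭ ys → g xs ≡ g ys

    subsequenceSum-cong : ∀ r {g g′ : List A → ℕ} → (∀ ys → g ys ≡ g′ ys) → ∀ xs → subsequenceSum r g xs ≡ subsequenceSum r g′ xs
    subsequenceSum-cong zero    eq xs       = eq []
    subsequenceSum-cong (suc r) eq []       = refl
    subsequenceSum-cong (suc r) eq (x ∷ xs) = cong₂ _+_ (subsequenceSum-cong r (eq ∘ (x ∷_)) xs) (subsequenceSum-cong (suc r) eq xs)

    subsequenceSum-↭ : ∀ r {g : List A → ℕ} → Symmetricᴸ g → ∀ {xs ys} → xs ↭ ys → subsequenceSum r g xs ≡ subsequenceSum r g ys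
    subsequenceSum-↭ zero    inv p = refl
    subsequenceSum-↭ (suc r) inv _↭_.refl = refl
    subsequenceSum-↭ (suc r) inv (prep x p) = cong₂ _+_ (subsequenceSum-↭ r (inv ∘ prep x) p) (subsequenceSum-↭ (suc r) inv p)
    subsequenceSum-↭ (suc zero) {g} inv (swap x y p) =
      ≡.trans (lem (g (x ∷ [])) (g (y ∷ [])) _) (cong (λ z → g (y ∷ []) + (g (x ∷ []) + z)) (subsequenceSum-↭ 1 inv p))
      where
      lem : ∀ a b c → a + (b + c) ≡ b + (a + c)
      lem = solve-∀
    -- Subsequences through both `x` and `y` correspond by the symmetry of `g`; those through
    -- exactly one of them exchange places in the sum.
    subsequenceSum-↭ (suc (suc r)) {g} inv {x ∷ y ∷ xs} {y ∷ x ∷ ys} (swap x y p) = ≡.trans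
      (cong₂ _+_ (cong₂ _+_ (≡.trans (subsequenceSum-↭ r (λ q → inv (prep x (prep y q))) p)
                                     (subsequenceSum-cong r (λ _ → inv (swap x y ↭-refl)) ys))
                            (subsequenceSum-↭ (suc r) (inv ∘ prep x) p))
                 (cong₂ _+_ (subsequenceSum-↭ (suc r) (inv ∘ prep y) p) (subsequenceSum-↭ (suc (suc r)) inv p)))
      (lem (subsequenceSum r (λ zs → g (y ∷ x ∷ zs)) ys) _ _ _)
      where
      lem : ∀ a b c d → a + b + (c + d) ≡ a + c + (b + d)
      lem = solve-∀
    subsequenceSum-↭ (suc r) inv (_↭_.trans p q) = ≡.trans (subsequenceSum-↭ (suc r) inv p) (subsequenceSum-↭ (suc r) inv q)

    subsequenceSum-prefix : ∀ (g : List A → ℕ) us zs → g us ≤ subsequenceSum (length us) g (us ++ zs)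
    subsequenceSum-prefix g []       zs = ≤-refl
    subsequenceSum-prefix g (u ∷ us) zs = ≤-trans (subsequenceSum-prefix (g ∘ (u ∷_)) us zs) (m≤m+n _ _)

  module Cliques {n : ℕ} (G : Graph n) {P : Fin n → Set} (P? : U.Decidable P) where
    open Symmetrisation G using (_⊑_)

    cliqueIn? : ∀ us → Dec (AllPairs (Adj G) us × All P us)
    cliqueIn? us = allPairs? (Adj? G) us ×-dec All.all? P? us

    cliqueIn : List (Fin n) → ℕ
    cliqueIn us = 𝟙 (cliqueIn? us)

    cliqueIn-symmetric : Symmetricᴸ cliqueIn
    cliqueIn-symmetric p = 𝟙-cong (cliqueIn? _) (cliqueIn? _) (resp p) (resp (↭-sym p))
      where
      resp : ∀ {us vs} → us ↭ vs → AllPairs (Adj G) us × All P us → AllPairs (Adj G) vs × All P vs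
      resp p (pairs , ps) = ↭ₛ.AllPairs-resp-↭ (≡.setoid (Fin n)) (Graph.symmetric G)
        ((λ { refl → id }) , (λ { refl → id })) (↭⇒↭ₛ p) pairs , All-resp-↭ p ps

    -- If `us` were longer, its first `suc r` vertices would form a clique. Permuting the sample to
    -- start with them makes them a counted subsequence, and the count does not depend on the order.
    clique-size : ∀ r {us vs} → subsequenceSum (suc r) cliqueIn vs ≡ 0 → us ⊑ vs →
                  AllPairs (Adj G) us → All P us → length us ≤ r
    clique-size r {us} {vs} none (zs , us++zs↭vs) pairs ps = ≮⇒≥ λ r<us → contradiction (positive r<us) (<⇒≱ (s≤s (≤-reflexive none)))
      where
      us₁ = take (suc r) us
      us₂ = drop (suc r) us

      split : us₁ ++ (us₂ ++ zs) ↭ vs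
      split = ↭-trans (↭-reflexive (≡.trans (sym (++-assoc us₁ us₂ zs)) (cong (_++ zs) (take++drop≡id (suc r) us)))) us++zs↭vs

      positive : suc r ≤ length us → 1 ≤ subsequenceSum (suc r) cliqueIn vs
      positive r<us = begin
        1
          ≡⟨ 𝟙-yes (cliqueIn? us₁) (AllPairs.take⁺ (suc r) pairs , All.take⁺ (suc r) ps) ⟨
        cliqueIn us₁
          ≤⟨ subsequenceSum-prefix cliqueIn us₁ (us₂ ++ zs) ⟩
        subsequenceSum (length us₁) cliqueIn (us₁ ++ (us₂ ++ zs))
          ≡⟨ cong (λ k → subsequenceSum k cliqueIn (us₁ ++ (us₂ ++ zs))) (≡.trans (length-take (suc r) us) (m≤n⇒m⊓n≡m r<us)) ⟩
        subsequenceSum (suc r) cliqueIn (us₁ ++ (us₂ ++ zs))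
          ≡⟨ subsequenceSum-↭ (suc r) cliqueIn-symmetric split ⟩
        subsequenceSum (suc r) cliqueIn vs ∎
        where open ≤-Reasoning

    -- Cliques are counted as ordered tuples, for comparison with `homs`.
    cliques : ℕ → ℕ
    cliques r = ∑ (vertexTuples n r) (cliqueIn ∘ toList)

  module Sampling {n : ℕ} (G : Graph n) (part : Bool → List (Fin n))
                  (part≤ : ∀ b h → ∑ (part b) h ≤ ∑ (allFin n) h) where
    open Symmetrisation G

    size : Bool → ℕ
    size b = length (part b)

    -- Weighting a sampled vertex by the size of its part gives all samples
    -- the same total weight and makes the expected edge weight a count of edges.
    sampleSum : List Bool → (List Entry → ℕ) → ℕ
    sampleSum []       F = F []
    sampleSum (b ∷ bs) F = ∑ (part b) (λ v → sampleSum bs (λ es → F (entry v (size b) b ∷ es)))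

    samples : List Bool → ℕ
    samples []       = 1
    samples (b ∷ bs) = size b * samples bs

    From : Bool → Entry → Set
    From b x = label x ≡ b × weight x ≡ size b × vertex x ∈ part b

    sampleSum-mono : ∀ bs {F F′ : List Entry → ℕ} → (∀ es → Pointwise From bs es → F es ≤ F′ es) → sampleSum bs F ≤ sampleSum bs F′
    sampleSum-mono []       le = le [] []
    sampleSum-mono (b ∷ bs) le = ∑-mono (part b) (λ v v∈ → sampleSum-mono bs (λ es from → le _ ((refl , refl , v∈) ∷ from)))

    sampleSum-const : ∀ bs c → sampleSum bs (λ _ → c) ≡ samples bs * c
    sampleSum-const []       c = sym (+-identityʳ c)
    sampleSum-const (b ∷ bs) c = ≡.trans (∑-const (part b) _) (≡.trans (cong (size b *_) (sampleSum-const bs c)) (sym (*-assoc (size b) _ c)))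

    sampleSum-+ : ∀ bs F F′ → sampleSum bs (λ es → F es + F′ es) ≡ sampleSum bs F + sampleSum bs F′
    sampleSum-+ []       F F′ = refl
    sampleSum-+ (b ∷ bs) F F′ = ≡.trans (∑-cong (part b) (λ v _ → sampleSum-+ bs _ _)) (∑-distrib-+ (part b) _ _)

    sampleSum-*ˡ : ∀ bs c F → sampleSum bs (λ es → c * F es) ≡ c * sampleSum bs F
    sampleSum-*ˡ []       c F = refl
    sampleSum-*ˡ (b ∷ bs) c F = ≡.trans (∑-cong (part b) (λ v _ → sampleSum-*ˡ bs c _)) (∑-*ˡ (part b) c _)

    -- Linearity of expectation: the weight `size b` cancels the probability 1/`size b` of drawing a
    -- given vertex.
    sampleSum-marginal : ∀ bs (h : Fin n → ℕ) →
      sampleSum bs (λ es → ∑ es (λ x → weight x * h (vertex x))) ≡ samples bs * ∑ bs (λ b → ∑ (part b) h)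
    sampleSum-marginal []       h = refl
    sampleSum-marginal (b ∷ bs) h = begin
      ∑ (part b) (λ v → sampleSum bs (λ es → size b * h v + ∑ es (λ x → weight x * h (vertex x))))
        ≡⟨ ∑-cong (part b) (λ v _ → ≡.trans (sampleSum-+ bs _ _) (cong₂ _+_ (≡.trans (sampleSum-const bs _) (sym (*-assoc (samples bs) (size b) (h v)))) (sampleSum-marginal bs h))) ⟩
      ∑ (part b) (λ v → samples bs * size b * h v + samples bs * rest)
        ≡⟨ ≡.trans (∑-distrib-+ (part b) _ _) (cong₂ _+_ (∑-*ˡ (part b) (samples bs * size b) h) (∑-const (part b) _)) ⟩
      samples bs * size b * ∑ (part b) h + size b * (samples bs * rest)
        ≡⟨ lem (samples bs) (size b) _ _ ⟩
      size b * samples bs * (∑ (part b) h + rest) ∎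
      where
      open ≡-Reasoning
      rest = ∑ bs (λ b → ∑ (part b) h)
      lem : ∀ t s x y → t * s * x + s * (t * y) ≡ s * t * (x + y)
      lem = solve-∀

    edgesBetween : Bool → Bool → ℕ
    edgesBetween b b′ = ∑ (part b) (λ u → ∑ (part b′) (λ v → a u v))

    edgesBetween-sym : ∀ b b′ → edgesBetween b b′ ≡ edgesBetween b′ b
    edgesBetween-sym b b′ = ≡.trans (∑-swap (part b) (part b′) a) (∑-cong (part b′) (λ v _ → ∑-cong (part b) (λ u _ → a-sym u v)))

    -- The expected edge weight of a sample, one term for each pair of positions.
    pairEdges : List Bool → ℕ
    pairEdges []       = 0
    pairEdges (b ∷ bs) = ∑ bs (edgesBetween b) + pairEdges bs

    sampleSum-edgeWeight : ∀ bs → sampleSum bs edgeWeight ≡ samples bs * pairEdges bs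
    sampleSum-edgeWeight []       = refl
    sampleSum-edgeWeight (b ∷ bs) = begin
      ∑ (part b) (λ v → sampleSum bs (λ es → size b * degree v es + edgeWeight es))
        ≡⟨ ∑-cong (part b) (λ v _ → ≡.trans (sampleSum-+ bs _ _) (cong₂ _+_ (≡.trans (sampleSum-*ˡ bs (size b) _) (cong (size b *_) (sampleSum-marginal bs (a v)))) (sampleSum-edgeWeight bs))) ⟩
      ∑ (part b) (λ v → size b * (samples bs * ∑ bs (λ b′ → ∑ (part b′) (a v))) + samples bs * pairEdges bs)
        ≡⟨ ≡.trans (∑-distrib-+ (part b) _ _) (cong₂ _+_ (≡.trans (∑-*ˡ (part b) (size b) _) (cong (size b *_) (≡.trans (∑-*ˡ (part b) (samples bs) _) (cong (samples bs *_) (∑-swap (part b) bs _))))) (∑-const (part b) _)) ⟩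
      size b * (samples bs * ∑ bs (edgesBetween b)) + size b * (samples bs * pairEdges bs)
        ≡⟨ lem (samples bs) (size b) _ _ ⟩
      size b * samples bs * (∑ bs (edgesBetween b) + pairEdges bs) ∎
      where
      open ≡-Reasoning
      lem : ∀ t s x y → s * (t * x) + s * (t * y) ≡ s * t * (x + y)
      lem = solve-∀

    -- The double sum runs over ordered pairs of positions. Its diagonal is what a sample misses, as
    -- a position is not paired with itself.
    pairEdges-double : ∀ bs → 2 * pairEdges bs + ∑ bs (λ b → edgesBetween b b) ≡ ∑ bs (λ b → ∑ bs (edgesBetween b))
    pairEdges-double []       = refl
    pairEdges-double (b ∷ bs) = begin
      2 * (x + pairEdges bs) + (d + ∑ bs (λ b → edgesBetween b b))
        ≡⟨ lem x (pairEdges bs) d _ ⟩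
      d + x + (x + (2 * pairEdges bs + ∑ bs (λ b → edgesBetween b b)))
        ≡⟨ cong (d + x +_) (cong₂ _+_ (∑-cong bs (λ b′ _ → edgesBetween-sym b b′)) (pairEdges-double bs)) ⟩
      d + x + (∑ bs (λ b′ → edgesBetween b′ b) + ∑ bs (λ b → ∑ bs (edgesBetween b)))
        ≡⟨ cong (d + x +_) (∑-distrib-+ bs _ _) ⟨
      d + x + ∑ bs (λ b′ → edgesBetween b′ b + ∑ bs (edgesBetween b′)) ∎
      where
      open ≡-Reasoning
      d = edgesBetween b b
      x = ∑ bs (edgesBetween b)
      lem : ∀ x r d s → 2 * (x + r) + (d + s) ≡ d + x + (x + (2 * r + s))
      lem = solve-∀

    -- Each position is either skipped, with factor 1, or used, and then it hits a given vertex with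
    -- probability at most K/n. Adding up all choices gives `(1 + K) ^ length bs`, whatever `r` is.
    sampleSum-subsequences : ∀ K bs → All (λ b → n ≤ K * size b) bs → ∀ r (g : List (Fin n) → ℕ) →
      n ^ r * sampleSum bs (λ es → subsequenceSum r g (map vertex es)) ≤
      (1 + K) ^ length bs * (samples bs * ∑ (vertexTuples n r) (g ∘ toList))
    sampleSum-subsequences K bs large zero g = begin
      1 * sampleSum bs (λ _ → g [])                           ≡⟨ ≡.trans (*-identityˡ _) (sampleSum-const bs (g [])) ⟩
      samples bs * g []                                       ≡⟨ cong (samples bs *_) (+-identityʳ (g [])) ⟨
      samples bs * (g [] + 0)                                 ≤⟨ m≤n*m _ ((1 + K) ^ length bs) {{m^n≢0 (1 + K) (length bs)}} ⟩
      (1 + K) ^ length bs * (samples bs * (g [] + 0))         ∎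
      where open ≤-Reasoning
    sampleSum-subsequences K [] large (suc r) g = ≤-trans (≤-reflexive (*-zeroʳ (n ^ suc r))) z≤n
    sampleSum-subsequences K (b ∷ bs) (n≤K ∷ large) (suc r) g = begin
      n ^ suc r * ∑ (part b) (λ v → sampleSum bs (λ es → subsequenceSum r (g ∘ (v ∷_)) (map vertex es) + subsequenceSum (suc r) g (map vertex es)))
        ≡⟨ cong (n ^ suc r *_) (≡.trans (∑-cong (part b) (λ v _ → sampleSum-+ bs _ _)) (≡.trans (∑-distrib-+ (part b) _ _) (cong (∑ (part b) X +_) (∑-const (part b) Y)))) ⟩
      n ^ suc r * (∑ (part b) X + size b * Y)
        ≡⟨ l₁ n (n ^ r) (∑ (part b) X) (size b) Y ⟩
      n * (n ^ r * ∑ (part b) X) + size b * (n ^ suc r * Y)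
        ≡⟨ cong (λ z → n * z + size b * (n ^ suc r * Y)) (∑-*ˡ (part b) (n ^ r) X) ⟨
      n * ∑ (part b) (λ v → n ^ r * X v) + size b * (n ^ suc r * Y)
        ≤⟨ +-mono-≤ (*-monoʳ-≤ n (∑-mono (part b) (λ v _ → sampleSum-subsequences K bs large r (g ∘ (v ∷_)))))
                    (*-monoʳ-≤ (size b) (sampleSum-subsequences K bs large (suc r) g)) ⟩
      n * ∑ (part b) (λ v → c * (t * h v)) + size b * (c * (t * H))
        ≤⟨ +-monoˡ-≤ _ (*-monoʳ-≤ n (part≤ b _)) ⟩
      n * ∑ (allFin n) (λ v → c * (t * h v)) + size b * (c * (t * H))
        ≡⟨ cong (λ z → n * z + size b * (c * (t * H))) (≡.trans (∑-*ˡ (allFin n) c _) (cong (c *_) (≡.trans (∑-*ˡ (allFin n) t h) (cong (t *_) (sym (∑-tuples-suc (allFin n) r _)))))) ⟩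
      n * (c * (t * H)) + size b * (c * (t * H))
        ≤⟨ +-monoˡ-≤ _ (*-monoˡ-≤ (c * (t * H)) n≤K) ⟩
      K * size b * (c * (t * H)) + size b * (c * (t * H))
        ≡⟨ l₂ K (size b) c t H ⟩
      (1 + K) * c * (size b * t * H) ∎
      where
      open ≤-Reasoning
      c = (1 + K) ^ length bs
      t = samples bs
      H = ∑ (vertexTuples n (suc r)) (g ∘ toList)
      h : Fin n → ℕ
      h v = ∑ (vertexTuples n r) (λ xs → g (v ∷ toList xs))
      X : Fin n → ℕ
      X v = sampleSum bs (λ es → subsequenceSum r (g ∘ (v ∷_)) (map vertex es))
      Y : ℕ
      Y = sampleSum bs (λ es → subsequenceSum (suc r) g (map vertex es))
      l₁ : ∀ n z x s y → n * z * (x + s * y) ≡ n * (z * x) + s * (n * z * y)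
      l₁ = solve-∀
      l₂ : ∀ K s c t h → K * s * (c * (t * h)) + s * (c * (t * h)) ≡ (1 + K) * c * (s * t * h)
      l₂ = solve-∀

    rare-subsequences : ∀ K C bs .{{_ : NonZero n}} → All (λ b → n ≤ K * size b) bs → ∀ r (g : List (Fin n) → ℕ) →
      (1 + K) ^ length bs * C * ∑ (vertexTuples n r) (g ∘ toList) ≤ n ^ r →
      C * sampleSum bs (λ es → subsequenceSum r g (map vertex es)) ≤ samples bs
    rare-subsequences K C bs large r g few = *-cancelˡ-≤ (n ^ r) {{m^n≢0 n r}} (begin
      n ^ r * (C * S)       ≡⟨ l₁ (n ^ r) C S ⟩
      C * (n ^ r * S)       ≤⟨ *-monoʳ-≤ C (sampleSum-subsequences K bs large r g) ⟩
      C * (c * (t * H))     ≡⟨ l₂ C c t H ⟩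
      t * (c * C * H)       ≤⟨ *-monoʳ-≤ t few ⟩
      t * n ^ r             ≡⟨ *-comm t (n ^ r) ⟩
      n ^ r * t             ∎)
      where
      open ≤-Reasoning
      c = (1 + K) ^ length bs
      t = samples bs
      H = ∑ (vertexTuples n r) (g ∘ toList)
      S = sampleSum bs (λ es → subsequenceSum r g (map vertex es))
      l₁ : ∀ a b c → a * (b * c) ≡ b * (a * c)
      l₁ = solve-∀
      l₂ : ∀ C c t H → C * (c * (t * H)) ≡ t * (c * C * H)
      l₂ = solve-∀

    samples>0 : ∀ K bs .{{_ : NonZero n}} → All (λ b → n ≤ K * size b) bs → 1 ≤ samples bs
    samples>0 K []       []            = ≤-refl
    samples>0 K (b ∷ bs) (n≤K ∷ large) = *-mono-≤ (pos (size b) n≤K) (samples>0 K bs large)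
      where
      pos : ∀ s → n ≤ K * s → 1 ≤ s
      pos zero    le = contradiction (≤-trans le (≤-reflexive (*-zeroʳ K))) (<⇒≱ (>-nonZero⁻¹ n))
      pos (suc s) _  = s≤s z≤n

    size₁ size₂ : Bool → ℕ
    size₁ b = if b then size b else 0
    size₂ b = if b then 0 else size b

    sample-weight : ∀ {bs es} → Pointwise From bs es → ∑ es weight ≡ ∑ bs size₁ + ∑ bs size₂
    sample-weight [] = refl
    sample-weight {b ∷ bs} ((_ , refl , _) ∷ from) = ≡.trans (cong (size b +_) (sample-weight from)) (lem b (∑ bs size₁) (∑ bs size₂))
      where
      lem : ∀ b x y → size b + (x + y) ≡ size₁ b + x + (size₂ b + y)
      lem true  x y = sym (+-assoc (size true) x y)
      lem false x y = lem′ (size false) x y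
        where
        lem′ : ∀ s x y → s + (x + y) ≡ x + (s + y)
        lem′ = solve-∀

    sample-weight₁ : ∀ {bs es} → Pointwise From bs es → ∑ es weight₁ ≡ ∑ bs size₁
    sample-weight₁ [] = refl
    sample-weight₁ ((refl , refl , _) ∷ from) = cong (_ +_) (sample-weight₁ from)

    sample-labelled : ∀ {P : Fin n → Set} → (∀ v → v ∈ part true → P v) → ∀ {bs es} → Pointwise From bs es →
                      All (λ x → label x ≡ true → P (vertex x)) es
    sample-labelled part⊆P [] = []
    sample-labelled part⊆P ((refl , _ , v∈) ∷ from) = (λ { refl → part⊆P _ v∈ }) ∷ sample-labelled part⊆P from

    module _ {P : Fin n → Set} (P? : U.Decidable P) (part⊆P : ∀ v → v ∈ part true → P v)
             (p q : ℕ) .{{_ : NonZero p}} .{{_ : NonZero q}} (bs : List Bool)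
             (ratio : p * ∑ bs size₂ ≤ q * ∑ bs size₁) where
      open Cliques G

      private
        A = ∑ bs size₁
        B = ∑ bs size₂
        Z = q * (A * A) + p * (B * B)
        t = samples bs

      -- If this vanishes, symmetrisation applies to the sample; otherwise it is at least 1.
      badness : List Entry → ℕ
      badness es = subsequenceSum (suc p) (cliqueIn P?) (map vertex es) + subsequenceSum (suc (p + q)) (cliqueIn U?) (map vertex es)

      -- For a bad sample the error term `Z * badness es` already pays for the `Z` on the left, and
      -- the trivial bound on the edge weight does the rest.
      sample-bound : ∀ es → Pointwise From bs es →
        p * q * (2 * edgeWeight es) + Z ≤ p * q * ((A + B) * (A + B)) + Z * badness es
      sample-bound es from = go (badness es) refl
        where
        go : ∀ k → badness es ≡ k → p * q * (2 * edgeWeight es) + Z ≤ p * q * ((A + B) * (A + B)) + Z * k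
        go zero eq = ≤-trans (symmetrisation-bound p q A B ratio P es (sample-weight from) (sample-weight₁ from)
            (sample-labelled part⊆P from)
            (λ us → clique-size P? p (m+n≡0⇒m≡0 _ eq))
            (λ us sub pairs → clique-size U? (p + q) (m+n≡0⇒n≡0 (subsequenceSum (suc p) (cliqueIn P?) (map vertex es)) eq) sub pairs (All.universal (λ _ → tt) us)))
          (m≤m+n _ _)
        go (suc k) _ = +-mono-≤ (*-monoʳ-≤ (p * q) (≤-trans (m+n≤o⇒m≤o (2 * edgeWeight es) (edgeWeight-bound es))
            (≤-reflexive (cong (λ w → w * w) (sample-weight from)))))
          (m≤m*n Z (suc k))

      -- `sample-bound` is averaged over all samples. Each of the two kinds of forbidden clique has
      -- expected number at most 1/(2 C), so the expected badness is at most 1/C.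
      sampling : ∀ K C .{{_ : NonZero n}} → All (λ b → n ≤ K * size b) bs →
        (1 + K) ^ length bs * (2 * C) * cliques P? (suc p) ≤ n ^ suc p →
        (1 + K) ^ length bs * (2 * C) * cliques U? (suc (p + q)) ≤ n ^ suc (p + q) →
        C * (p * q * (2 * pairEdges bs) + Z) ≤ C * (p * q * ((A + B) * (A + B))) + Z
      sampling K C large few₁ few₂ = *-cancelˡ-≤ t {{>-nonZero (samples>0 K bs large)}} (begin
        t * (C * (p * q * (2 * pairEdges bs) + Z))
          ≡⟨ l₁ t C (p * q) (pairEdges bs) Z ⟩
        C * (p * q * (2 * (t * pairEdges bs)) + t * Z)
          ≡⟨ cong (λ z → C * (p * q * (2 * z) + t * Z)) (sampleSum-edgeWeight bs) ⟨
        C * (p * q * (2 * sampleSum bs edgeWeight) + t * Z)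
          ≡⟨ cong (C *_) (≡.trans (sampleSum-+ bs _ _) (cong₂ _+_ (≡.trans (sampleSum-*ˡ bs (p * q) _) (cong (p * q *_) (sampleSum-*ˡ bs 2 edgeWeight))) (sampleSum-const bs Z))) ⟨
        C * sampleSum bs (λ es → p * q * (2 * edgeWeight es) + Z)
          ≤⟨ *-monoʳ-≤ C (sampleSum-mono bs sample-bound) ⟩
        C * sampleSum bs (λ es → p * q * ((A + B) * (A + B)) + Z * badness es)
          ≡⟨ cong (C *_) (≡.trans (sampleSum-+ bs _ _) (cong₂ _+_ (sampleSum-const bs _) (sampleSum-*ˡ bs Z badness))) ⟩
        C * (t * (p * q * ((A + B) * (A + B))) + Z * sampleSum bs badness)
          ≡⟨ l₂ C t (p * q * ((A + B) * (A + B))) Z (sampleSum bs badness) ⟩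
        t * (C * (p * q * ((A + B) * (A + B)))) + Z * (C * sampleSum bs badness)
          ≤⟨ +-monoʳ-≤ _ (*-monoʳ-≤ Z bad) ⟩
        t * (C * (p * q * ((A + B) * (A + B)))) + Z * t
          ≡⟨ l₃ t (C * (p * q * ((A + B) * (A + B)))) Z ⟩
        t * (C * (p * q * ((A + B) * (A + B))) + Z) ∎)
        where
        open ≤-Reasoning
        l₁ : ∀ t C P R Z → t * (C * (P * (2 * R) + Z)) ≡ C * (P * (2 * (t * R)) + t * Z)
        l₁ = solve-∀
        l₂ : ∀ C t x Z b → C * (t * x + Z * b) ≡ t * (C * x) + Z * (C * b)
        l₂ = solve-∀
        l₃ : ∀ t x Z → t * x + Z * t ≡ t * (x + Z)
        l₃ = solve-∀

        bad : C * sampleSum bs badness ≤ t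
        bad = *-cancelˡ-≤ 2 (begin
          2 * (C * sampleSum bs badness)
            ≡⟨ ≡.trans (cong (λ z → 2 * (C * z)) (sampleSum-+ bs _ _)) (l₄ C _ _) ⟩
          2 * C * sampleSum bs (λ es → subsequenceSum (suc p) (cliqueIn P?) (map vertex es))
            + 2 * C * sampleSum bs (λ es → subsequenceSum (suc (p + q)) (cliqueIn U?) (map vertex es))
            ≤⟨ +-mono-≤ (rare-subsequences K (2 * C) bs large (suc p) (cliqueIn P?) few₁)
                        (rare-subsequences K (2 * C) bs large (suc (p + q)) (cliqueIn U?) few₂) ⟩
          t + t
            ≡⟨ cong (t +_) (+-identityʳ t) ⟨
          2 * t ∎)
          where
          l₄ : ∀ C x y → 2 * (C * (x + y)) ≡ 2 * C * x + 2 * C * y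
          l₄ = solve-∀

-- From samples to the degree sum of the graph.

module EdgeDensity where
  open FiniteSums
  open Homomorphisms
  open ZykovSymmetrisation
  open CliqueSampling
  open import Data.Bool using (Bool; true; false)
  open import Data.Fin as Fin using (Fin; zero; suc)
  open import Data.Fin.Subset as Subset using (Subset; inside; outside; ∁; ∣_∣)
  open import Data.Fin.Subset.Properties using (_∈?_; x∈∁p⇒x∉p; ∣∁p∣≡n∸∣p∣; ∣p∣≤n)
  open import Data.List using (List; []; _∷_; _++_; map; length; allFin; replicate; cartesianProduct)
  open import Data.List.Membership.Propositional using (_∈_)
  open import Data.List.Membership.Propositional.Properties using (∈-map⁻)
  open import Data.List.Properties using (length-map; length-++; length-replicate)
  open import Data.List.Relation.Unary.All as All using (All; []; _∷_)
  import Data.List.Relation.Unary.All.Properties as All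
  open import Data.List.Relation.Unary.AllPairs using (AllPairs; []; _∷_)
  open import Data.Nat using (ℕ; zero; suc; _+_; _*_; _^_; _≤_; _<_; z≤n; NonZero; _≤?_)
  open import Data.Nat.Properties
  open import Data.Nat.Tactic.RingSolver using (solve-∀)
  open import Data.Product using (_×_; _,_; proj₁; proj₂)
  open import Data.Vec as Vec using (Vec; toList; lookup; []; _∷_)
  open import Data.Vec.Properties using (lookup-map)
  open import Function using (_∘_)
  open import Relation.Binary.PropositionalEquality as ≡ using (_≡_; _≢_; refl; cong; cong₂; sym; subst; subst₂; module ≡-Reasoning)
  open import Relation.Nullary using (Dec; yes; no; ¬_; contradiction)
  open import Relation.Nullary.Decidable using (_×-dec_)
  open import Relation.Unary.Properties using (U?)

  element-∈ : ∀ {n} (M : Subset n) i → element M i Subset.∈ M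
  element-∈ (inside  ∷ M) zero    = Vec.here
  element-∈ (inside  ∷ M) (suc i) = Vec.there (element-∈ M i)
  element-∈ (outside ∷ M) i       = Vec.there (element-∈ M i)

  ∑-element : ∀ {n} (M : Subset n) (f : Fin n → ℕ) →
    ∑ (allFin n) f ≡ ∑ (allFin ∣ M ∣) (f ∘ element M) + ∑ (allFin ∣ ∁ M ∣) (f ∘ element (∁ M))
  ∑-element []                    f = refl
  ∑-element {suc n} (inside  ∷ M) f = begin
    ∑ (allFin (suc n)) f                                             ≡⟨ ∑-allFin-suc n f ⟩
    f zero + ∑ (allFin n) (f ∘ suc)                                  ≡⟨ cong (f zero +_) (∑-element M (f ∘ suc)) ⟩
    f zero + (∑ (allFin ∣ M ∣) (f ∘ suc ∘ element M) + rest)         ≡⟨ +-assoc (f zero) _ rest ⟨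
    f zero + ∑ (allFin ∣ M ∣) (f ∘ suc ∘ element M) + rest           ≡⟨ cong (_+ rest) (∑-allFin-suc ∣ M ∣ (f ∘ element (inside ∷ M))) ⟨
    ∑ (allFin (suc ∣ M ∣)) (f ∘ element (inside ∷ M)) + rest         ∎
    where
    open ≡-Reasoning
    rest = ∑ (allFin ∣ ∁ M ∣) (f ∘ suc ∘ element (∁ M))
  ∑-element {suc n} (outside ∷ M) f = begin
    ∑ (allFin (suc n)) f                                             ≡⟨ ∑-allFin-suc n f ⟩
    f zero + ∑ (allFin n) (f ∘ suc)                                  ≡⟨ cong (f zero +_) (∑-element M (f ∘ suc)) ⟩
    f zero + (rest + ∑ (allFin ∣ ∁ M ∣) (f ∘ suc ∘ element (∁ M)))   ≡⟨ lem (f zero) rest _ ⟩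
    rest + (f zero + ∑ (allFin ∣ ∁ M ∣) (f ∘ suc ∘ element (∁ M)))   ≡⟨ cong (rest +_) (∑-allFin-suc ∣ ∁ M ∣ (f ∘ element (∁ (outside ∷ M)))) ⟨
    rest + ∑ (allFin (suc ∣ ∁ M ∣)) (f ∘ element (∁ (outside ∷ M)))  ∎
    where
    open ≡-Reasoning
    rest = ∑ (allFin ∣ M ∣) (f ∘ suc ∘ element M)
    lem : ∀ a b c → a + (b + c) ≡ b + (a + c)
    lem = solve-∀

  ∑-zero : ∀ {A : Set} (xs : List A) {f : A → ℕ} → (∀ x → f x ≡ 0) → ∑ xs f ≡ 0
  ∑-zero xs f≡0 = ≡.trans (∑-cong xs (λ x _ → f≡0 x)) (≡.trans (∑-const xs 0) (*-zeroʳ (length xs)))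

  ∑-vertexTuples-within : ∀ {n} (M : Subset n) r (g : Vec (Fin n) r → ℕ) →
    (∀ xs → ¬ All (Subset._∈ M) (toList xs) → g xs ≡ 0) →
    ∑ (vertexTuples n r) g ≡ ∑ (vertexTuples ∣ M ∣ r) (g ∘ Vec.map (element M))
  ∑-vertexTuples-within M zero    g zero-outside = refl
  ∑-vertexTuples-within {n} M (suc r) g zero-outside = begin
    ∑ (vertexTuples n (suc r)) g
      ≡⟨ ∑-tuples-suc (allFin n) r g ⟩
    ∑ (allFin n) (λ x → ∑ (vertexTuples n r) (g ∘ (x ∷_)))
      ≡⟨ ∑-element M _ ⟩
    ∑ (allFin ∣ M ∣) (λ i → ∑ (vertexTuples n r) (g ∘ (element M i ∷_))) + ∑ (allFin ∣ ∁ M ∣) (λ i → ∑ (vertexTuples n r) (g ∘ (element (∁ M) i ∷_)))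
      ≡⟨ cong₂ _+_
           (∑-cong (allFin ∣ M ∣) (λ i _ → ∑-vertexTuples-within M r (g ∘ (element M i ∷_)) (λ xs ¬all → zero-outside _ (¬all ∘ All.tail))))
           (∑-zero (allFin ∣ ∁ M ∣) (λ i → ∑-zero (vertexTuples n r) (λ xs → zero-outside _ (x∈∁p⇒x∉p (element-∈ (∁ M) i) ∘ All.head)))) ⟩
    ∑ (allFin ∣ M ∣) (λ i → ∑ (vertexTuples ∣ M ∣ r) (λ ys → g (element M i ∷ Vec.map (element M) ys))) + 0
      ≡⟨ +-identityʳ _ ⟩
    ∑ (allFin ∣ M ∣) (λ i → ∑ (vertexTuples ∣ M ∣ r) (λ ys → g (element M i ∷ Vec.map (element M) ys)))
      ≡⟨ ∑-tuples-suc (allFin ∣ M ∣) r _ ⟨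
    ∑ (vertexTuples ∣ M ∣ (suc r)) (g ∘ Vec.map (element M)) ∎
    where open ≡-Reasoning

  AllPairs-lookup : ∀ {n r} (G : Graph n) (xs : Vec (Fin n) r) → AllPairs (Adj G) (toList xs) →
                    ∀ i j → i ≢ j → Adj G (lookup xs i) (lookup xs j)
  AllPairs-lookup G (x ∷ xs) (px ∷ pairs) zero    zero    i≢j = contradiction refl i≢j
  AllPairs-lookup G (x ∷ xs) (px ∷ pairs) zero    (suc j) _   = All-lookup px j
    where
    All-lookup : ∀ {P : Fin _ → Set} {r} {xs : Vec (Fin _) r} → All P (toList xs) → ∀ j → P (lookup xs j)
    All-lookup {xs = x ∷ xs} (p ∷ ps) zero    = p
    All-lookup {xs = x ∷ xs} (p ∷ ps) (suc j) = All-lookup ps j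
  AllPairs-lookup G (x ∷ xs) (px ∷ pairs) (suc i) zero    i≢j = Graph.symmetric G (AllPairs-lookup G (x ∷ xs) (px ∷ pairs) zero (suc i) (i≢j ∘ sym))
  AllPairs-lookup G (x ∷ xs) (px ∷ pairs) (suc i) (suc j) i≢j = AllPairs-lookup G xs pairs i j (i≢j ∘ cong suc)

  AllPairs⇒multipartite : ∀ {n r} (G : Graph n) (xs : Vec (Fin n) r) → AllPairs (Adj G) (toList xs) → Multipartite (Vec.allFin r) G xs
  AllPairs⇒multipartite G xs pairs i j ≢ = AllPairs-lookup G xs pairs i j (≢ ∘ cong (lookup (Vec.allFin _)))

  cliques≤homs : ∀ {n} (G : Graph n) r → Cliques.cliques G U? r ≤ homs (Vec.allFin r) G
  cliques≤homs {n} G r = ∑-mono (vertexTuples n r) (λ xs _ →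
    𝟙-mono (Cliques.cliqueIn? G U? (toList xs)) (multipartite? (Vec.allFin r) G xs) (AllPairs⇒multipartite G xs ∘ proj₁))

  cliques≤homs-induced : ∀ {n} (G : Graph n) (M : Subset n) r → Cliques.cliques G (_∈? M) r ≤ homs (Vec.allFin r) (induced G M)
  cliques≤homs-induced {n} G M r = ≤-trans
    (≤-reflexive (∑-vertexTuples-within M r _ (λ xs ¬all → 𝟙-no (cliqueIn? (toList xs)) (¬all ∘ proj₂))))
    (∑-mono (vertexTuples ∣ M ∣ r) (λ ys _ → 𝟙-mono (cliqueIn? (toList (Vec.map (element M) ys))) (multipartite? (Vec.allFin r) (induced G M) ys)
      (λ (pairs , _) i j ≢ → subst₂ (Adj G) (lookup-map i (element M) ys) (lookup-map j (element M) ys)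
        (AllPairs⇒multipartite G (Vec.map (element M) ys) pairs i j ≢))))
    where open Cliques G (_∈? M)

  𝟙-disjoint : {P Q R : Set} (P? : Dec P) (Q? : Dec Q) (R? : Dec R) → (P → R) → (Q → R) → (P → ¬ Q) → 𝟙 P? + 𝟙 Q? ≤ 𝟙 R?
  𝟙-disjoint (yes p) (yes q) R? _   _   dis = contradiction q (dis p)
  𝟙-disjoint (yes p) (no _)  R? P⇒R _   _   = ≤-reflexive (sym (𝟙-yes R? (P⇒R p)))
  𝟙-disjoint (no _)  Q?      R? _   Q⇒R _   = 𝟙-mono Q? R? Q⇒R

  -- Handshake count: an edge contributes to the degree sum once for each of its two orders.
  e≤half : ∀ {n} (G : Graph n) → 2 * e G ≤ ∑ (allFin n) (λ u → ∑ (allFin n) (λ v → 𝟙 (Adj? G u v)))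
  e≤half {n} G = begin
    2 * e G
      ≡⟨ cong (e G +_) (+-identityʳ (e G)) ⟩
    e G + e G
      ≡⟨ cong₂ _+_ e≡ (≡.trans e≡ (∑-swap V V _)) ⟩
    ∑ V (λ u → ∑ V (λ v → 𝟙 (edge? u v))) + ∑ V (λ u → ∑ V (λ v → 𝟙 (edge? v u)))
      ≡⟨ ≡.trans (∑-cong V (λ u _ → ∑-distrib-+ V _ _)) (∑-distrib-+ V _ _) ⟨
    ∑ V (λ u → ∑ V (λ v → 𝟙 (edge? u v) + 𝟙 (edge? v u)))
      ≤⟨ ∑-mono V (λ u _ → ∑-mono V (λ v _ → 𝟙-disjoint (edge? u v) (edge? v u) (Adj? G u v)
           proj₂ (Graph.symmetric G ∘ proj₂) (λ (u<v , _) (v<u , _) → <-asym u<v v<u))) ⟩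
    ∑ V (λ u → ∑ V (λ v → 𝟙 (Adj? G u v))) ∎
    where
    open ≤-Reasoning
    V = allFin n
    edge? : ∀ u v → Dec (u Fin.< v × Adj G u v)
    edge? u v = (u Fin.<? v) ×-dec Adj? G u v
    e≡ : e G ≡ ∑ V (λ u → ∑ V (λ v → 𝟙 (edge? u v)))
    e≡ = ≡.trans (length-filter (λ (u , v) → edge? u v) (cartesianProduct V V)) (∑-cartesianProductWith _,_ V V _)

  ∑-replicate : ∀ {A : Set} L (x : A) (f : A → ℕ) → ∑ (replicate L x) f ≡ L * f x
  ∑-replicate zero    x f = refl
  ∑-replicate (suc L) x f = cong (f x +_) (∑-replicate L x f)

  -- The loss of L d in R comes from pairs of sampled vertices with equal
  -- indices, the summand L² Z on the right from samples containing a clique.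
  cancel-samples : ∀ L P R X d Z N .{{_ : NonZero L}} → 2 * R + L * d ≡ L * L * X → d ≤ N → Z ≤ P * N →
    L * (P * (2 * R) + L * L * Z) ≤ L * (P * (L * L * N)) + L * L * Z →
    L * (P * X + Z) ≤ L * (P * N) + 2 * (P * N)
  cancel-samples L P R X d Z N pairs d≤N Z≤PN le = *-cancelˡ-≤ (L * L) {{m*n≢0 L L}} (begin
    L * L * (L * (P * X + Z))
      ≡⟨ l₁ L P X Z ⟩
    L * (P * (L * L * X) + L * L * Z)
      ≡⟨ cong (λ z → L * (P * z + L * L * Z)) pairs ⟨
    L * (P * (2 * R + L * d) + L * L * Z)
      ≡⟨ l₂ L P R d Z ⟩
    L * (P * (2 * R) + L * L * Z) + L * L * (P * d)
      ≤⟨ +-mono-≤ le (*-monoʳ-≤ (L * L) (*-monoʳ-≤ P d≤N)) ⟩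
    L * (P * (L * L * N)) + L * L * Z + L * L * (P * N)
      ≤⟨ +-monoˡ-≤ _ (+-monoʳ-≤ (L * (P * (L * L * N))) (*-monoʳ-≤ (L * L) Z≤PN)) ⟩
    L * (P * (L * L * N)) + L * L * (P * N) + L * L * (P * N)
      ≡⟨ l₃ L P N ⟩
    L * L * (L * (P * N) + 2 * (P * N)) ∎)
    where
    open ≤-Reasoning
    l₁ : ∀ L P X Z → L * L * (L * (P * X + Z)) ≡ L * (P * (L * L * X) + L * L * Z)
    l₁ = solve-∀
    l₂ : ∀ L P R d Z → L * (P * (2 * R + L * d) + L * L * Z) ≡ L * (P * (2 * R) + L * L * Z) + L * L * (P * d)
    l₂ = solve-∀
    l₃ : ∀ L P N → L * (P * (L * L * N)) + L * L * (P * N) + L * L * (P * N) ≡ L * L * (L * (P * N) + 2 * (P * N))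
    l₃ = solve-∀

  -- This is `(1 + K) ^ (L + L) * (2 * L)` for the `K` and `L` chosen below, the rarity that
  -- `sampling` demands for `2 * L` positions and `C = L`.
  cliqueThreshold : ℕ → ℕ → ℕ → ℕ
  cliqueThreshold p q E = (1 + (2 * E + (p + q))) ^ (4 * E + 4 * E) * (2 * (4 * E))

  module Density {n : ℕ} .{{_ : NonZero n}} (G : Graph n) (M : Subset n) where
    open Symmetrisation G using (a)

    private
      m = ∣ M ∣
      k = ∣ ∁ M ∣

    part : Bool → List (Fin n)
    part true  = map (element M) (allFin m)
    part false = map (element (∁ M)) (allFin k)

    ∑-part : ∀ f → ∑ (allFin n) f ≡ ∑ (part true) f + ∑ (part false) f
    ∑-part f = ≡.trans (∑-element M f) (sym (cong₂ _+_ (∑-map (element M) (allFin m) f) (∑-map (element (∁ M)) (allFin k) f)))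

    part≤ : ∀ b h → ∑ (part b) h ≤ ∑ (allFin n) h
    part≤ true  h = ≤-trans (m≤m+n _ _) (≤-reflexive (sym (∑-part h)))
    part≤ false h = ≤-trans (m≤n+m _ (∑ (part true) h)) (≤-reflexive (sym (∑-part h)))

    open Sampling G part part≤

    size-true : size true ≡ m
    size-true = ≡.trans (length-map (element M) (allFin m)) (length-allFin m)

    size-false : size false ≡ k
    size-false = ≡.trans (length-map (element (∁ M)) (allFin k)) (length-allFin k)

    m+k≡n : m + k ≡ n
    m+k≡n = ≡.trans (cong (m +_) (∣∁p∣≡n∸∣p∣ M)) (m+[n∸m]≡n (∣p∣≤n M))

    part⊆M : ∀ v → v ∈ part true → v Subset.∈ M
    part⊆M v v∈ with ∈-map⁻ (element M) v∈
    ... | i , _ , refl = element-∈ M i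

    edgesBetween≤ : ∀ b b′ → edgesBetween b b′ ≤ size b * size b′
    edgesBetween≤ b b′ = ≤-trans
      (∑-mono (part b) (λ u _ → ≤-trans (∑-mono (part b′) (λ v _ → 𝟙≤1 (Adj? G u v))) (≤-reflexive (∑-one (part b′)))))
      (≤-reflexive (∑-const (part b) (size b′)))

    degreeSum : ℕ
    degreeSum = ∑ (allFin n) (λ u → ∑ (allFin n) (a u))

    degreeSum-split : degreeSum ≡ edgesBetween true true + 2 * edgesBetween true false + edgesBetween false false
    degreeSum-split = begin
      ∑ (allFin n) (λ u → ∑ (allFin n) (a u))
        ≡⟨ ≡.trans (∑-part _) (cong₂ _+_ (split true) (split false)) ⟩
      edgesBetween true true + edgesBetween true false + (edgesBetween false true + edgesBetween false false)
        ≡⟨ cong (λ z → edgesBetween true true + edgesBetween true false + (z + edgesBetween false false)) (edgesBetween-sym false true) ⟩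
      edgesBetween true true + edgesBetween true false + (edgesBetween true false + edgesBetween false false)
        ≡⟨ lem (edgesBetween true true) (edgesBetween true false) (edgesBetween false false) ⟩
      edgesBetween true true + 2 * edgesBetween true false + edgesBetween false false ∎
      where
      open ≡-Reasoning
      split : ∀ b → ∑ (part b) (λ u → ∑ (allFin n) (a u)) ≡ edgesBetween b true + edgesBetween b false
      split b = ≡.trans (∑-cong (part b) (λ u _ → ∑-part (a u))) (∑-distrib-+ (part b) _ _)
      lem : ∀ x y z → x + y + (y + z) ≡ x + 2 * y + z
      lem = solve-∀

    module _ (p q E : ℕ) .{{_ : NonZero p}} .{{_ : NonZero q}} .{{_ : NonZero E}} (ratio : p * k ≤ q * m) where

      -- `L` is the number of positions per sampled part. In `K`, the summand `p + q` ensures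
      -- `n ≤ K * m` by `ratio`, and `2 * E` makes a complement with fewer than n/`K` vertices
      -- negligible.
      L K : ℕ
      L = 4 * E
      K = 2 * E + (p + q)

      private
        instance
          L≢0 : NonZero L
          L≢0 = m*n≢0 4 E

      threshold : ℕ
      threshold = cliqueThreshold p q E

      Z P : ℕ
      Z = q * (m * m) + p * (k * k)
      P = p * q

      private
        n≤Km : n ≤ K * m
        n≤Km = begin
          n                ≤⟨ m≤n*m n p ⟩
          p * n            ≡⟨ cong (p *_) m+k≡n ⟨
          p * (m + k)      ≡⟨ *-distribˡ-+ p m k ⟩
          p * m + p * k    ≤⟨ +-monoʳ-≤ (p * m) ratio ⟩
          p * m + q * m    ≡⟨ *-distribʳ-+ m p q ⟨
          (p + q) * m      ≤⟨ *-monoˡ-≤ m (m≤n+m (p + q) (2 * E)) ⟩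
          K * m            ∎
          where open ≤-Reasoning

        qX≤PX : ∀ x → q * x ≤ P * x
        qX≤PX x = *-monoˡ-≤ x (m≤n*m q p)

        pX≤PX : ∀ x → p * x ≤ P * x
        pX≤PX x = *-monoˡ-≤ x (m≤m*n p q)

        mm+kk≤nn : m * m + k * k ≤ n * n
        mm+kk≤nn = ≤-trans (m≤m+n _ (2 * (m * k))) (≤-reflexive (≡.trans (lem m k) (cong (λ z → z * z) m+k≡n)))
          where
          lem : ∀ m k → m * m + k * k + 2 * (m * k) ≡ (m + k) * (m + k)
          lem = solve-∀

        true-large : n ≤ K * size true
        true-large = subst (λ s → n ≤ K * s) (sym size-true) n≤Km

        halve : ∀ x N → L * x ≤ L * (P * N) + 2 * (P * N) → 2 * (E * x) ≤ 2 * (E * (P * N)) + P * N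
        halve x N le = *-cancelˡ-≤ 2 (subst₂ _≤_ (l₁ E x) (l₂ E (P * N)) le)
          where
          l₁ : ∀ E x → 4 * E * x ≡ 2 * (2 * (E * x))
          l₁ = solve-∀
          l₂ : ∀ E y → 4 * E * y + 2 * y ≡ 2 * (2 * (E * y) + y)
          l₂ = solve-∀

      -- The error leaves room for both cases: sampling uses up `P * (n * n)` at most, and the
      -- remainder lets `unbalanced` bound the pairs meeting the complement trivially.
      Target : Set
      Target = 2 * (E * (P * degreeSum + Z)) ≤ 2 * (E * (P * (n * n))) + 2 * (P * (n * n))

      -- Both parts now have at least n/`K` vertices, so `L` positions are drawn from each. Equal
      -- numbers keep the sampled weights proportional to `m` and `k`.
      balanced : n ≤ K * k →
        threshold * Cliques.cliques G (_∈? M) (suc p) ≤ n ^ suc p →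
        threshold * Cliques.cliques G U? (suc (p + q)) ≤ n ^ suc (p + q) → Target
      balanced n≤Kk few₁ few₂ = ≤-trans
        (halve (P * degreeSum + Z) (n * n) (cancel-samples L P (pairEdges bs) degreeSum diagonal Z (n * n) pairs diagonal≤ Z≤ bound))
        (+-monoʳ-≤ (2 * (E * (P * (n * n)))) (m≤n*m (P * (n * n)) 2))
        where
        bs = replicate L true ++ replicate L false

        length-bs : length bs ≡ L + L
        length-bs = ≡.trans (length-++ (replicate L true)) (cong₂ _+_ (length-replicate L) (length-replicate L))

        ∑-bs : ∀ f → ∑ bs f ≡ L * f true + L * f false
        ∑-bs f = ≡.trans (∑-++ (replicate L true) (replicate L false) f) (cong₂ _+_ (∑-replicate L true f) (∑-replicate L false f))

        A≡ : ∑ bs size₁ ≡ L * m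
        A≡ = ≡.trans (∑-bs size₁) (≡.trans (cong (L * size true +_) (*-zeroʳ L)) (≡.trans (+-identityʳ _) (cong (L *_) size-true)))

        B≡ : ∑ bs size₂ ≡ L * k
        B≡ = ≡.trans (∑-bs size₂) (cong₂ _+_ (*-zeroʳ L) (cong (L *_) size-false))

        diagonal = edgesBetween true true + edgesBetween false false

        diagonal≤ : diagonal ≤ n * n
        diagonal≤ = ≤-trans (+-mono-≤ (≤-trans (edgesBetween≤ true true) (≤-reflexive (cong₂ _*_ size-true size-true)))
                                      (≤-trans (edgesBetween≤ false false) (≤-reflexive (cong₂ _*_ size-false size-false)))) mm+kk≤nn

        pairs : 2 * pairEdges bs + L * diagonal ≡ L * L * degreeSum
        pairs = begin
          2 * pairEdges bs + L * diagonal
            ≡⟨ cong (2 * pairEdges bs +_) (≡.trans (*-distribˡ-+ L _ _) (sym (∑-bs (λ b → edgesBetween b b)))) ⟩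
          2 * pairEdges bs + ∑ bs (λ b → edgesBetween b b)
            ≡⟨ pairEdges-double bs ⟩
          ∑ bs (λ b → ∑ bs (edgesBetween b))
            ≡⟨ ≡.trans (∑-bs _) (cong₂ (λ x y → L * x + L * y) (∑-bs (edgesBetween true)) (∑-bs (edgesBetween false))) ⟩
          L * (L * edgesBetween true true + L * edgesBetween true false) + L * (L * edgesBetween false true + L * edgesBetween false false)
            ≡⟨ cong (λ z → L * (L * edgesBetween true true + L * edgesBetween true false) + L * (L * z + L * edgesBetween false false)) (edgesBetween-sym false true) ⟩
          L * (L * edgesBetween true true + L * edgesBetween true false) + L * (L * edgesBetween true false + L * edgesBetween false false)
            ≡⟨ lem L (edgesBetween true true) (edgesBetween true false) (edgesBetween false false) ⟩
          L * L * (edgesBetween true true + 2 * edgesBetween true false + edgesBetween false false)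
            ≡⟨ cong (L * L *_) degreeSum-split ⟨
          L * L * degreeSum ∎
          where
          open ≡-Reasoning
          lem : ∀ L x y z → L * (L * x + L * y) + L * (L * y + L * z) ≡ L * L * (x + 2 * y + z)
          lem = solve-∀

        Z≤ : Z ≤ P * (n * n)
        Z≤ = ≤-trans (+-mono-≤ (qX≤PX (m * m)) (pX≤PX (k * k))) (≤-trans (≤-reflexive (sym (*-distribˡ-+ P (m * m) (k * k)))) (*-monoʳ-≤ P mm+kk≤nn))

        large : All (λ b → n ≤ K * size b) bs
        large = All.++⁺ (All.replicate⁺ L true-large) (All.replicate⁺ L (subst (λ s → n ≤ K * s) (sym size-false) n≤Kk))

        ratio′ : p * ∑ bs size₂ ≤ q * ∑ bs size₁
        ratio′ = subst₂ (λ A B → p * B ≤ q * A) (sym A≡) (sym B≡) (subst₂ _≤_ (lem L p k) (lem L q m) (*-monoʳ-≤ L ratio))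
          where
          lem : ∀ L p k → L * (p * k) ≡ p * (L * k)
          lem = solve-∀

        bound : L * (P * (2 * pairEdges bs) + L * L * Z) ≤ L * (P * (L * L * (n * n))) + L * L * Z
        bound = subst₂ _≤_
          (≡.trans (cong₂ (λ A B → L * (P * (2 * pairEdges bs) + (q * (A * A) + p * (B * B)))) A≡ B≡)
                   (cong (λ z → L * (P * (2 * pairEdges bs) + z)) (z-scale L p q m k)))
          (≡.trans (cong₂ (λ A B → L * (P * ((A + B) * (A + B))) + (q * (A * A) + p * (B * B))) A≡ B≡)
                   (cong₂ (λ x z → L * (P * x) + z) (≡.trans (square L m k) (cong (λ z → L * L * (z * z)) m+k≡n)) (z-scale L p q m k)))
          (sampling (_∈? M) part⊆M p q bs ratio′ K L large
            (subst (λ l → (1 + K) ^ l * (2 * L) * Cliques.cliques G (_∈? M) (suc p) ≤ n ^ suc p) (sym length-bs) few₁)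
            (subst (λ l → (1 + K) ^ l * (2 * L) * Cliques.cliques G U? (suc (p + q)) ≤ n ^ suc (p + q)) (sym length-bs) few₂))
          where
          z-scale : ∀ L p q m k → q * (L * m * (L * m)) + p * (L * k * (L * k)) ≡ L * L * (q * (m * m) + p * (k * k))
          z-scale = solve-∀
          square : ∀ L m k → (L * m + L * k) * (L * m + L * k) ≡ L * L * ((m + k) * (m + k))
          square = solve-∀

      -- If the complement of M is too small, cliques meeting it need not be rare
      -- among samples, so only M is sampled.
      unbalanced : K * k ≤ n →
        threshold * Cliques.cliques G (_∈? M) (suc p) ≤ n ^ suc p →
        threshold * Cliques.cliques G U? (suc (p + q)) ≤ n ^ suc (p + q) → Target
      unbalanced Kk≤n few₁ few₂ = begin
        2 * (E * (P * degreeSum + Z))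
          -- Pairs meeting the complement are all counted as edges. The term `p * (k * k)` of `Z`
          -- then has to be paid from the slack, which `small` permits because `2 * E * k ≤ n`.
          ≤⟨ *-monoʳ-≤ 2 (*-monoʳ-≤ E (+-monoˡ-≤ Z (*-monoʳ-≤ P degreeSum≤))) ⟩
        2 * (E * (P * (eₘ + 2 * (m * k) + k * k) + Z))
          ≡⟨ l₁ E P eₘ m k p q ⟩
        2 * (E * (P * eₘ + q * (m * m))) + 2 * (E * (P * (2 * (m * k) + k * k))) + p * (2 * E * k * k)
          ≤⟨ +-mono-≤ (+-monoˡ-≤ _ (halve (P * eₘ + q * (m * m)) (m * m) (cancel-samples L P (pairEdges bs) eₘ eₘ (q * (m * m)) (m * m) pairs eₘ≤ (qX≤PX (m * m)) bound))) small ⟩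
        2 * (E * (P * (m * m))) + P * (m * m) + 2 * (E * (P * (2 * (m * k) + k * k))) + P * (n * k)
          ≡⟨ cong (λ z → 2 * (E * (P * (m * m))) + P * (m * m) + 2 * (E * (P * (2 * (m * k) + k * k))) + P * (z * k)) m+k≡n ⟨
        2 * (E * (P * (m * m))) + P * (m * m) + 2 * (E * (P * (2 * (m * k) + k * k))) + P * ((m + k) * k)
          ≤⟨ m≤m+n _ (P * (m * m + 3 * (m * k) + k * k)) ⟩
        2 * (E * (P * (m * m))) + P * (m * m) + 2 * (E * (P * (2 * (m * k) + k * k))) + P * ((m + k) * k) + P * (m * m + 3 * (m * k) + k * k)
          ≡⟨ l₂ E P m k ⟩
        2 * (E * (P * ((m + k) * (m + k)))) + 2 * (P * ((m + k) * (m + k)))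
          ≡⟨ cong (λ z → 2 * (E * (P * (z * z))) + 2 * (P * (z * z))) m+k≡n ⟩
        2 * (E * (P * (n * n))) + 2 * (P * (n * n)) ∎
        where
        open ≤-Reasoning
        bs = replicate L true
        eₘ = edgesBetween true true

        l₁ : ∀ E P e m k p q → 2 * (E * (P * (e + 2 * (m * k) + k * k) + (q * (m * m) + p * (k * k)))) ≡ 2 * (E * (P * e + q * (m * m))) + 2 * (E * (P * (2 * (m * k) + k * k))) + p * (2 * E * k * k)
        l₁ = solve-∀
        l₂ : ∀ E P m k → 2 * (E * (P * (m * m))) + P * (m * m) + 2 * (E * (P * (2 * (m * k) + k * k))) + P * ((m + k) * k) + P * (m * m + 3 * (m * k) + k * k) ≡ 2 * (E * (P * ((m + k) * (m + k)))) + 2 * (P * ((m + k) * (m + k)))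
        l₂ = solve-∀

        small : p * (2 * E * k * k) ≤ P * (n * k)
        small = ≤-trans (*-monoʳ-≤ p (*-monoˡ-≤ k (≤-trans (*-monoˡ-≤ k (m≤m+n (2 * E) (p + q))) Kk≤n))) (pX≤PX (n * k))

        degreeSum≤ : degreeSum ≤ eₘ + 2 * (m * k) + k * k
        degreeSum≤ = ≤-trans (≤-reflexive degreeSum-split) (+-mono-≤ (+-monoʳ-≤ eₘ (*-monoʳ-≤ 2
            (≤-trans (edgesBetween≤ true false) (≤-reflexive (cong₂ _*_ size-true size-false)))))
          (≤-trans (edgesBetween≤ false false) (≤-reflexive (cong₂ _*_ size-false size-false))))

        eₘ≤ : eₘ ≤ m * m
        eₘ≤ = ≤-trans (edgesBetween≤ true true) (≤-reflexive (cong₂ _*_ size-true size-true))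

        A≡ : ∑ bs size₁ ≡ L * m
        A≡ = ≡.trans (∑-replicate L true size₁) (cong (L *_) size-true)

        B≡ : ∑ bs size₂ ≡ 0
        B≡ = ≡.trans (∑-replicate L true size₂) (*-zeroʳ L)

        pairs : 2 * pairEdges bs + L * eₘ ≡ L * L * eₘ
        pairs = begin-equality
          2 * pairEdges bs + L * eₘ                            ≡⟨ cong (2 * pairEdges bs +_) (∑-replicate L true (λ b → edgesBetween b b)) ⟨
          2 * pairEdges bs + ∑ bs (λ b → edgesBetween b b)     ≡⟨ pairEdges-double bs ⟩
          ∑ bs (λ b → ∑ bs (edgesBetween b))                   ≡⟨ ≡.trans (∑-replicate L true _) (cong (L *_) (∑-replicate L true (edgesBetween true))) ⟩
          L * (L * eₘ)                                         ≡⟨ *-assoc L L eₘ ⟨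
          L * L * eₘ                                           ∎

        ratio′ : p * ∑ bs size₂ ≤ q * ∑ bs size₁
        ratio′ = ≤-trans (≤-reflexive (≡.trans (cong (p *_) B≡) (*-zeroʳ p))) z≤n

        -- The threshold is calibrated for `L + L` positions; only `L` are drawn here.
        threshold′ : ∀ {x y} → threshold * x ≤ y → (1 + K) ^ length bs * (2 * L) * x ≤ y
        threshold′ {x} le = ≤-trans (*-monoˡ-≤ x (*-monoˡ-≤ (2 * L) (^-monoʳ-≤ (1 + K) (≤-trans (≤-reflexive (length-replicate L)) (m≤m+n L L))))) le

        bound : L * (P * (2 * pairEdges bs) + L * L * (q * (m * m))) ≤ L * (P * (L * L * (m * m))) + L * L * (q * (m * m))
        bound = subst₂ _≤_
          (≡.trans (cong₂ (λ A B → L * (P * (2 * pairEdges bs) + (q * (A * A) + p * (B * B)))) A≡ B≡)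
                   (cong (λ z → L * (P * (2 * pairEdges bs) + z)) (z-scale L p q m)))
          (≡.trans (cong₂ (λ A B → L * (P * ((A + B) * (A + B))) + (q * (A * A) + p * (B * B))) A≡ B≡)
                   (cong₂ (λ x z → L * (P * x) + z) (square L m) (z-scale L p q m)))
          (sampling (_∈? M) part⊆M p q bs ratio′ K L (All.replicate⁺ L true-large) (threshold′ few₁) (threshold′ few₂))
          where
          z-scale : ∀ L p q m → q * (L * m * (L * m)) + p * (0 * 0) ≡ L * L * (q * (m * m))
          z-scale = solve-∀
          square : ∀ L m → (L * m + 0) * (L * m + 0) ≡ L * L * (m * m)
          square = solve-∀

      degreeSum-bound :
        threshold * Cliques.cliques G (_∈? M) (suc p) ≤ n ^ suc p →
        threshold * Cliques.cliques G U? (suc (p + q)) ≤ n ^ suc (p + q) →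
        E * (P * degreeSum + Z) ≤ E * (P * (n * n)) + P * (n * n)
      degreeSum-bound few₁ few₂ = *-cancelˡ-≤ 2 (≤-trans (target (n ≤? K * k)) (≤-reflexive (sym (*-distribˡ-+ 2 (E * (P * (n * n))) (P * (n * n))))))
        where
        target : Dec (n ≤ K * k) → Target
        target (yes n≤Kk) = balanced n≤Kk few₁ few₂
        target (no  n≰Kk) = unbalanced (<⇒≤ (≰⇒> n≰Kk)) few₁ few₂

-- The edge bound in natural numbers, with binomial coefficients.

module EdgeBound where
  open FiniteSums
  open Homomorphisms
  open Copies
  open CliqueSampling
  open EdgeDensity
  open import Data.Fin.Subset using (Subset; ∁; ∣_∣)
  open import Data.Fin.Subset.Properties using (_∈?_; ∣∁p∣≡n∸∣p∣; ∣p∣≤n)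
  open import Data.Nat using (ℕ; zero; suc; _+_; _*_; _∸_; _^_; _≤_; z≤n; s≤s; NonZero; >-nonZero; >-nonZero⁻¹)
  open import Data.Nat.Combinatorics using (_C_; nC1≡n; nCk+nC[k+1]≡[n+1]C[k+1])
  open import Data.Nat.Properties
  open import Data.Nat.Tactic.RingSolver using (solve-∀)
  open import Data.Product using (proj₁; proj₂)
  import Data.Vec as Vec
  open import Relation.Binary.PropositionalEquality using (_≡_; refl; cong; cong₂; sym; subst; module ≡-Reasoning)
  open import Relation.Unary.Properties using (U?)

  2*nC2+n≡n*n : ∀ n → 2 * (n C 2) + n ≡ n * n
  2*nC2+n≡n*n zero    = refl
  2*nC2+n≡n*n (suc n) = begin
    2 * (suc n C 2) + suc n         ≡⟨ cong (λ z → 2 * z + suc n) (nCk+nC[k+1]≡[n+1]C[k+1] n 1) ⟨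
    2 * (n C 1 + n C 2) + suc n     ≡⟨ cong (λ z → 2 * (z + n C 2) + suc n) (nC1≡n n) ⟩
    2 * (n + n C 2) + suc n         ≡⟨ lem n (n C 2) ⟩
    2 * (n C 2) + n + (1 + (n + n)) ≡⟨ cong (_+ (1 + (n + n))) (2*nC2+n≡n*n n) ⟩
    n * n + (1 + (n + n))           ≡⟨ lem′ n ⟩
    suc n * suc n                   ∎
    where
    open ≡-Reasoning
    lem : ∀ n c → 2 * (n + c) + (1 + n) ≡ 2 * c + n + (1 + (n + n))
    lem = solve-∀
    lem′ : ∀ n → n * n + (1 + (n + n)) ≡ (1 + n) * (1 + n)
    lem′ = solve-∀

  module _ {h f : ℕ} (H : Graph h) (F : Graph f) (p q E : ℕ) .{{_ : NonZero p}} .{{_ : NonZero q}} .{{_ : NonZero E}}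
           (H-colouring : Colourable H (suc (p + q))) (F-colouring : Colourable F (suc p)) where

    private
      fewH = few-cliques-if-free H H-colouring (cliqueThreshold p q E)
      fewF = few-cliques-if-few-copies F F-colouring (cliqueThreshold p q E)
      P = p * q

    copyThreshold : ℕ
    copyThreshold = proj₁ fewF

    -- The summands make `n` large enough for supersaturation of `H`, for `m` to exceed
    -- `copyThreshold` (through `n ≤ (p + q) * m`), and for `E ≤ n`.
    orderThreshold : ℕ
    orderThreshold = proj₁ fewH + ((p + q) * suc copyThreshold + E)

    module _ (n : ℕ) .{{_ : NonZero n}} (large : orderThreshold ≤ n) (G : Graph n) (free : (H -free) G) (M : Subset n)
             (ratio : p * (n ∸ ∣ M ∣) ≤ q * ∣ M ∣)
             (few : suc copyThreshold * copies F (induced G M) ≤ ∣ M ∣ ^ f) where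

      private
        m = ∣ M ∣
        k = n ∸ ∣ M ∣

        m+k≡n : m + k ≡ n
        m+k≡n = m+[n∸m]≡n (∣p∣≤n M)

        ratio′ : p * ∣ ∁ M ∣ ≤ q * m
        ratio′ = subst (λ z → p * z ≤ q * m) (sym (∣∁p∣≡n∸∣p∣ M)) ratio

        D<m : suc copyThreshold ≤ m
        D<m = *-cancelˡ-≤ (p + q) {{>-nonZero (≤-trans (>-nonZero⁻¹ p) (m≤m+n p q))}} (begin
          (p + q) * suc copyThreshold         ≤⟨ m≤m+n _ E ⟩
          (p + q) * suc copyThreshold + E     ≤⟨ m+n≤o⇒n≤o (proj₁ fewH) large ⟩
          n                                   ≤⟨ m≤n*m n p ⟩
          p * n                               ≡⟨ cong (p *_) m+k≡n ⟨
          p * (m + k)                         ≡⟨ *-distribˡ-+ p m k ⟩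
          p * m + p * k                       ≤⟨ +-monoʳ-≤ (p * m) ratio ⟩
          p * m + q * m                       ≡⟨ *-distribʳ-+ m p q ⟨
          (p + q) * m                         ∎)
          where
          open ≤-Reasoning

        instance
          m≢0 : NonZero m
          m≢0 = >-nonZero (≤-trans (s≤s z≤n) D<m)

        E≤n : E ≤ n
        E≤n = m+n≤o⇒n≤o ((p + q) * suc copyThreshold) (m+n≤o⇒n≤o (proj₁ fewH) large)

        few-in-M : cliqueThreshold p q E * Cliques.cliques G (_∈? M) (suc p) ≤ n ^ suc p
        few-in-M = begin
          cliqueThreshold p q E * Cliques.cliques G (_∈? M) (suc p)         ≤⟨ *-monoʳ-≤ (cliqueThreshold p q E) (cliques≤homs-induced G M (suc p)) ⟩
          cliqueThreshold p q E * homs (Vec.allFin (suc p)) (induced G M)   ≤⟨ proj₂ fewF m (induced G M) (≤-trans (n≤1+n _) D<m) few ⟩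
          m ^ suc p                                                         ≤⟨ ^-monoˡ-≤ (suc p) (∣p∣≤n M) ⟩
          n ^ suc p                                                         ∎
          where open ≤-Reasoning

        few-in-G : cliqueThreshold p q E * Cliques.cliques G U? (suc (p + q)) ≤ n ^ suc (p + q)
        few-in-G = ≤-trans (*-monoʳ-≤ (cliqueThreshold p q E) (cliques≤homs G (suc (p + q))))
          (proj₂ fewH n G (m+n≤o⇒m≤o (proj₁ fewH) large) free)

        degrees : E * (P * (2 * e G) + (q * (m * m) + p * (k * k))) ≤ E * (P * (n * n)) + P * (n * n)
        degrees = ≤-trans (*-monoʳ-≤ E (+-mono-≤ (*-monoʳ-≤ P (e≤half G))
            (≤-reflexive (cong (λ z → q * (m * m) + p * (z * z)) (sym (∣∁p∣≡n∸∣p∣ M))))))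
          (Density.degreeSum-bound G M p q E ratio′ few-in-M few-in-G)

      -- Doubled binomials are squares minus a linear term. On the left the linear terms may be
      -- added; on the right they cost `n`, at most n²/`E` because `E ≤ n`. With the sampling error
      -- n²/`E` this makes 2 n²/`E` for twice the number of edges.
      edge-bound : E * P * e G + (E * q * (m C 2) + E * p * (k C 2)) ≤ E * P * (m * k + (m C 2 + k C 2)) + P * (n ^ 2)
      edge-bound = *-cancelˡ-≤ 2 (begin
        2 * (E * P * e G + (E * q * Cm + E * p * Ck))
          ≤⟨ m≤m+n _ (E * (q * m + p * k)) ⟩
        2 * (E * P * e G + (E * q * Cm + E * p * Ck)) + E * (q * m + p * k)
          ≡⟨ l₁ E p q (e G) Cm Ck m k ⟩
        E * (P * (2 * e G) + (q * (2 * Cm + m) + p * (2 * Ck + k)))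
          ≡⟨ cong₂ (λ x y → E * (P * (2 * e G) + (q * x + p * y))) (2*nC2+n≡n*n m) (2*nC2+n≡n*n k) ⟩
        E * (P * (2 * e G) + (q * (m * m) + p * (k * k)))
          ≤⟨ degrees ⟩
        E * (P * (n * n)) + P * (n * n)
          ≡⟨ cong (λ z → E * (P * z) + P * (n * n)) nn ⟩
        E * (P * (2 * (m * k + (Cm + Ck)) + n)) + P * (n * n)
          ≡⟨ l₂ E P (m * k + (Cm + Ck)) n ⟩
        2 * (E * P * (m * k + (Cm + Ck))) + P * (E * n) + P * (n * n)
          ≤⟨ +-monoˡ-≤ (P * (n * n)) (+-monoʳ-≤ (2 * (E * P * (m * k + (Cm + Ck)))) (*-monoʳ-≤ P (*-monoˡ-≤ n E≤n))) ⟩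
        2 * (E * P * (m * k + (Cm + Ck))) + P * (n * n) + P * (n * n)
          ≡⟨ l₃ (E * P * (m * k + (Cm + Ck))) P n ⟩
        2 * (E * P * (m * k + (Cm + Ck)) + P * (n * (n * 1))) ∎)
        where
        open ≤-Reasoning
        Cm = m C 2
        Ck = k C 2
        l₁ : ∀ E p q e Cm Ck m k → 2 * (E * (p * q) * e + (E * q * Cm + E * p * Ck)) + E * (q * m + p * k)
             ≡ E * (p * q * (2 * e) + (q * (2 * Cm + m) + p * (2 * Ck + k)))
        l₁ = solve-∀
        l₂ : ∀ E P x n → E * (P * (2 * x + n)) + P * (n * n) ≡ 2 * (E * P * x) + P * (E * n) + P * (n * n)
        l₂ = solve-∀
        l₃ : ∀ x P n → 2 * x + P * (n * n) + P * (n * n) ≡ 2 * (x + P * (n * (n * 1)))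
        l₃ = solve-∀
        l₄ : ∀ m k → m * m + 2 * (m * k) + k * k ≡ (m + k) * (m + k)
        l₄ = solve-∀
        l₅ : ∀ m k x y → (2 * x + m) + 2 * (m * k) + (2 * y + k) ≡ 2 * (m * k + (x + y)) + (m + k)
        l₅ = solve-∀
        nn : n * n ≡ 2 * (m * k + (Cm + Ck)) + n
        nn = begin-equality
          n * n                                        ≡⟨ cong (λ z → z * z) m+k≡n ⟨
          (m + k) * (m + k)                            ≡⟨ l₄ m k ⟨
          m * m + 2 * (m * k) + k * k                  ≡⟨ cong₂ (λ x y → x + 2 * (m * k) + y) (2*nC2+n≡n*n m) (2*nC2+n≡n*n k) ⟨
          2 * Cm + m + 2 * (m * k) + (2 * Ck + k)      ≡⟨ l₅ m k Cm Ck ⟩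
          2 * (m * k + (Cm + Ck)) + (m + k)            ≡⟨ cong (2 * (m * k + (Cm + Ck)) +_) m+k≡n ⟩
          2 * (m * k + (Cm + Ck)) + n                  ∎

-- Passage to rationals and reals.

module Reals where
  open import Data.Integer as ℤ using (+_)
  import Data.Integer.Properties as ℤ
  open import Data.Nat as ℕ using (ℕ; suc; NonZero)
  import Data.Nat.Properties as ℕ
  open import Data.Product using (_×_; _,_; ∃)
  open import Data.Rational using (ℚ; mkℚ; 0ℚ; 1ℚ; _+_; _-_; _*_; _/_; _≤_; _<_; -_; toℚᵘ; Positive; positive; nonNegative; *<*)
  import Data.Rational.Properties as ℚ
  open import Data.Rational.Solver using (module +-*-Solver)
  open import Data.Rational.Unnormalised as ℚᵘ using (mkℚᵘ; *≡*; *≤*)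
  import Data.Rational.Unnormalised.Properties as ℚᵘ
  open import Relation.Binary.PropositionalEquality

  -- Arithmetic of unnormalised rationals involves no gcd, so identities for `fromℕ` and `/` are
  -- transferred there and checked by cross-multiplication.
  toℚᵘ-/ : ∀ i b → toℚᵘ (i / suc b) ℚᵘ.≃ mkℚᵘ i b
  toℚᵘ-/ i b = ℚ.toℚᵘ-fromℚᵘ (mkℚᵘ i b)

  fromℕ-+ : ∀ a b → fromℕ (a ℕ.+ b) ≡ fromℕ a + fromℕ b
  fromℕ-+ a b = ℚ.toℚᵘ-injective (begin
    toℚᵘ (fromℕ (a ℕ.+ b))                  ≈⟨ toℚᵘ-/ (+ (a ℕ.+ b)) 0 ⟩
    mkℚᵘ (+ (a ℕ.+ b)) 0                    ≈⟨ *≡* (cong (ℤ._* (+ 1)) (cong₂ ℤ._+_ (sym (ℤ.*-identityʳ (+ a))) (sym (ℤ.*-identityʳ (+ b))))) ⟩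
    mkℚᵘ (+ a) 0 ℚᵘ.+ mkℚᵘ (+ b) 0          ≈⟨ ℚᵘ.+-cong (toℚᵘ-/ (+ a) 0) (toℚᵘ-/ (+ b) 0) ⟨
    toℚᵘ (fromℕ a) ℚᵘ.+ toℚᵘ (fromℕ b)      ≈⟨ ℚ.toℚᵘ-homo-+ (fromℕ a) (fromℕ b) ⟨
    toℚᵘ (fromℕ a + fromℕ b)                ∎)
    where open import Relation.Binary.Reasoning.Setoid ℚᵘ.≃-setoid

  fromℕ-* : ∀ a b → fromℕ (a ℕ.* b) ≡ fromℕ a * fromℕ b
  fromℕ-* a b = ℚ.toℚᵘ-injective (begin
    toℚᵘ (fromℕ (a ℕ.* b))                  ≈⟨ toℚᵘ-/ (+ (a ℕ.* b)) 0 ⟩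
    mkℚᵘ (+ (a ℕ.* b)) 0                    ≈⟨ *≡* (cong (ℤ._* (+ 1)) (ℤ.pos-* a b)) ⟩
    mkℚᵘ (+ a) 0 ℚᵘ.* mkℚᵘ (+ b) 0          ≈⟨ ℚᵘ.*-cong (toℚᵘ-/ (+ a) 0) (toℚᵘ-/ (+ b) 0) ⟨
    toℚᵘ (fromℕ a) ℚᵘ.* toℚᵘ (fromℕ b)      ≈⟨ ℚ.toℚᵘ-homo-* (fromℕ a) (fromℕ b) ⟨
    toℚᵘ (fromℕ a * fromℕ b)                ∎)
    where open import Relation.Binary.Reasoning.Setoid ℚᵘ.≃-setoid

  /-*-cancel : ∀ a b .{{_ : NonZero b}} → (+ a / b) * fromℕ b ≡ fromℕ a
  /-*-cancel a (suc b) = ℚ.toℚᵘ-injective (begin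
    toℚᵘ ((+ a / suc b) * fromℕ (suc b))          ≈⟨ ℚ.toℚᵘ-homo-* (+ a / suc b) (fromℕ (suc b)) ⟩
    toℚᵘ (+ a / suc b) ℚᵘ.* toℚᵘ (fromℕ (suc b))  ≈⟨ ℚᵘ.*-cong (toℚᵘ-/ (+ a) b) (toℚᵘ-/ (+ suc b) 0) ⟩
    mkℚᵘ (+ a) b ℚᵘ.* mkℚᵘ (+ suc b) 0            ≈⟨ *≡* (trans (ℤ.*-identityʳ (+ a ℤ.* + suc b)) (cong (λ z → + a ℤ.* + suc z) (sym (ℕ.*-identityʳ b)))) ⟩
    mkℚᵘ (+ a) 0                                  ≈⟨ toℚᵘ-/ (+ a) 0 ⟨
    toℚᵘ (fromℕ a)                                ∎)
    where open import Relation.Binary.Reasoning.Setoid ℚᵘ.≃-setoid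

  fromℕ-mono-≤ : ∀ {a b} → a ℕ.≤ b → fromℕ a ≤ fromℕ b
  fromℕ-mono-≤ {a} {b} a≤b = ℚ.toℚᵘ-cancel-≤ (begin
    toℚᵘ (fromℕ a)     ≃⟨ toℚᵘ-/ (+ a) 0 ⟩
    mkℚᵘ (+ a) 0       ≤⟨ *≤* (ℤ.*-monoʳ-≤-nonNeg (+ 1) (ℤ.+≤+ a≤b)) ⟩
    mkℚᵘ (+ b) 0       ≃⟨ toℚᵘ-/ (+ b) 0 ⟨
    toℚᵘ (fromℕ b)     ∎)
    where open ℚᵘ.≤-Reasoning

  fromℕ-cancel-≤ : ∀ {a b} → fromℕ a ≤ fromℕ b → a ℕ.≤ b
  fromℕ-cancel-≤ {a} {b} le = ℤ.drop‿+≤+ (subst₂ ℤ._≤_ (ℤ.*-identityʳ (+ a)) (ℤ.*-identityʳ (+ b)) (ℚᵘ.drop-*≤* (begin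
    mkℚᵘ (+ a) 0       ≃⟨ toℚᵘ-/ (+ a) 0 ⟨
    toℚᵘ (fromℕ a)     ≤⟨ ℚ.toℚᵘ-mono-≤ le ⟩
    toℚᵘ (fromℕ b)     ≃⟨ toℚᵘ-/ (+ b) 0 ⟩
    mkℚᵘ (+ b) 0       ∎)))
    where open ℚᵘ.≤-Reasoning

  0≤fromℕ : ∀ a → 0ℚ ≤ fromℕ a
  0≤fromℕ a = fromℕ-mono-≤ {0} {a} ℕ.z≤n

  fromℕ-positive : ∀ a .{{_ : NonZero a}} → Positive (fromℕ a)
  fromℕ-positive a = positive (ℚ.<-≤-trans (ℚ.positive⁻¹ 1ℚ) (fromℕ-mono-≤ {1} {a} (ℕ.>-nonZero⁻¹ a)))

  /-≤⇒ℕ : ∀ a b c d .{{_ : NonZero b}} .{{_ : NonZero d}} → + a / b ≤ + c / d → a ℕ.* d ℕ.≤ c ℕ.* b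
  /-≤⇒ℕ a b c d le = fromℕ-cancel-≤ (begin
    fromℕ (a ℕ.* d)                       ≡⟨ trans (fromℕ-* a d) (cong (_* fromℕ d) (sym (/-*-cancel a b))) ⟩
    (+ a / b) * fromℕ b * fromℕ d         ≤⟨ ℚ.*-monoʳ-≤-nonNeg (fromℕ d) {{nonNegative (0≤fromℕ d)}} (ℚ.*-monoʳ-≤-nonNeg (fromℕ b) {{nonNegative (0≤fromℕ b)}} le) ⟩
    (+ c / d) * fromℕ b * fromℕ d         ≡⟨ lem (+ c / d) (fromℕ b) (fromℕ d) ⟩
    (+ c / d) * fromℕ d * fromℕ b         ≡⟨ trans (cong (_* fromℕ b) (/-*-cancel c d)) (sym (fromℕ-* c b)) ⟩
    fromℕ (c ℕ.* b)                       ∎)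
    where
    open ℚ.≤-Reasoning
    lem : ∀ x y z → x * y * z ≡ x * z * y
    lem = solve 3 (λ x y z → x :* y :* z := x :* z :* y) refl
      where open +-*-Solver

  <⇒positive-gap : ∀ {x y} → x < y → 0ℚ < y - x × x + (y - x) ≤ y
  <⇒positive-gap {x} {y} x<y = subst (_< y - x) (ℚ.+-inverseʳ x) (ℚ.+-monoˡ-< (- x) x<y) , ℚ.≤-reflexive (lem x y)
    where
    lem : ∀ x y → x + (y - x) ≡ y
    lem = solve 2 (λ x y → x :+ (y :- x) := y) refl
      where open +-*-Solver

  archimedean : ∀ δ → 0ℚ < δ → ∃ λ E → NonZero E × 1ℚ ≤ fromℕ E * δ
  -- The denominator of `δ` serves as `E`, its numerator being at least 1.
  archimedean δ@(mkℚ (+ suc a) d c) _ = suc d , _ , (begin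
    1ℚ                                      ≤⟨ fromℕ-mono-≤ {1} {suc a} (ℕ.s≤s ℕ.z≤n) ⟩
    fromℕ (suc a)                           ≡⟨ /-*-cancel (suc a) (suc d) ⟨
    (+ suc a / suc d) * fromℕ (suc d)       ≡⟨ cong (_* fromℕ (suc d)) (ℚ.↥p/↧p≡p δ) ⟩
    δ * fromℕ (suc d)                       ≡⟨ ℚ.*-comm δ (fromℕ (suc d)) ⟩
    fromℕ (suc d) * δ                       ∎)
    where open ℚ.≤-Reasoning
  archimedean (mkℚ (+ 0) _ _)      (*<* (ℤ.+<+ ()))
  archimedean (mkℚ ℤ.-[1+ _ ] _ _) (*<* ())

  -- After multiplication by `E * p * q` this is `bound` with the subtracted terms moved to the
  -- right; the error `p * q * N` is absorbed by `1 ≤ E * ε`.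
  edge-bound-ℚ : ∀ (p q E : ℕ) .{{_ : NonZero p}} .{{_ : NonZero q}} .{{_ : NonZero E}} (ε : ℚ) → 1ℚ ≤ fromℕ E * ε →
    ∀ edges mk Cm Ck N →
    E ℕ.* (p ℕ.* q) ℕ.* edges ℕ.+ (E ℕ.* q ℕ.* Cm ℕ.+ E ℕ.* p ℕ.* Ck) ℕ.≤ E ℕ.* (p ℕ.* q) ℕ.* (mk ℕ.+ (Cm ℕ.+ Ck)) ℕ.+ p ℕ.* q ℕ.* N →
    fromℕ edges ≤ fromℕ mk + (1ℚ - (+ 1 / p)) * fromℕ Cm + (1ℚ - (+ 1 / q)) * fromℕ Ck + ε * fromℕ N
  edge-bound-ℚ p q E ε 1≤Eε edges mk Cm Ck N bound = ℚ.*-cancelˡ-≤-pos T {{T-pos}} (begin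
    T * e′
      ≡⟨ l₁ E′ P′ e′ p′ q′ C₁ C₂ ⟩
    (E′ * P′ * e′ + (E′ * q′ * C₁ + E′ * p′ * C₂)) - (E′ * q′ * C₁ + E′ * p′ * C₂)
      ≤⟨ ℚ.+-monoˡ-≤ (- (E′ * q′ * C₁ + E′ * p′ * C₂)) (subst₂ _≤_ lhs rhs (fromℕ-mono-≤ bound)) ⟩
    (E′ * P′ * (mk′ + (C₁ + C₂)) + P′ * N′) - (E′ * q′ * C₁ + E′ * p′ * C₂)
      ≤⟨ ℚ.+-monoˡ-≤ (- (E′ * q′ * C₁ + E′ * p′ * C₂)) (ℚ.+-monoʳ-≤ (E′ * P′ * (mk′ + (C₁ + C₂))) ε-bound) ⟩
    (E′ * P′ * (mk′ + (C₁ + C₂)) + P′ * N′ * (E′ * ε)) - (E′ * q′ * C₁ + E′ * p′ * C₂)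
      -- Factors `x * p′` and `y * q′`, both equal to 1, are inserted so that the ring solver can
      -- treat the reciprocals as variables.
      ≡⟨ cong₂ (λ u v → (E′ * P′ * (mk′ + (C₁ + C₂)) + P′ * N′ * (E′ * ε)) - (u + v)) (unit q′ C₁ (/-*-cancel 1 p)) (unit p′ C₂ (/-*-cancel 1 q)) ⟩
    (E′ * P′ * (mk′ + (C₁ + C₂)) + P′ * N′ * (E′ * ε)) - (E′ * q′ * (x * p′) * C₁ + E′ * p′ * (y * q′) * C₂)
      ≡⟨ l₂ E′ p′ q′ mk′ C₁ C₂ N′ ε x y ⟩
    T * (mk′ + (1ℚ - x) * C₁ + (1ℚ - y) * C₂ + ε * N′) ∎)
    where
    open ℚ.≤-Reasoning
    open +-*-Solver
    p′ = fromℕ p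
    q′ = fromℕ q
    P′ = p′ * q′
    E′ = fromℕ E
    e′ = fromℕ edges
    C₁ = fromℕ Cm
    C₂ = fromℕ Ck
    mk′ = fromℕ mk
    N′ = fromℕ N
    x  = + 1 / p
    y  = + 1 / q
    T  = E′ * P′

    l₁ : ∀ E P e p q C₁ C₂ → E * P * e ≡ (E * P * e + (E * q * C₁ + E * p * C₂)) - (E * q * C₁ + E * p * C₂)
    l₁ = solve 7 (λ E P e p q C₁ C₂ → E :* P :* e := (E :* P :* e :+ (E :* q :* C₁ :+ E :* p :* C₂)) :- (E :* q :* C₁ :+ E :* p :* C₂)) refl

    l₂ : ∀ E p q mk C₁ C₂ N ε x y →
      (E * (p * q) * (mk + (C₁ + C₂)) + p * q * N * (E * ε)) - (E * q * (x * p) * C₁ + E * p * (y * q) * C₂)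
      ≡ E * (p * q) * (mk + (1ℚ - x) * C₁ + (1ℚ - y) * C₂ + ε * N)
    l₂ = solve 10 (λ E p q mk C₁ C₂ N ε x y →
      (E :* (p :* q) :* (mk :+ (C₁ :+ C₂)) :+ p :* q :* N :* (E :* ε)) :- (E :* q :* (x :* p) :* C₁ :+ E :* p :* (y :* q) :* C₂)
      := E :* (p :* q) :* (mk :+ (con 1ℚ :- x) :* C₁ :+ (con 1ℚ :- y) :* C₂ :+ ε :* N)) refl

    unit : ∀ r C {u} → u ≡ 1ℚ → E′ * r * C ≡ E′ * r * u * C
    unit r C refl = cong (_* C) (sym (ℚ.*-identityʳ (E′ * r)))

    T-pos : Positive T
    T-pos = ℚ.pos*pos⇒pos E′ {{fromℕ-positive E}} P′ {{ℚ.pos*pos⇒pos p′ {{fromℕ-positive p}} q′ {{fromℕ-positive q}}}}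

    ε-bound : P′ * N′ ≤ P′ * N′ * (E′ * ε)
    ε-bound = begin
      P′ * N′               ≡⟨ ℚ.*-identityʳ (P′ * N′) ⟨
      P′ * N′ * 1ℚ          ≤⟨ ℚ.*-monoˡ-≤-nonNeg (P′ * N′) {{nonNegative 0≤P′N′}} 1≤Eε ⟩
      P′ * N′ * (E′ * ε)    ∎
      where
      0≤P′N′ : 0ℚ ≤ P′ * N′
      0≤P′N′ = subst (0ℚ ≤_) (trans (fromℕ-* (p ℕ.* q) N) (cong (_* N′) (fromℕ-* p q))) (0≤fromℕ (p ℕ.* q ℕ.* N))

    pair : ∀ a b c → fromℕ (a ℕ.* b ℕ.* c) ≡ fromℕ a * fromℕ b * fromℕ c
    pair a b c = trans (fromℕ-* (a ℕ.* b) c) (cong (_* fromℕ c) (fromℕ-* a b))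

    triple : ∀ c → fromℕ (E ℕ.* (p ℕ.* q) ℕ.* c) ≡ E′ * P′ * fromℕ c
    triple c = trans (pair E (p ℕ.* q) c) (cong (λ z → E′ * z * fromℕ c) (fromℕ-* p q))

    lhs : fromℕ (E ℕ.* (p ℕ.* q) ℕ.* edges ℕ.+ (E ℕ.* q ℕ.* Cm ℕ.+ E ℕ.* p ℕ.* Ck)) ≡ E′ * P′ * e′ + (E′ * q′ * C₁ + E′ * p′ * C₂)
    lhs = trans (fromℕ-+ (E ℕ.* (p ℕ.* q) ℕ.* edges) (E ℕ.* q ℕ.* Cm ℕ.+ E ℕ.* p ℕ.* Ck))
      (cong₂ _+_ (triple edges) (trans (fromℕ-+ (E ℕ.* q ℕ.* Cm) (E ℕ.* p ℕ.* Ck)) (cong₂ _+_ (pair E q Cm) (pair E p Ck))))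

    rhs : fromℕ (E ℕ.* (p ℕ.* q) ℕ.* (mk ℕ.+ (Cm ℕ.+ Ck)) ℕ.+ p ℕ.* q ℕ.* N) ≡ E′ * P′ * (mk′ + (C₁ + C₂)) + P′ * N′
    rhs = trans (fromℕ-+ (E ℕ.* (p ℕ.* q) ℕ.* (mk ℕ.+ (Cm ℕ.+ Ck))) (p ℕ.* q ℕ.* N))
      (cong₂ _+_ (trans (triple (mk ℕ.+ (Cm ℕ.+ Ck))) (cong (E′ * P′ *_) (trans (fromℕ-+ mk (Cm ℕ.+ Ck)) (cong (λ z → mk′ + z) (fromℕ-+ Cm Ck))))) (pair p q N))

  -- If `y < x`, the gap separating `x` from `c` would separate `y` from `c` as well.
  fromℚ-<ℝ-trans : ∀ x y c → fromℚ x <ℝ c → c ≤ℝ fromℚ y → x ≤ y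
  fromℚ-<ℝ-trans x y c (δ , 0<δ , N , x+δ≤c) c≤y = ℚ.≮⇒≥ λ y<x → c≤y (δ , 0<δ , N , λ n N≤n →
    ℚ.≤-trans (ℚ.+-monoˡ-≤ δ (ℚ.<⇒≤ y<x)) (x+δ≤c n N≤n))

  fromℚ-≤ℝ-* : ∀ x y z → fromℚ x ≤ℝ fromℚ y *ℝ fromℚ z → x ≤ y * z
  fromℚ-≤ℝ-* x y z x≤yz = ℚ.≮⇒≥ λ yz<x → let 0<gap , ≤x = <⇒positive-gap yz<x in x≤yz (_ , 0<gap , 0 , λ _ _ → ≤x)

  -- A strict gap in the opposite direction would persist at all late indices, so one index beyond
  -- both `N` and `N′` refutes it.
  fromℚ-≤ℝ-+* : ∀ x y z (ε : ℝ) N → (∀ n → N ℕ.≤ n → x ≤ y + seq ε n * z) → fromℚ x ≤ℝ fromℚ y +ℝ ε *ℝ fromℚ z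
  fromℚ-≤ℝ-+* x y z ε N bound (δ , 0<δ , N′ , gap) = ℚ.<-irrefl refl (begin-strict
    rhs            ≡⟨ ℚ.+-identityʳ rhs ⟨
    rhs + 0ℚ       <⟨ ℚ.+-monoʳ-< rhs 0<δ ⟩
    rhs + δ        ≤⟨ gap (N ℕ.⊔ N′) (ℕ.m≤n⊔m N N′) ⟩
    x              ≤⟨ bound (N ℕ.⊔ N′) (ℕ.m≤m⊔n N N′) ⟩
    rhs            ∎)
    where
    open ℚ.≤-Reasoning
    rhs = y + seq ε (N ℕ.⊔ N′) * z

-- Choice of the constants and conclusion.

open EdgeBound
open Reals
open import Data.Fin.Subset using (Subset; ∣_∣)
open import Data.Integer using (+_)
open import Data.Nat using (ℕ; _∸_; _^_; _≤_; _<_; NonZero)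
open import Data.Nat.Combinatorics using (_C_)
open import Data.Nat.Properties using (<-trans)
open import Data.Product using (∃-syntax; _×_; _,_)
open import Data.Rational using (1ℚ; _/_; _+_; _-_; _*_)

theorem3 :
    ∀ {h f : ℕ} (H : Graph h) (F : Graph f)
    (χF<χH : χ F < χ H) (2≤χF : 2 ≤ χ F) →
    let instance
          χF-1≢0 : NonZero (χ F ∸ 1)
          χF-1≢0 = ∸-nonZero 2≤χF
          χH-1≢0 : NonZero (χ H ∸ 1)
          χH-1≢0 = ∸-nonZero (<-trans 2≤χF χF<χH)
          χH-χF≢0 : NonZero (χ H ∸ χ F)
          χH-χF≢0 = ∸-nonZero χF<χH
    in
    (c : ℝ) → fromℚ (+ (χ F ∸ 1) / (χ H ∸ 1)) <ℝ c →
    (ε : ℝ) → 0ℝ <ℝ ε →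
    ∃[ η ] (0ℝ <ℝ η × ∃[ n₀ ]
      (∀ (n : ℕ) .{{_ : NonZero n}} → n₀ ≤ n →
       (G : Graph n) → (H -free) G →
       (M : Subset n) →
       let m = ∣ M ∣ in
       c ≤ℝ fromℚ (+ m / n) →
       fromℚ (fromℕ (copies F (induced G M))) ≤ℝ η *ℝ fromℚ (fromℕ (m ^ f)) →
       fromℚ (fromℕ (e G)) ≤ℝ
         fromℚ (fromℕ m * fromℕ (n ∸ m)
                + (1ℚ - (+ 1 / (χ F ∸ 1))) * fromℕ (m C 2)
                + (1ℚ - (+ 1 / (χ H ∸ χ F))) * fromℕ ((n ∸ m) C 2))
         +ℝ ε *ℝ fromℚ (fromℕ (n ^ 2))))
theorem3 {h} {f} H F χF<χH 2≤χF c p/r<c ε (δ , 0<δ , N , δ≤ε) = fromℚ η , η-pos , orderThreshold H F p q E colH colF ,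
  λ n n₀≤n G free M c≤m/n few →
    let m     = ∣ M ∣
        turán = (1ℚ - (+ 1 / p)) * fromℕ (m C 2)
        rest  = (1ℚ - (+ 1 / q)) * fromℕ ((n ∸ m) C 2)
        bound = edge-bound H F p q E colH colF n n₀≤n G free M
                  (ratio n m (∣p∣≤n M) (fromℚ-<ℝ-trans (+ p / (χ H ∸ 1)) (+ m / n) c p/r<c c≤m/n))
                  (few-copies (copies F (induced G M)) (m ^ f)
                    (fromℚ-≤ℝ-* (fromℕ (copies F (induced G M))) η (fromℕ (m ^ f)) few))
    in fromℚ-≤ℝ-+* (fromℕ (e G)) (fromℕ m * fromℕ (n ∸ m) + turán + rest) (fromℕ (n ^ 2)) ε N λ k N≤k →
         subst (λ mk → fromℕ (e G) ℚ.≤ mk + turán + rest + seq ε k * fromℕ (n ^ 2)) (fromℕ-* m (n ∸ m))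
           (edge-bound-ℚ p q E (seq ε k) (1≤Eε k N≤k) (e G) (m ℕ.* (n ∸ m)) (m C 2) ((n ∸ m) C 2) (n ^ 2) bound)
  where
  open import Data.Fin.Subset.Properties using (∣p∣≤n)
  open import Data.Nat as ℕ using (suc)
  import Data.Nat.Properties as ℕ
  open import Data.Nat.Tactic.RingSolver using (solve-∀)
  open import Data.Product using (proj₁; proj₂)
  open import Data.Rational as ℚ using (ℚ; 0ℚ)
  import Data.Rational.Properties as ℚ
  open import Relation.Binary.PropositionalEquality

  p q E D : ℕ
  p = χ F ∸ 1
  q = χ H ∸ χ F
  -- `δ` is a positive rational below all late terms of `ε`, so a single `E` serves for all of them.
  E = proj₁ (archimedean δ 0<δ)

  instance
    p≢0 : NonZero p
    p≢0 = ∸-nonZero 2≤χF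
    q≢0 : NonZero q
    q≢0 = ∸-nonZero χF<χH
    χH-1≢0 : NonZero (χ H ∸ 1)
    χH-1≢0 = ∸-nonZero (<-trans 2≤χF χF<χH)
    E≢0 : NonZero E
    E≢0 = proj₁ (proj₂ (archimedean δ 0<δ))

  χF≡ : χ F ≡ suc p
  χF≡ = sym (ℕ.m+[n∸m]≡n (ℕ.<⇒≤ 2≤χF))

  χH≡ : χ H ≡ suc (p ℕ.+ q)
  χH≡ = trans (sym (ℕ.m+[n∸m]≡n (ℕ.<⇒≤ χF<χH))) (cong (ℕ._+ q) χF≡)

  colF : Colourable F (suc p)
  colF = subst (Colourable F) χF≡ (proj₁ (proj₂ (leastColouring F)))

  colH : Colourable H (suc (p ℕ.+ q))
  colH = subst (Colourable H) χH≡ (proj₁ (proj₂ (leastColouring H)))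

  -- With `η = 1 / D`, the hypothesis on copies becomes the integer inequality expected by
  -- `edge-bound`.
  D = suc (copyThreshold H F p q E colH colF)

  η : ℚ
  η = + 1 / D

  η-pos : 0ℝ <ℝ fromℚ η
  η-pos = η , positive-η , 0 , λ _ _ → ℚ.≤-reflexive (ℚ.+-identityˡ η)
    where
    positive-η : 0ℚ ℚ.< η
    positive-η = ℚ.positive⁻¹ η {{ℚ.normalize-pos 1 D}}

  few-copies : ∀ x y → fromℕ x ℚ.≤ η * fromℕ y → D ℕ.* x ≤ y
  few-copies x y x≤ηy = fromℕ-cancel-≤ (begin
    fromℕ (D ℕ.* x)               ≡⟨ fromℕ-* D x ⟩
    fromℕ D * fromℕ x             ≤⟨ ℚ.*-monoˡ-≤-nonNeg (fromℕ D) {{ℚ.nonNegative (0≤fromℕ D)}} x≤ηy ⟩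
    fromℕ D * (η * fromℕ y)       ≡⟨ ℚ.*-assoc (fromℕ D) η (fromℕ y) ⟨
    fromℕ D * η * fromℕ y         ≡⟨ cong (_* fromℕ y) (trans (ℚ.*-comm (fromℕ D) η) (/-*-cancel 1 D)) ⟩
    1ℚ * fromℕ y                  ≡⟨ ℚ.*-identityˡ (fromℕ y) ⟩
    fromℕ y                       ∎)
    where open ℚ.≤-Reasoning

  -- As `χ H ∸ 1` is `p + q`, cross-multiplying gives `p * n ≤ (p + q) * m`, and `p * m` cancels.
  ratio : ∀ n m .{{_ : NonZero n}} → m ≤ n → + p / (χ H ∸ 1) ℚ.≤ + m / n → p ℕ.* (n ∸ m) ≤ q ℕ.* m
  ratio n m m≤n p/r≤m/n = ℕ.+-cancelˡ-≤ (p ℕ.* m) _ _ (begin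
    p ℕ.* m ℕ.+ p ℕ.* (n ∸ m)     ≡⟨ ℕ.*-distribˡ-+ p m (n ∸ m) ⟨
    p ℕ.* (m ℕ.+ (n ∸ m))         ≡⟨ cong (p ℕ.*_) (ℕ.m+[n∸m]≡n m≤n) ⟩
    p ℕ.* n                       ≤⟨ /-≤⇒ℕ p (χ H ∸ 1) m n p/r≤m/n ⟩
    m ℕ.* (χ H ∸ 1)               ≡⟨ cong (λ r → m ℕ.* (r ∸ 1)) χH≡ ⟩
    m ℕ.* (p ℕ.+ q)               ≡⟨ lem m p q ⟩
    p ℕ.* m ℕ.+ q ℕ.* m           ∎)
    where
    open ℕ.≤-Reasoning
    lem : ∀ m p q → m ℕ.* (p ℕ.+ q) ≡ p ℕ.* m ℕ.+ q ℕ.* m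
    lem = solve-∀

  1≤Eε : ∀ k → N ≤ k → 1ℚ ℚ.≤ fromℕ E * seq ε k
  1≤Eε k N≤k = ℚ.≤-trans (proj₂ (proj₂ (archimedean δ 0<δ)))
    (ℚ.*-monoˡ-≤-nonNeg (fromℕ E) {{ℚ.nonNegative (0≤fromℕ E)}}
      (subst (ℚ._≤ seq ε k) (ℚ.+-identityˡ δ) (δ≤ε k N≤k)))
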